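{- Let $\mathbb F$ be an algebraically closed field, $G$ a Cayley bigraph on a finite group $\mathcal G$, $L$ a subgraph of $G$, and $0\le k\le\rho(L)$. Then the generic maximum excess of $(L,G,\mathcal G,\mathbb F,k)$ is divisible by $|\mathcal G|$.
   Context: Cayley bigraph on $\mathcal G$ with generators $g_1,g_2$: $V_G=\mathcal G$, $E_G=\mathcal G\times\{1,2\}$, edge $(g,i)$ has tail $g$, head $g_ig$. For $x\in\mathcal G$ and a subgraph $L$, $Lx$ is the image of $L$ under $g\mapsto gx$, $(g,i)\mapsto(gx,i)$; for $P\in V_G\sqcup E_G$, $\mathcal G_L(P)=\{x\in\mathcal G:P\in Lx\}$. For $k\ge0$ and $M\in\mathbb F^{k\times\mathcal G}$ with columns $m^x$, $M$ is $L$-surjective if for every $P$ the columns $m^x$, $x\in\mathcal G_L(P)$, span $\mathbb F^k$; then $\mathcal K_M(L)$ is the sheaf on $G$ with $\mathcal K_M(L)(P)=\{a\in\mathbb F^{\mathcal G}:a_x=0\ \forall x\notin\mathcal G_L(P),\ \sum_xa_xm^x=0\}$ and restriction maps the inclusions. The generic maximum excess of $(L,G,\mathcal G,\mathbb F,k)$ (for $k\le\rho(L)$) is the largest integer $m$ such that the set of $L$-surjective $M\in\mathbb F^{k\times\mathcal G}$ with ${\rm m.e.}(\mathcal K_M(L))\ge m$ is Zariski dense in $\mathbb F^{k\times\mathcal G}$. Maximum excess of a sheaf $\mathcal F$: with $\mathcal F(V)=\bigoplus_v\mathcal F(v)$, $d_h,d_t$ sending $\mathcal F(e)$ into $\mathcal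 F(he)$, $\mathcal F(te)$ by the restriction maps, $\Gamma_{\rm ht}(U)=\bigoplus_e\{w\in\mathcal F(e):d_hw,d_tw\in U\}$ and ${\rm m.e.}(\mathcal F)=\max_{U\subset\mathcal F(V)}(\dim\Gamma_{\rm ht}(U)-\dim U)$. $\rho(L)=\sum_X\max(0,|E_X|-|V_X|)$ over connected components $X$ of $L$ as an undirected graph. -}

module Defs where

open import Level using (Level; _⊔_) renaming (suc to lsuc)
open import Algebra.Bundles using (CommutativeRing)
open import Algebra.Structures using (IsGroup)
open import Algebra.Module.Bundles using (LeftModule)
import Algebra.Module.Construct.TensorUnit as TensorUnit
open import Algebra.Module.Morphism.Structures
  using (module LeftModuleMorphisms)
import Algebra.Properties.CommutativeMonoid.Sum as CommutativeMonoidSum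
import Algebra.Properties.Semiring.Sum as SemiringSum
import Algebra.Properties.Semiring.Exp as SemiringExp
open import Data.Fin.Base using (Fin; toℕ; fromℕ)
open import Data.Fin.Properties using (*↔×; inj⇒≟)
open import Data.Integer.Base as ℤ using (ℤ; _⊖_)
open import Data.Nat.Base as ℕ using (ℕ; suc; _∸_)
import Data.Nat.Properties as ℕₚ
open import Data.Product.Base using (Σ; ∃; _×_; _,_; proj₁; proj₂)
open import Data.Product.Function.NonDependent.Propositional using (_×-↔_)
open import Data.Sum.Base using (_⊎_; inj₁; inj₂)
open import Function.Base using (_∘_)
open import Function.Bundles using (_↔_; _⇔_; Inverse)
open import Function.Construct.Composition using (_↔-∘_)
open import Function.Construct.Identity using (↔-id)
open import Function.Construct.Symmetry using (↔-sym)
open import Function.Definitions using (Injective)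
open import Function.Properties.Inverse using (Inverse⇒Injection)
open import Relation.Binary.Construct.Closure.Equivalence using (EqClosure; return)
import Relation.Binary.Construct.Closure.Equivalence as EqClosure
open import Relation.Binary.Definitions using (DecidableEquality)
open import Relation.Binary.PropositionalEquality.Core
  using (_≡_; refl; sym; trans; cong; subst)
open import Relation.Nullary.Decidable.Core using (yes; no)
open import Relation.Nullary.Negation.Core using (¬_)
open import Relation.Unary using (Pred; _∈_; _∉_; _⊆_)

private
  variable
    a p : Level

record HasSize {A : Set a} (P : Pred A p) (n : ℕ) : Set (a ⊔ p) where
  field
    enum      : Fin n → A
    injective : Injective _≡_ _≡_ enum
    image     : ∀ x → x ∈ P ⇔ ∃ λ i → enum i ≡ x

IsLargest : Pred ℤ p → ℤ → Set p
IsLargest P m = P m × (∀ m′ → P m′ → m′ ℤ.≤ m)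

record FiniteGraph a : Set (lsuc a) where
  field
    Vertex     : Set a
    Edge       : Set a
    head tail  : Edge → Vertex
    ∣V∣ ∣E∣    : ℕ
    V-finite   : Vertex ↔ Fin ∣V∣
    E-finite   : Edge ↔ Fin ∣E∣

  _≟_ : DecidableEquality Vertex
  _≟_ = inj⇒≟ (Inverse⇒Injection V-finite)

record Subgraph (G : FiniteGraph a) : Set (lsuc a) where
  open FiniteGraph G
  field
    V      : Pred Vertex a
    E      : Pred Edge a
    head∈V : ∀ {e} → e ∈ E → head e ∈ V
    tail∈V : ∀ {e} → e ∈ E → tail e ∈ V

module _ {G : FiniteGraph a} where
  open FiniteGraph G

  _∈ᴸ_ : Vertex ⊎ Edge → Subgraph G → Set a
  inj₁ v ∈ᴸ L = v ∈ Subgraph.V L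
  inj₂ e ∈ᴸ L = e ∈ Subgraph.E L

  module _ (L : Subgraph G) where
    open Subgraph L

    Adjacent : Vertex → Vertex → Set a
    Adjacent u v = ∃ λ e → e ∈ E × tail e ≡ u × head e ≡ v

    Connected : Vertex → Vertex → Set a
    Connected = EqClosure Adjacent

    component : Vertex → Subgraph G
    component v = record
      { V      = λ u → u ∈ V × Connected v u
      ; E      = λ e → e ∈ E × Connected v (tail e)
      ; head∈V = λ (e∈E , v~te) → head∈V e∈E ,
                   EqClosure.transitive Adjacent v~te
                     (return (_ , e∈E , refl , refl))
      ; tail∈V = λ (e∈E , v~te) → tail∈V e∈E , v~te
      }

    -- IsRho L r says r = Σ_X max(0, |E_X| - |V_X|).  Each component X is listed
    -- once, through a chosen vertex of it.
    record IsRho (r : ℕ) : Set a where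
      field
        number        : ℕ
        rep           : Fin number → Vertex
        rep∈V         : ∀ j → rep j ∈ V
        rep-covers    : ∀ v → v ∈ V → ∃ λ j → Connected (rep j) v
        rep-distinct  : ∀ i j → Connected (rep i) (rep j) → i ≡ j
        vertices      : Fin number → ℕ
        edges         : Fin number → ℕ
        vertices-size : ∀ j → HasSize (Subgraph.V (component (rep j))) (vertices j)
        edges-size    : ∀ j → HasSize (Subgraph.E (component (rep j))) (edges j)
        total         : r ≡ CommutativeMonoidSum.sum ℕₚ.+-0-commutativeMonoid
                              (λ j → edges j ∸ vertices j)

  _≤ρ_ : ℕ → Subgraph G → Set a
  k ≤ρ L = ∃ λ r → IsRho L r × k ℕ.≤ r

record FiniteGroup a : Set (lsuc a) where
  infixl 7 _∙_
  field
    Carrier : Set a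
    _∙_     : Carrier → Carrier → Carrier
    ε       : Carrier
    _⁻¹     : Carrier → Carrier
    isGroup : IsGroup _≡_ _∙_ ε _⁻¹
    order   : ℕ
    finite  : Carrier ↔ Fin order

  open IsGroup isGroup public using (assoc)

module _ (𝒢 : FiniteGroup a) where
  open FiniteGroup 𝒢

  -- The two elements need be neither distinct nor generating.
  CayleyBigraph : (Fin 2 → Carrier) → FiniteGraph a
  CayleyBigraph g = record
    { Vertex   = Carrier
    ; Edge     = Carrier × Fin 2
    ; head     = λ (h , i) → g i ∙ h
    ; tail     = proj₁
    ; V-finite = finite
    ; E-finite = ↔-sym *↔× ↔-∘ (finite ×-↔ ↔-id (Fin 2))
    }

module _ (𝒢 : FiniteGroup a) (g : Fin 2 → FiniteGroup.Carrier 𝒢) where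
  open FiniteGroup 𝒢
  open FiniteGraph (CayleyBigraph 𝒢 g) using (Vertex; Edge)

  translate : Subgraph (CayleyBigraph 𝒢 g) → Carrier → Subgraph (CayleyBigraph 𝒢 g)
  translate L x = record
    { V      = λ v → ∃ λ h → h ∈ V × h ∙ x ≡ v
    ; E      = λ (v , i) → ∃ λ h → (h , i) ∈ E × h ∙ x ≡ v
    ; head∈V = λ { {_ , i} (h , h∈E , hx≡v) →
                     g i ∙ h , head∈V h∈E , trans (assoc (g i) h x) (cong (g i ∙_) hx≡v) }
    ; tail∈V = λ (h , h∈E , hx≡v) → h , tail∈V h∈E , hx≡v
    }
    where open Subgraph L

  Translates : Subgraph (CayleyBigraph 𝒢 g) → Vertex ⊎ Edge → Pred Carrier a
  Translates L P x = P ∈ᴸ translate L x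

module _ {c ℓ} (R : CommutativeRing c ℓ) where
  open CommutativeRing R hiding (refl; sym; trans)
  open SemiringSum semiring using (sum)
  open SemiringExp semiring using (_^_)

  record IsField : Set (c ⊔ ℓ) where
    field
      1≉0     : ¬ (1# ≈ 0#)
      inverse : ∀ x → ¬ (x ≈ 0#) → ∃ λ y → x * y ≈ 1#

  -- Every polynomial Σ_{i ≤ n+1} pᵢ xⁱ of degree exactly n + 1 has a root.
  IsAlgebraicallyClosed : Set (c ⊔ ℓ)
  IsAlgebraicallyClosed =
    ∀ n (p : Fin (suc (suc n)) → Carrier) → ¬ (p (fromℕ (suc n)) ≈ 0#) →
    ∃ λ x → sum (λ i → p i * x ^ toℕ i) ≈ 0#

  -- Expressions rather than normal forms: only the induced functions on X → R
  -- enter the Zariski topology.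
  data Polynomial (X : Set a) : Set (a ⊔ c) where
    con       : Carrier → Polynomial X
    var       : X → Polynomial X
    _:+_ _:*_ : Polynomial X → Polynomial X → Polynomial X

  ⟦_⟧ : ∀ {X : Set a} → Polynomial X → (X → Carrier) → Carrier
  ⟦ con r ⟧  x = r
  ⟦ var i ⟧  x = x i
  ⟦ p :+ q ⟧ x = ⟦ p ⟧ x + ⟦ q ⟧ x
  ⟦ p :* q ⟧ x = ⟦ p ⟧ x * ⟦ q ⟧ x

  Zeros : ∀ {X : Set a} → Pred (Polynomial X) p → Pred (X → Carrier) (a ⊔ c ⊔ ℓ ⊔ p)
  Zeros T x = ∀ q → q ∈ T → ⟦ q ⟧ x ≈ 0#

  -- The only Zariski-closed set containing S is the whole space.
  ZariskiDense : ∀ {X : Set a} → Pred (X → Carrier) p → Set (lsuc (a ⊔ c ⊔ ℓ) ⊔ p)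
  ZariskiDense {a = a} {X = X} S =
    (T : Pred (Polynomial X) (a ⊔ c ⊔ ℓ)) → S ⊆ Zeros T → ∀ x → x ∈ Zeros T

  -- Vector spaces are left modules over a ring that is a field.
  module _ {m ℓm} (N : LeftModule ring m ℓm) where
    open LeftModule N

    record Subspace p : Set (c ⊔ m ⊔ ℓm ⊔ lsuc p) where
      field
        member    : Pred Carrierᴹ p
        ≈-closed  : ∀ {x y} → x ≈ᴹ y → x ∈ member → y ∈ member
        0-closed  : 0ᴹ ∈ member
        +-closed  : ∀ {x y} → x ∈ member → y ∈ member → x +ᴹ y ∈ member
        *ₗ-closed : ∀ r {x} → x ∈ member → r *ₗ x ∈ member

    combination : ∀ {d} → (Fin d → Carrier) → (Fin d → Carrierᴹ) → Carrierᴹ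
    combination r b = CommutativeMonoidSum.sum +ᴹ-commutativeMonoid (λ i → r i *ₗ b i)

    record HasDimension (W : Pred Carrierᴹ p) (d : ℕ) : Set (c ⊔ ℓ ⊔ m ⊔ ℓm ⊔ p) where
      field
        basis       : Fin d → Carrierᴹ
        basis∈W     : ∀ i → basis i ∈ W
        independent : ∀ r → combination r basis ≈ᴹ 0ᴹ → ∀ i → r i ≈ 0#
        spanning    : ∀ w → w ∈ W → ∃ λ r → combination r basis ≈ᴹ w

  module _ {m ℓm} {N : LeftModule ring m ℓm} where
    open LeftModule N

    subspaceModule : Subspace N p → LeftModule ring (m ⊔ p) ℓm
    subspaceModule W = record
      { Carrierᴹ = Σ Carrierᴹ member
      ; _≈ᴹ_ = λ x y → proj₁ x ≈ᴹ proj₁ y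
      ; _+ᴹ_ = λ (x , x∈W) (y , y∈W) → x +ᴹ y , +-closed x∈W y∈W
      ; _*ₗ_ = λ r (x , x∈W) → r *ₗ x , *ₗ-closed r x∈W
      ; 0ᴹ = 0ᴹ , 0-closed
      ; -ᴹ_ = λ (x , x∈W) → -ᴹ x , ≈-closed (-1*x≈-x x) (*ₗ-closed (- 1#) x∈W)
      ; isLeftModule = record
        { isLeftSemimodule = record
          { +ᴹ-isCommutativeMonoid = record
            { isMonoid = record
              { isSemigroup = record
                { isMagma = record
                  { isEquivalence = record
                    { refl = ≈ᴹ-refl ; sym = ≈ᴹ-sym ; trans = ≈ᴹ-trans }
                  ; ∙-cong = +ᴹ-cong
                  }
                ; assoc = λ x y z → +ᴹ-assoc (proj₁ x) (proj₁ y) (proj₁ z)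
                }
              ; identity = (λ x → +ᴹ-identityˡ (proj₁ x)) , (λ x → +ᴹ-identityʳ (proj₁ x))
              }
            ; comm = λ x y → +ᴹ-comm (proj₁ x) (proj₁ y)
            }
          ; isPreleftSemimodule = record
            { *ₗ-cong = *ₗ-cong
            ; *ₗ-zeroˡ = λ x → *ₗ-zeroˡ (proj₁ x)
            ; *ₗ-distribʳ = λ x r s → *ₗ-distribʳ (proj₁ x) r s
            ; *ₗ-identityˡ = λ x → *ₗ-identityˡ (proj₁ x)
            ; *ₗ-assoc = λ r s x → *ₗ-assoc r s (proj₁ x)
            ; *ₗ-zeroʳ = *ₗ-zeroʳ
            ; *ₗ-distribˡ = λ r x y → *ₗ-distribˡ r (proj₁ x) (proj₁ y)
            }
          }
        ; -ᴹ‿cong = -ᴹ‿cong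
        ; -ᴹ‿inverse = (λ x → -ᴹ‿inverseˡ (proj₁ x)) , (λ x → -ᴹ‿inverseʳ (proj₁ x))
        }
      }
      where
      open Subspace W
      open import Relation.Binary.Reasoning.Setoid ≈ᴹ-setoid
      -1*x≈-x : ∀ x → (- 1#) *ₗ x ≈ᴹ -ᴹ x
      -1*x≈-x x = begin
        (- 1#) *ₗ x                          ≈⟨ +ᴹ-identityʳ _ ⟨
        (- 1#) *ₗ x +ᴹ 0ᴹ                    ≈⟨ +ᴹ-congˡ (-ᴹ‿inverseʳ x) ⟨
        (- 1#) *ₗ x +ᴹ (x +ᴹ -ᴹ x)           ≈⟨ +ᴹ-assoc _ x (-ᴹ x) ⟨
        ((- 1#) *ₗ x +ᴹ x) +ᴹ -ᴹ x           ≈⟨ +ᴹ-congʳ (+ᴹ-congˡ (*ₗ-identityˡ x)) ⟨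
        ((- 1#) *ₗ x +ᴹ 1# *ₗ x) +ᴹ -ᴹ x     ≈⟨ +ᴹ-congʳ (*ₗ-distribʳ x (- 1#) 1#) ⟨
        ((- 1# + 1#) *ₗ x) +ᴹ -ᴹ x           ≈⟨ +ᴹ-congʳ (*ₗ-congʳ (-‿inverseˡ 1#)) ⟩
        (0# *ₗ x) +ᴹ -ᴹ x                    ≈⟨ +ᴹ-congʳ (*ₗ-zeroˡ x) ⟩
        0ᴹ +ᴹ -ᴹ x                           ≈⟨ +ᴹ-identityˡ _ ⟩
        -ᴹ x                                 ∎

    module _ (W W′ : Subspace N p)
             (W⊆W′ : ∀ x → x ∈ Subspace.member W → x ∈ Subspace.member W′) where

      inclusion : Σ Carrierᴹ (Subspace.member W) → Σ Carrierᴹ (Subspace.member W′)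
      inclusion (x , x∈W) = x , W⊆W′ x x∈W

      inclusion-linear : LeftModuleMorphisms.IsLeftModuleHomomorphism
        (LeftModule.rawLeftModule (subspaceModule W))
        (LeftModule.rawLeftModule (subspaceModule W′)) inclusion
      inclusion-linear = record
        { +ᴹ-isGroupHomomorphism = record
          { isMonoidHomomorphism = record
            { isMagmaHomomorphism = record
              { isRelHomomorphism = record { cong = λ x≈y → x≈y }
              ; homo = λ _ _ → ≈ᴹ-refl
              }
            ; ε-homo = ≈ᴹ-refl
            }
          ; ⁻¹-homo = λ _ → ≈ᴹ-refl
          }
        ; *ₗ-homo = λ _ _ → ≈ᴹ-refl
        }

  -- The product of a family of modules; used only over finite index types,
  -- where it is the direct sum.
  ⨁ : ∀ {m ℓm} {I : Set a} → (I → LeftModule ring m ℓm) → LeftModule ring (a ⊔ m) (a ⊔ ℓm)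
  ⨁ {I = I} N = record
    { Carrierᴹ = ∀ i → Carrierᴹ (N i)
    ; _≈ᴹ_ = λ x y → ∀ i → _≈ᴹ_ (N i) (x i) (y i)
    ; _+ᴹ_ = λ x y i → _+ᴹ_ (N i) (x i) (y i)
    ; _*ₗ_ = λ r x i → _*ₗ_ (N i) r (x i)
    ; 0ᴹ = λ i → 0ᴹ (N i)
    ; -ᴹ_ = λ x i → -ᴹ_ (N i) (x i)
    ; isLeftModule = record
      { isLeftSemimodule = record
        { +ᴹ-isCommutativeMonoid = record
          { isMonoid = record
            { isSemigroup = record
              { isMagma = record
                { isEquivalence = record
                  { refl = λ i → ≈ᴹ-refl (N i)
                  ; sym = λ x≈y i → ≈ᴹ-sym (N i) (x≈y i)
                  ; trans = λ x≈y y≈z i → ≈ᴹ-trans (N i) (x≈y i) (y≈z i)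
                  }
                ; ∙-cong = λ x≈y u≈v i → +ᴹ-cong (N i) (x≈y i) (u≈v i)
                }
              ; assoc = λ x y z i → +ᴹ-assoc (N i) (x i) (y i) (z i)
              }
            ; identity = (λ x i → +ᴹ-identityˡ (N i) (x i)) , (λ x i → +ᴹ-identityʳ (N i) (x i))
            }
          ; comm = λ x y i → +ᴹ-comm (N i) (x i) (y i)
          }
        ; isPreleftSemimodule = record
          { *ₗ-cong = λ r≈s x≈y i → *ₗ-cong (N i) r≈s (x≈y i)
          ; *ₗ-zeroˡ = λ x i → *ₗ-zeroˡ (N i) (x i)
          ; *ₗ-distribʳ = λ x r s i → *ₗ-distribʳ (N i) (x i) r s
          ; *ₗ-identityˡ = λ x i → *ₗ-identityˡ (N i) (x i)
          ; *ₗ-assoc = λ r s x i → *ₗ-assoc (N i) r s (x i)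
          ; *ₗ-zeroʳ = λ r i → *ₗ-zeroʳ (N i) r
          ; *ₗ-distribˡ = λ r x y i → *ₗ-distribˡ (N i) r (x i) (y i)
          }
        }
      ; -ᴹ‿cong = λ x≈y i → -ᴹ‿cong (N i) (x≈y i)
      ; -ᴹ‿inverse = (λ x i → -ᴹ‿inverseˡ (N i) (x i)) , (λ x i → -ᴹ‿inverseʳ (N i) (x i))
      }
    }
    where open LeftModule

  record Sheaf (G : FiniteGraph a) m ℓm : Set (a ⊔ c ⊔ ℓ ⊔ lsuc (m ⊔ ℓm)) where
    open FiniteGraph G
    open LeftModule using (Carrierᴹ; rawLeftModule)
    field
      atV : Vertex → LeftModule ring m ℓm
      atE : Edge → LeftModule ring m ℓm
      resʰ : ∀ e → Carrierᴹ (atE e) → Carrierᴹ (atV (head e))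
      resᵗ : ∀ e → Carrierᴹ (atE e) → Carrierᴹ (atV (tail e))
      resʰ-linear : ∀ e → LeftModuleMorphisms.IsLeftModuleHomomorphism
        (rawLeftModule (atE e)) (rawLeftModule (atV (head e))) (resʰ e)
      resᵗ-linear : ∀ e → LeftModuleMorphisms.IsLeftModuleHomomorphism
        (rawLeftModule (atE e)) (rawLeftModule (atV (tail e))) (resᵗ e)

  module _ {m ℓm} {G : FiniteGraph a} (ℱ : Sheaf G m ℓm) where
    open FiniteGraph G
    open Sheaf ℱ
    open LeftModule using (Carrierᴹ; 0ᴹ)

    ℱ[V] : LeftModule ring (a ⊔ m) (a ⊔ ℓm)
    ℱ[V] = ⨁ atV

    ℱ[E] : LeftModule ring (a ⊔ m) (a ⊔ ℓm)
    ℱ[E] = ⨁ atE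

    ι : ∀ v → Carrierᴹ (atV v) → Carrierᴹ ℱ[V]
    ι v x u with v ≟ u
    ... | yes v≡u = subst (Carrierᴹ ∘ atV) v≡u x
    ... | no  _   = 0ᴹ (atV u)

    -- dʰ e and dᵗ e are the restrictions of d_h and d_t to the summand of e.
    dʰ dᵗ : ∀ e → Carrierᴹ (atE e) → Carrierᴹ ℱ[V]
    dʰ e w = ι (head e) (resʰ e w)
    dᵗ e w = ι (tail e) (resᵗ e w)

    Γʰᵗ : Pred (Carrierᴹ ℱ[V]) p → Pred (Carrierᴹ ℱ[E]) (a ⊔ p)
    Γʰᵗ U w = ∀ e → dʰ e (w e) ∈ U × dᵗ e (w e) ∈ U

    -- Dimensions and maxima are relations, since they are not computable over
    -- an arbitrary field.
    HasExcess : Subspace ℱ[V] p → ℤ → Set (a ⊔ c ⊔ ℓ ⊔ m ⊔ ℓm ⊔ p)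
    HasExcess U n = ∃ λ dΓ → ∃ λ dU →
      HasDimension ℱ[E] (Γʰᵗ (Subspace.member U)) dΓ ×
      HasDimension ℱ[V] (Subspace.member U) dU ×
      n ≡ dΓ ⊖ dU

    IsMaximumExcess : ℤ → Set (lsuc (a ⊔ c ⊔ ℓ ⊔ m ⊔ ℓm))
    IsMaximumExcess = IsLargest λ n →
      ∃ λ (U : Subspace ℱ[V] (a ⊔ c ⊔ ℓ ⊔ m ⊔ ℓm)) → HasExcess U n

  module _ (𝒢 : FiniteGroup a) (g : Fin 2 → FiniteGroup.Carrier 𝒢)
           (L : Subgraph (CayleyBigraph 𝒢 g)) (k : ℕ) where
    open FiniteGroup 𝒢 using (order; finite) renaming (Carrier to C)
    open FiniteGraph (CayleyBigraph 𝒢 g) using (Vertex; Edge; head; tail)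

    𝒢[_] : Vertex ⊎ Edge → Pred C a
    𝒢[ P ] = Translates 𝒢 g L P

    -- M (i , x) is the i-th coordinate of the column mˣ.
    Matrix : Set (a ⊔ c)
    Matrix = Fin k × C → Carrier

    Σᴳ : (C → Carrier) → Carrier
    Σᴳ f = sum (f ∘ Inverse.from finite)

    IsSurjective : Matrix → Set (a ⊔ c ⊔ ℓ)
    IsSurjective M = ∀ (P : Vertex ⊎ Edge) (b : Fin k → Carrier) →
      ∃ λ (r : C → Carrier) →
        (∀ x → x ∉ 𝒢[ P ] → r x ≈ 0#) ×
        (∀ i → Σᴳ (λ x → r x * M (i , x)) ≈ b i)

    F^𝒢 : LeftModule ring (a ⊔ c) (a ⊔ ℓ)
    F^𝒢 = ⨁ {I = C} (λ _ → TensorUnit.leftModule)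

    private
      module ≈ = CommutativeRing R using (refl; sym; trans)
      module S = SemiringSum semiring

    Σᴳ-cong : ∀ {f h} → (∀ x → f x ≈ h x) → Σᴳ f ≈ Σᴳ h
    Σᴳ-cong f≈h = S.sum-cong-≋ {order} (f≈h ∘ Inverse.from finite)

    Σᴳ-0 : Σᴳ (λ _ → 0#) ≈ 0#
    Σᴳ-0 = S.sum-replicate-zero order

    Σᴳ-+ : ∀ f h → Σᴳ (λ x → f x + h x) ≈ Σᴳ f + Σᴳ h
    Σᴳ-+ f h = S.∑-distrib-+ {order} (f ∘ Inverse.from finite) (h ∘ Inverse.from finite)

    Σᴳ-* : ∀ t f → Σᴳ (λ x → t * f x) ≈ t * Σᴳ f
    Σᴳ-* t f = ≈.sym (S.*-distribˡ-sum {order} t (f ∘ Inverse.from finite))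

    module _ (M : Matrix) where

      𝒦-space : Vertex ⊎ Edge → Subspace F^𝒢 (a ⊔ ℓ)
      𝒦-space P = record
        { member = λ r →
            (∀ x → x ∉ 𝒢[ P ] → r x ≈ 0#) ×
            (∀ i → Σᴳ (λ x → r x * M (i , x)) ≈ 0#)
        ; ≈-closed = λ r≈s (r-supp , r-ker) →
            (λ x x∉ → ≈.trans (≈.sym (r≈s x)) (r-supp x x∉)) ,
            (λ i → ≈.trans (Σᴳ-cong λ x → *-congʳ {M (i , x)} (≈.sym (r≈s x))) (r-ker i))
        ; 0-closed =
            (λ _ _ → ≈.refl) ,
            (λ i → ≈.trans (Σᴳ-cong λ x → zeroˡ (M (i , x))) Σᴳ-0)
        ; +-closed = λ {r} {s} (r-supp , r-ker) (s-supp , s-ker) →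
            (λ x x∉ → ≈.trans (+-cong (r-supp x x∉) (s-supp x x∉)) (+-identityˡ 0#)) ,
            (λ i → ≈.trans (Σᴳ-cong λ x → distribʳ (M (i , x)) (r x) (s x))
                  (≈.trans (Σᴳ-+ (λ x → r x * M (i , x)) (λ x → s x * M (i , x)))
                  (≈.trans (+-cong (r-ker i) (s-ker i)) (+-identityˡ 0#))))
        ; *ₗ-closed = λ t {r} (r-supp , r-ker) →
            (λ x x∉ → ≈.trans (*-congˡ (r-supp x x∉)) (zeroʳ t)) ,
            (λ i → ≈.trans (Σᴳ-cong λ x → *-assoc t (r x) (M (i , x)))
                  (≈.trans (Σᴳ-* t (λ x → r x * M (i , x)))
                  (≈.trans (*-congˡ (r-ker i)) (zeroʳ t))))
        }

      𝒦-mono : ∀ P Q → (∀ x → x ∈ 𝒢[ P ] → x ∈ 𝒢[ Q ]) →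
               ∀ r → r ∈ Subspace.member (𝒦-space P) → r ∈ Subspace.member (𝒦-space Q)
      𝒦-mono P Q P⊆Q r (r-supp , r-ker) = (λ x x∉ → r-supp x (x∉ ∘ P⊆Q x)) , r-ker

      𝒦 : Sheaf (CayleyBigraph 𝒢 g) (a ⊔ c ⊔ ℓ) (a ⊔ ℓ)
      𝒦 = record
        { atV  = λ v → subspaceModule (𝒦-space (inj₁ v))
        ; atE  = λ e → subspaceModule (𝒦-space (inj₂ e))
        ; resʰ = λ e → inclusion (𝒦-space (inj₂ e)) (𝒦-space (inj₁ (head e))) (E⊆head e)
        ; resᵗ = λ e → inclusion (𝒦-space (inj₂ e)) (𝒦-space (inj₁ (tail e))) (E⊆tail e)
        ; resʰ-linear = λ e →
            inclusion-linear (𝒦-space (inj₂ e)) (𝒦-space (inj₁ (head e))) (E⊆head e)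
        ; resᵗ-linear = λ e →
            inclusion-linear (𝒦-space (inj₂ e)) (𝒦-space (inj₁ (tail e))) (E⊆tail e)
        }
        where
        E⊆head = λ e → 𝒦-mono (inj₂ e) (inj₁ (head e))
                          (λ x → Subgraph.head∈V (translate 𝒢 g L x))
        E⊆tail = λ e → 𝒦-mono (inj₂ e) (inj₁ (tail e))
                          (λ x → Subgraph.tail∈V (translate 𝒢 g L x))

    IsGenericMaximumExcess : ℤ → Set (lsuc (a ⊔ c ⊔ ℓ))
    IsGenericMaximumExcess = IsLargest λ n →
      ZariskiDense λ M →
        IsSurjective M × ∃ λ e → IsMaximumExcess (𝒦 M) e × n ℤ.≤ e

{-# OPTIONS --safe #-}

-- By the modular law the maximizers of the excess of a sheaf are closed under intersection and sum, so there
-- is a unique maximizer U of least dimension, and it is the sum of its intersections with the stalks.  Whether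
-- the sheaf of M has a subspace with prescribed dimensions of stalks and of Γʰᵗ is a constructible condition on
-- M, by elimination of quantifiers over an algebraically closed field; as affine space is irreducible, it either
-- holds on a nonempty open set or fails on one.  Take an M at which each of these finitely many conditions has
-- its generic truth value.  Right translation by y ∈ 𝒢 permutes the columns of M and the vertices of G alike,
-- and preserves nonempty open sets; so the translated dimensions of U are also attained at M, and by uniqueness
-- they are those of U.  Hence the stalks of U have the same dimension at all vertices, those of Γʰᵗ(U) the same
-- total dimension over the edges with a given tail, and the excess is divisible by |𝒢|.  The hypothesis k ≤ ρ(L) makes
-- every 𝒢_L(P) have at least k elements, so that a generic M is L-surjective.

module Submission where

open import Defs
open import Algebra.Bundles using (CommutativeRing; Group)
open import Algebra.Module.Bundles using (LeftModule)
import Algebra.Properties.CommutativeMonoid.Sum as CommutativeMonoidSum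
import Algebra.Properties.Group as GroupProperties
import Algebra.Properties.Ring as RingProperties
import Algebra.Properties.Semiring.Exp as SemiringExp
import Algebra.Properties.Semiring.Sum as SemiringSum
import Algebra.Solver.CommutativeMonoid as CommutativeMonoidSolver
import Algebra.Solver.Ring.NaturalCoefficients.Default as NatSolver
open import Axiom.ExcludedMiddle using (ExcludedMiddle)
open import Data.Bool.Base using (Bool; true; false)
open import Data.Empty using (⊥; ⊥-elim)
open import Data.Fin.Base using (Fin; zero; suc; toℕ; fromℕ; fromℕ<; inject₁; inject≤; opposite; punchIn; _↑ˡ_; _↑ʳ_; combine; remQuot)
import Data.Fin.Properties as Finₚ
open import Data.Integer.Base as ℤ using (ℤ; +_; _⊖_)
open import Data.Integer.Divisibility using (_∣_)
import Data.Integer.Properties as ℤₚ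
open import Data.List.Base as List using (List; []; _∷_; length)
open import Data.Maybe.Base using (Maybe; just; nothing; maybe′)
open import Data.Nat.Base as ℕ using (ℕ; zero; suc; _≤_; _<_; _∸_; z≤n; s≤s)
import Data.Nat.Divisibility as ℕDiv
import Data.Nat.Properties as ℕₚ
open import Data.Nat.Tactic.RingSolver using (solve-∀)
open import Data.Product.Base using (Σ; ∃; _×_; _,_; proj₁; proj₂)
open import Data.Product.Function.NonDependent.Propositional using (_×-↔_)
open import Data.Sum.Base using (_⊎_; inj₁; inj₂; [_,_])
open import Data.Unit.Base using (⊤; tt)
open import Data.Vec.Base using (Vec; []; _∷_; lookup; tabulate)
import Data.Vec.Functional as F
import Data.Vec.Functional.Properties as Fₚ
open import Data.Vec.Properties using (lookup∘tabulate)
open import Function.Base using (_∘_; id)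
open import Function.Bundles using (_↔_; mk↔ₛ′; Inverse; Equivalence)
open import Function.Construct.Composition using (_↔-∘_)
open import Function.Construct.Identity using (↔-id)
open import Function.Construct.Symmetry using (↔-sym)
open import Function.Definitions using (Injective)
open import Level using (Level; Lift; lift; lower; _⊔_) renaming (suc to lsuc)
open import Relation.Binary.PropositionalEquality as ≡ using (_≡_; _≢_; refl; cong; cong₂; subst; subst₂)
import Relation.Binary.Reasoning.Setoid as SetoidReasoning
open import Relation.Nullary.Decidable.Core using (Dec; yes; no; decidable-stable)
open import Relation.Nullary.Negation.Core using (¬_; contradiction)
open import Relation.Unary using (Pred; _∈_; _∉_; _⊆_)

-- Translating by `y` leads from the sheaf of `M` to that of another matrix, so a maximizer cannot
-- be compared with its translate directly; only a condition with the same truth value at both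
-- matrices can be transported. For quantifier elimination that condition must speak of finitely
-- many scalars. Dimensions are therefore encoded by lists `τ` and `σ` of the places where
-- independent sections sit: the sizes of the fibres of `τ` and of `tail ∘ σ` play the part of
-- dimensions, and independence makes them lower bounds. Lower bounds suffice, because a translated
-- list yields a subspace of the same dimension with at least as many sections, which a maximizer of
-- least dimension does not allow to be different from itself. Right translation is transitive on
-- vertices but has a separate orbit of edges for each colour; grading edges by their tails merges
-- the colours. Algebraic closedness enters only through the existence of roots: nonvanishing of
-- nonzero polynomials somewhere, irreducibility of affine space and a Nullstellensatz in one
-- variable are all drawn from it.

variable
  a p q : Level

-- Excluded middle at lower levels and concatenation of finite families

lower-em : ∀ p q → ExcludedMiddle (p ⊔ q) → ExcludedMiddle p
lower-em p q em {P} with em {Lift q P}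
... | yes x = yes (lower x)
... | no ¬x = no (¬x ∘ lift)

↔-injective : ∀ {A : Set a} {B : Set p} (A↔B : A ↔ B) → Injective _≡_ _≡_ (Inverse.to A↔B)
↔-injective A↔B eq = ≡.trans (≡.sym (strictlyInverseʳ _)) (≡.trans (cong from eq) (strictlyInverseʳ _))
  where open Inverse A↔B

module _ {A : Set a} where

  append : ∀ {m n} → (Fin m → A) → (Fin n → A) → Fin (m ℕ.+ n) → A
  append {zero}  f g = g
  append {suc m} f g = f zero F.∷ append (f ∘ suc) g

  append-all : (P : Pred A p) → ∀ {m n} {f : Fin m → A} {g : Fin n → A} →
               (∀ i → f i ∈ P) → (∀ j → g j ∈ P) → ∀ k → append f g k ∈ P
  append-all P {zero}  f∈P g∈P k       = g∈P k
  append-all P {suc m} f∈P g∈P zero    = f∈P zero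
  append-all P {suc m} f∈P g∈P (suc k) = append-all P (f∈P ∘ suc) g∈P k

-- Finite sums and linear relations over a field

module FieldLemmas {c ℓ} (𝔽 : CommutativeRing c ℓ) (isField : IsField 𝔽)
                   (em : ExcludedMiddle ℓ) where

  open CommutativeRing 𝔽 public
    using (_≈_; _+_; _*_; -_; _-_; 0#; 1#; setoid; ring; semiring; commutativeSemiring;
           +-cong; +-congˡ; +-congʳ; *-cong; *-congˡ; *-congʳ; -‿cong;
           +-assoc; *-assoc; +-comm; *-comm; +-identityˡ; +-identityʳ;
           *-identityˡ; *-identityʳ; zeroˡ; zeroʳ; distribˡ; distribʳ;
           -‿inverseˡ; -‿inverseʳ)
    renaming (Carrier to K; refl to ≈-refl; sym to ≈-sym; trans to ≈-trans; reflexive to ≈-reflexive)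
  open RingProperties ring public using (-‿distribˡ-*; -‿distribʳ-*; x∙y⁻¹≈ε⇒x≈y; -1*x≈-x)
  open SemiringSum semiring public
    using (sum; sum-cong-≋; sum-remove; sum-init-last; sum-permute; ∑-distrib-+; ∑-comm;
           sum-replicate-zero; *-distribˡ-sum; *-distribʳ-sum)
  open SetoidReasoning setoid public
  open IsField isField public
  open NatSolver commutativeSemiring public using (solve; _:=_) renaming (_:+_ to _⊕_; _:*_ to _⊗_)

  zero? : ∀ x → Dec (x ≈ 0#)
  zero? x = em

  cancel-zero : ∀ {x y} → ¬ x ≈ 0# → x * y ≈ 0# → y ≈ 0#
  cancel-zero {x} {y} x≉0 xy≈0 with i , xi≈1 ← inverse x x≉0 = begin
    y            ≈⟨ *-identityˡ y ⟨
    1# * y       ≈⟨ *-congʳ xi≈1 ⟨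
    x * i * y    ≈⟨ solve 3 (λ x i y → x ⊗ i ⊗ y := i ⊗ (x ⊗ y)) ≈-refl x i y ⟩
    i * (x * y)  ≈⟨ *-congˡ xy≈0 ⟩
    i * 0#       ≈⟨ zeroʳ i ⟩
    0#           ∎

  *-nonzero : ∀ {x y} → ¬ x ≈ 0# → ¬ y ≈ 0# → ¬ x * y ≈ 0#
  *-nonzero x≉0 y≉0 = y≉0 ∘ cancel-zero x≉0

  sum-zero : ∀ {n} {f : Fin n → K} → (∀ i → f i ≈ 0#) → sum f ≈ 0#
  sum-zero {n} f≈0 = ≈-trans (sum-cong-≋ f≈0) (sum-replicate-zero n)

  x-y≈0⇒x≈y : ∀ {x y} → x + - y ≈ 0# → x ≈ y
  x-y≈0⇒x≈y {x} {y} = x∙y⁻¹≈ε⇒x≈y x y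

  δ : ∀ {d} → Fin d → Fin d → K
  δ zero    zero    = 1#
  δ zero    (suc j) = 0#
  δ (suc i) zero    = 0#
  δ (suc i) (suc j) = δ i j

  δ-refl : ∀ {d} (i : Fin d) → δ i i ≡ 1#
  δ-refl zero    = refl
  δ-refl (suc i) = δ-refl i

  δ-≢ : ∀ {d} {i j : Fin d} → i ≢ j → δ i j ≡ 0#
  δ-≢ {i = zero}  {zero}  i≢j = contradiction refl i≢j
  δ-≢ {i = zero}  {suc j} i≢j = refl
  δ-≢ {i = suc i} {zero}  i≢j = refl
  δ-≢ {i = suc i} {suc j} i≢j = δ-≢ (i≢j ∘ cong suc)

  δ-injective : ∀ {d e} {f : Fin d → Fin e} → Injective _≡_ _≡_ f → ∀ i j → δ (f i) (f j) ≡ δ i j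
  δ-injective {f = f} f-inj i j with i Finₚ.≟ j
  ... | yes refl = ≡.trans (δ-refl (f i)) (≡.sym (δ-refl i))
  ... | no i≢j   = ≡.trans (δ-≢ (i≢j ∘ f-inj)) (≡.sym (δ-≢ i≢j))

  sum-δ : ∀ {d} (i : Fin d) (f : Fin d → K) → sum (λ j → δ i j * f j) ≈ f i
  sum-δ zero    f = ≈-trans (+-cong (*-identityˡ _) (sum-zero λ j → zeroˡ (f (suc j)))) (+-identityʳ _)
  sum-δ (suc i) f = ≈-trans (+-cong (zeroˡ _) (sum-δ i (f ∘ suc))) (+-identityˡ _)

  -- Elimination by cross-multiplication: the other rows get the weights `r j * α` and the pivot row
  -- gets `- sum (λ j → r j * p j)`, so that nothing is divided by the pivot `α`.
  eliminate : ∀ {n} (r p q : Fin n → K) α t →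
              - sum (λ j → r j * p j) * t + sum (λ j → r j * α * q j) ≈
              sum (λ j → r j * (α * q j + - (p j * t)))
  eliminate r p q α t = begin
    - sum (λ j → r j * p j) * t + sum (λ j → r j * α * q j)
      ≈⟨ +-congʳ (-‿distribˡ-* _ _) ⟨
    - (sum (λ j → r j * p j) * t) + sum (λ j → r j * α * q j)
      ≈⟨ +-congʳ (≈-trans (-‿cong (*-distribʳ-sum t (λ j → r j * p j)))
           (≈-trans (≈-sym (-1*x≈-x _)) (*-distribˡ-sum (- 1#) (λ j → r j * p j * t)))) ⟩
    sum (λ j → - 1# * (r j * p j * t)) + sum (λ j → r j * α * q j)
      ≈⟨ ∑-distrib-+ (λ j → - 1# * (r j * p j * t)) (λ j → r j * α * q j) ⟨
    sum (λ j → - 1# * (r j * p j * t) + r j * α * q j)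
      ≈⟨ sum-cong-≋ (λ j → step (r j) (p j) (q j)) ⟩
    sum (λ j → r j * (α * q j + - (p j * t))) ∎
    where
    step : ∀ r p q → - 1# * (r * p * t) + r * α * q ≈ r * (α * q + - (p * t))
    step r p q = begin
      - 1# * (r * p * t) + r * α * q  ≈⟨ +-congʳ (-1*x≈-x _) ⟩
      - (r * p * t) + r * α * q       ≈⟨ +-comm _ _ ⟩
      r * α * q + - (r * p * t)       ≈⟨ +-cong (*-assoc _ _ _) (-‿cong (*-assoc _ _ _)) ⟩
      r * (α * q) + - (r * (p * t))   ≈⟨ +-congˡ (-‿distribʳ-* _ _) ⟩
      r * (α * q) + r * - (p * t)     ≈⟨ distribˡ _ _ _ ⟨
      r * (α * q + - (p * t))         ∎

  -- Induction on the number of coordinates. If the first coordinate vanishes throughout, one vector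
  -- is dropped with coefficient zero; otherwise a pivot clears that coordinate, which leaves one
  -- vector and one coordinate fewer.
  dependent : ∀ {d e} → d ≤ e → (A : Fin (suc e) → Fin d → K) →
              ∃ λ (r : Fin (suc e) → K) → (∃ λ i → ¬ r i ≈ 0#) × (∀ x → sum (λ i → r i * A i x) ≈ 0#)
  dependent {zero}  _ A = (λ _ → 1#) , (zero , 1≉0) , λ ()
  dependent {suc d} {suc e} (s≤s d≤e) A with em {∃ λ i → Lift ℓ (¬ A i zero ≈ 0#)}
  ... | no none with r , (i , ri≉0) , r-ker ← dependent d≤e (λ i x → A (suc i) (suc x)) =
    0# F.∷ r , (suc i , ri≉0) , λ where
      zero → ≈-trans (+-congʳ (zeroˡ (A zero zero))) (≈-trans (+-identityˡ _)
        (sum-zero {suc e} λ j → ≈-trans (*-congˡ {r j} (first-zero (suc j))) (zeroʳ (r j))))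
      (suc x) → ≈-trans (+-congʳ (zeroˡ (A zero (suc x)))) (≈-trans (+-identityˡ _) (r-ker x))
    where
    first-zero : ∀ i → A i zero ≈ 0#
    first-zero i = decidable-stable (zero? _) λ ≉0 → none (i , lift ≉0)
  ... | yes (i₀ , lift pivot) with inv , pinv≈1 ← inverse _ pivot
    with r , (i , ri≉0) , r-ker ← dependent d≤e
           (λ i x → A i₀ zero * A (punchIn i₀ i) (suc x) + - (A (punchIn i₀ i) zero * A i₀ (suc x))) =
    full , (punchIn i₀ i , λ eq → *-nonzero ri≉0 pivot (≈-trans (≈-sym (full-punchIn i)) eq)) ,
    vanish
    where
    r′ = λ j → r j * A i₀ zero
    v = - sum (λ j → r j * A (punchIn i₀ j) zero)
    full : Fin (suc (suc e)) → K
    full = F.insertAt r′ i₀ v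
    full-punchIn : ∀ j → full (punchIn i₀ j) ≈ r′ j
    full-punchIn j = ≈-reflexive (Fₚ.insertAt-punchIn r′ i₀ v j)
    vanish : ∀ x → sum (λ i → full i * A i x) ≈ 0#
    vanish x = begin
      sum (λ i → full i * A i x)
        ≈⟨ sum-remove {i = i₀} (λ i → full i * A i x) ⟩
      full i₀ * A i₀ x + sum (λ j → full (punchIn i₀ j) * A (punchIn i₀ j) x)
        ≈⟨ +-cong (*-congʳ (≈-reflexive (Fₚ.insertAt-lookup r′ i₀ v)))
                  (sum-cong-≋ {suc e} {λ j → full (punchIn i₀ j) * A (punchIn i₀ j) x}
                                      {λ j → r′ j * A (punchIn i₀ j) x} (λ j → *-congʳ (full-punchIn j))) ⟩
      v * A i₀ x + sum (λ j → r′ j * A (punchIn i₀ j) x)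
        ≈⟨ eliminate r (λ j → A (punchIn i₀ j) zero) (λ j → A (punchIn i₀ j) x) (A i₀ zero) (A i₀ x) ⟩
      sum (λ j → r j * (A i₀ zero * A (punchIn i₀ j) x + - (A (punchIn i₀ j) zero * A i₀ x)))
        ≈⟨ last-step x ⟩
      0# ∎
      where
      last-step : ∀ x → sum (λ j → r j * (A i₀ zero * A (punchIn i₀ j) x + - (A (punchIn i₀ j) zero * A i₀ x))) ≈ 0#
      last-step zero    = sum-zero {suc e} λ j → ≈-trans (*-congˡ {r j}
        (≈-trans (+-congʳ (*-comm (A i₀ zero) (A (punchIn i₀ j) zero))) (-‿inverseʳ _))) (zeroʳ (r j))
      last-step (suc x) = r-ker x

-- Independence, bases and the modular law for dimensions

module LinearAlgebra {c ℓ m ℓm} (𝔽 : CommutativeRing c ℓ) (isField : IsField 𝔽)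
                     (em : ExcludedMiddle (c ⊔ ℓ ⊔ m ⊔ ℓm))
                     (N : LeftModule (CommutativeRing.ring 𝔽) m ℓm) where

  open FieldLemmas 𝔽 isField (lower-em ℓ (c ⊔ ℓ ⊔ m ⊔ ℓm) em)
    hiding (begin_; _∎; step-≈-⟩; step-≈-⟨; step-≡-⟩; step-≡-⟨; step-≡-∣)
  open LeftModule N
  open CommutativeMonoidSum +ᴹ-commutativeMonoid using ()
    renaming (sum to sumᴹ; sum-cong-≋ to sumᴹ-cong; ∑-comm to sumᴹ-comm; ∑-distrib-+ to sumᴹ-distrib;
              sum-replicate-zero to sumᴹ-zero)
  open SetoidReasoning ≈ᴹ-setoid
  open CommutativeMonoidSolver +ᴹ-commutativeMonoid using () renaming (solve to solveᴹ; _⊕_ to _⊞_; _⊜_ to _≜_)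

  comb : ∀ {d} → (Fin d → K) → (Fin d → Carrierᴹ) → Carrierᴹ
  comb = combination 𝔽 N

  Independent : ∀ {d} → (Fin d → Carrierᴹ) → Set (c ⊔ ℓ ⊔ ℓm)
  Independent {d} b = ∀ (r : Fin d → K) → comb r b ≈ᴹ 0ᴹ → ∀ i → r i ≈ 0#

  Span : ∀ {d} → (Fin d → Carrierᴹ) → Pred Carrierᴹ (c ⊔ ℓm)
  Span {d} b w = ∃ λ (r : Fin d → K) → comb r b ≈ᴹ w

  -- Finite dimensionality without a chosen basis. The stalks are cut out by equations, so a bound
  -- on independent families is what is at hand, and it is what makes the construction of bases
  -- terminate.
  Bounded : ℕ → Set (c ⊔ ℓ ⊔ m ⊔ ℓm)
  Bounded B = ∀ e (b : Fin e → Carrierᴹ) → Independent b → e ≤ B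

  comb-cong : ∀ {d} {r s : Fin d → K} {b b′ : Fin d → Carrierᴹ} →
              (∀ i → r i ≈ s i) → (∀ i → b i ≈ᴹ b′ i) → comb r b ≈ᴹ comb s b′
  comb-cong r≈s b≈b′ = sumᴹ-cong λ i → *ₗ-cong (r≈s i) (b≈b′ i)

  *ₗ-sum : ∀ {d} (t : K) (f : Fin d → Carrierᴹ) → t *ₗ sumᴹ f ≈ᴹ sumᴹ (λ i → t *ₗ f i)
  *ₗ-sum {zero}  t f = *ₗ-zeroʳ t
  *ₗ-sum {suc d} t f = ≈ᴹ-trans (*ₗ-distribˡ t _ _) (+ᴹ-congˡ (*ₗ-sum t (f ∘ suc)))

  sum-*ₗ : ∀ {d} (r : Fin d → K) (x : Carrierᴹ) → sum r *ₗ x ≈ᴹ sumᴹ (λ i → r i *ₗ x)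
  sum-*ₗ {zero}  r x = *ₗ-zeroˡ x
  sum-*ₗ {suc d} r x = ≈ᴹ-trans (*ₗ-distribʳ x _ _) (+ᴹ-congˡ (sum-*ₗ (r ∘ suc) x))

  comb-comb : ∀ {d e} (r : Fin e → K) (A : Fin e → Fin d → K) (b : Fin d → Carrierᴹ) →
              comb r (λ i → comb (A i) b) ≈ᴹ comb (λ j → sum (λ i → r i * A i j)) b
  comb-comb {d} {e} r A b = begin
    sumᴹ (λ i → r i *ₗ sumᴹ (λ j → A i j *ₗ b j))
      ≈⟨ sumᴹ-cong {e} (λ i → ≈ᴹ-trans (*ₗ-sum (r i) (λ j → A i j *ₗ b j))
                               (sumᴹ-cong {d} λ j → ≈ᴹ-sym (*ₗ-assoc (r i) (A i j) (b j)))) ⟩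
    sumᴹ (λ i → sumᴹ (λ j → (r i * A i j) *ₗ b j))
      ≈⟨ sumᴹ-comm (λ i j → (r i * A i j) *ₗ b j) ⟩
    sumᴹ (λ j → sumᴹ (λ i → (r i * A i j) *ₗ b j))
      ≈⟨ sumᴹ-cong {d} (λ j → ≈ᴹ-sym (sum-*ₗ (λ i → r i * A i j) (b j))) ⟩
    sumᴹ (λ j → sum (λ i → r i * A i j) *ₗ b j) ∎

  comb-scale : ∀ {d} (t : K) (r : Fin d → K) (b : Fin d → Carrierᴹ) →
               t *ₗ comb r b ≈ᴹ comb (λ i → t * r i) b
  comb-scale {d} t r b = ≈ᴹ-trans (*ₗ-sum t (λ i → r i *ₗ b i))
                           (sumᴹ-cong {d} λ i → ≈ᴹ-sym (*ₗ-assoc t (r i) (b i)))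

  comb-+ : ∀ {d} (r s : Fin d → K) (b : Fin d → Carrierᴹ) →
           comb r b +ᴹ comb s b ≈ᴹ comb (λ i → r i + s i) b
  comb-+ {d} r s b = ≈ᴹ-trans (≈ᴹ-sym (sumᴹ-distrib (λ i → r i *ₗ b i) (λ i → s i *ₗ b i)))
                       (sumᴹ-cong {d} λ i → ≈ᴹ-sym (*ₗ-distribʳ (b i) (r i) (s i)))

  comb-0 : ∀ {d} (b : Fin d → Carrierᴹ) → comb (λ _ → 0#) b ≈ᴹ 0ᴹ
  comb-0 {d} b = ≈ᴹ-trans (sumᴹ-cong {d} λ i → *ₗ-zeroˡ (b i)) (sumᴹ-zero d)

  comb-δ : ∀ {d} (b : Fin d → Carrierᴹ) i → comb (δ i) b ≈ᴹ b i
  comb-δ b zero    = ≈ᴹ-trans (+ᴹ-cong (*ₗ-identityˡ _) (comb-0 (b ∘ suc))) (+ᴹ-identityʳ _)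
  comb-δ b (suc i) = ≈ᴹ-trans (+ᴹ-cong (*ₗ-zeroˡ _) (comb-δ (b ∘ suc) i)) (+ᴹ-identityˡ _)

  span : ∀ {d} → (Fin d → Carrierᴹ) → Subspace 𝔽 N (c ⊔ ℓm)
  span b = record
    { member    = Span b
    ; ≈-closed  = λ x≈y (r , r≈) → r , ≈ᴹ-trans r≈ x≈y
    ; 0-closed  = (λ _ → 0#) , comb-0 b
    ; +-closed  = λ (r , r≈) (s , s≈) → (λ i → r i + s i) , ≈ᴹ-trans (≈ᴹ-sym (comb-+ r s b)) (+ᴹ-cong r≈ s≈)
    ; *ₗ-closed = λ t (r , r≈) → (λ i → t * r i) , ≈ᴹ-trans (≈ᴹ-sym (comb-scale t r b)) (*ₗ-cong ≈-refl r≈)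
    }

  ∈-span : ∀ {d} (b : Fin d → Carrierᴹ) i → b i ∈ Span b
  ∈-span b i = δ i , comb-δ b i

  module _ (W : Subspace 𝔽 N p) where
    open Subspace W

    comb-closed : ∀ {d} (r : Fin d → K) {b : Fin d → Carrierᴹ} → (∀ i → b i ∈ member) → comb r b ∈ member
    comb-closed {zero}  r b∈W = 0-closed
    comb-closed {suc d} r b∈W = +-closed (*ₗ-closed (r zero) (b∈W zero)) (comb-closed (r ∘ suc) (b∈W ∘ suc))

    Span-⊆ : ∀ {d} {b : Fin d → Carrierᴹ} → (∀ i → b i ∈ member) → Span b ⊆ member
    Span-⊆ b∈W (r , r≈) = ≈-closed r≈ (comb-closed r b∈W)

  -- More than `d` coefficient vectors of length `d` satisfy a nontrivial relation, which the
  -- combinations inherit.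
  steinitz : ∀ {d e} (b : Fin d → Carrierᴹ) (w : Fin e → Carrierᴹ) →
             (∀ i → w i ∈ Span b) → Independent w → e ≤ d
  steinitz {d} {e} b w w∈b ind with e ℕₚ.≤? d
  ... | yes e≤d = e≤d
  ... | no  e≰d = ⊥-elim (go e w w∈b ind (ℕₚ.≰⇒> e≰d))
    where
    go : ∀ e (w : Fin e → Carrierᴹ) → (∀ i → w i ∈ Span b) → Independent w → ¬ d < e
    go (suc e) w w∈b ind (s≤s d≤e) with r , (i , ri≉0) , r-ker ← dependent d≤e (λ i → proj₁ (w∈b i)) =
      ri≉0 (ind r (begin
        comb r w
          ≈⟨ comb-cong {suc e} {r} {r} {w} {λ i → comb (proj₁ (w∈b i)) b} (λ _ → ≈-refl) (λ i → ≈ᴹ-sym (proj₂ (w∈b i))) ⟩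
        comb r (λ i → comb (proj₁ (w∈b i)) b)
          ≈⟨ comb-comb r (λ i → proj₁ (w∈b i)) b ⟩
        comb (λ j → sum (λ i → r i * proj₁ (w∈b i) j)) b
          ≈⟨ comb-cong {d} {b = b} r-ker (λ _ → ≈ᴹ-refl) ⟩
        comb (λ _ → 0#) b
          ≈⟨ comb-0 b ⟩
        0ᴹ ∎) i)

  comb-append : ∀ {d e} (r : Fin (d ℕ.+ e) → K) (b : Fin d → Carrierᴹ) (b′ : Fin e → Carrierᴹ) →
                comb r (append b b′) ≈ᴹ comb (λ i → r (i ↑ˡ e)) b +ᴹ comb (λ j → r (d ↑ʳ j)) b′
  comb-append {zero}  r b b′ = ≈ᴹ-sym (+ᴹ-identityˡ _)
  comb-append {suc d} r b b′ = ≈ᴹ-trans (+ᴹ-congˡ (comb-append (r ∘ suc) (b ∘ suc) b′)) (≈ᴹ-sym (+ᴹ-assoc _ _ _))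

  append-comb : ∀ {d e} (r : Fin d → K) (s : Fin e → K) (b : Fin d → Carrierᴹ) (b′ : Fin e → Carrierᴹ) →
                comb (append r s) (append b b′) ≈ᴹ comb r b +ᴹ comb s b′
  append-comb {zero}  r s b b′ = ≈ᴹ-sym (+ᴹ-identityˡ _)
  append-comb {suc d} r s b b′ = ≈ᴹ-trans (+ᴹ-congˡ (append-comb (r ∘ suc) s (b ∘ suc) b′)) (≈ᴹ-sym (+ᴹ-assoc _ _ _))

  independent-∷ : ∀ {d} (b : Fin d → Carrierᴹ) {w} → Independent b → ¬ w ∈ Span b → Independent (w F.∷ b)
  independent-∷ b {w} ind w∉b r r≈0 with zero? (r zero)
  ... | yes r₀≈0 = λ where
        zero    → r₀≈0
        (suc i) → ind (r ∘ suc) (≈ᴹ-trans (≈ᴹ-sym (≈ᴹ-trans (+ᴹ-congʳ (≈ᴹ-trans (*ₗ-cong r₀≈0 ≈ᴹ-refl) (*ₗ-zeroˡ w)))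
                                             (+ᴹ-identityˡ _))) r≈0) i
  ... | no r₀≉0 with inv , r₀inv≈1 ← inverse _ r₀≉0 = ⊥-elim (w∉b (Subspace.≈-closed (span b) w≈
          (Subspace.*ₗ-closed (span b) (- inv) (r ∘ suc , ≈ᴹ-refl))))
    where
    rest = comb (r ∘ suc) b
    w≈ : (- inv) *ₗ rest ≈ᴹ w
    w≈ = begin
      (- inv) *ₗ rest                           ≈⟨ +ᴹ-identityˡ _ ⟨
      0ᴹ +ᴹ (- inv) *ₗ rest                     ≈⟨ +ᴹ-congʳ (*ₗ-zeroʳ inv) ⟨
      inv *ₗ 0ᴹ +ᴹ (- inv) *ₗ rest              ≈⟨ +ᴹ-congʳ (*ₗ-cong ≈-refl r≈0) ⟨
      inv *ₗ (r zero *ₗ w +ᴹ rest) +ᴹ (- inv) *ₗ rest ≈⟨ +ᴹ-congʳ (*ₗ-distribˡ inv _ _) ⟩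
      (inv *ₗ (r zero *ₗ w) +ᴹ inv *ₗ rest) +ᴹ (- inv) *ₗ rest ≈⟨ +ᴹ-assoc _ _ _ ⟩
      inv *ₗ (r zero *ₗ w) +ᴹ (inv *ₗ rest +ᴹ (- inv) *ₗ rest) ≈⟨ +ᴹ-congˡ (*ₗ-distribʳ rest inv (- inv)) ⟨
      inv *ₗ (r zero *ₗ w) +ᴹ (inv + - inv) *ₗ rest ≈⟨ +ᴹ-congˡ (*ₗ-cong (-‿inverseʳ inv) ≈ᴹ-refl) ⟩
      inv *ₗ (r zero *ₗ w) +ᴹ 0# *ₗ rest         ≈⟨ +ᴹ-congˡ (*ₗ-zeroˡ rest) ⟩
      inv *ₗ (r zero *ₗ w) +ᴹ 0ᴹ                ≈⟨ +ᴹ-identityʳ _ ⟩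
      inv *ₗ (r zero *ₗ w)                      ≈⟨ *ₗ-assoc inv (r zero) w ⟨
      (inv * r zero) *ₗ w                       ≈⟨ *ₗ-cong (≈-trans (*-comm _ _) r₀inv≈1) ≈ᴹ-refl ⟩
      1# *ₗ w                                   ≈⟨ *ₗ-identityˡ w ⟩
      w                                         ∎

  module _ {B : ℕ} (bounded : Bounded B) (H : Pred Carrierᴹ m) where

    -- `H` is any predicate, not only a subspace: applied to a set of homogeneous vectors it yields
    -- a basis of homogeneous vectors.
    extend : ∀ {d} (b : Fin d → Carrierᴹ) → Independent b →
             ∃ λ e → ∃ λ (b′ : Fin e → Carrierᴹ) →
               (∀ i → b′ i ∈ H) × Independent (append b′ b) × (∀ h → h ∈ H → h ∈ Span (append b′ b))
    extend {d} b ind = go (suc B) (ℕₚ.m≤m+n (suc B) _) F.[] (λ ()) ind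
      where
      -- The inequality says that the family grown so far and the remaining fuel together exceed
      -- `B`, so running out of fuel contradicts the bound.
      go : ∀ fuel {e} → B < fuel ℕ.+ (e ℕ.+ d) → (b′ : Fin e → Carrierᴹ) → (∀ i → b′ i ∈ H) → Independent (append b′ b) →
           ∃ λ e → ∃ λ (b′ : Fin e → Carrierᴹ) →
             (∀ i → b′ i ∈ H) × Independent (append b′ b) × (∀ h → h ∈ H → h ∈ Span (append b′ b))
      go zero B< b′ b′∈H ind = ⊥-elim (ℕₚ.<⇒≱ B< (bounded _ _ ind))
      go (suc fuel) {e} B< b′ b′∈H ind
        with lower-em (c ⊔ m ⊔ ℓm) (c ⊔ ℓ ⊔ m ⊔ ℓm) em {∃ λ h → h ∈ H × ¬ h ∈ Span (append b′ b)}
      ... | no none = e , b′ , b′∈H , ind , λ h h∈H →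
              decidable-stable (lower-em (c ⊔ ℓm) (c ⊔ ℓ ⊔ m ⊔ ℓm) em) λ h∉ → none (h , h∈H , h∉)
      ... | yes (h , h∈H , h∉) = go fuel (subst (B <_) (≡.sym (ℕₚ.+-suc fuel (e ℕ.+ d))) B<) (h F.∷ b′)
              (λ { zero → h∈H ; (suc i) → b′∈H i }) (independent-∷ (append b′ b) ind h∉)

  dimension : ∀ {B} → Bounded B → (W : Pred Carrierᴹ m) → ∃ λ d → HasDimension 𝔽 N W d
  dimension bounded W with e , b′ , b′∈W , ind , spans ← extend bounded W {zero} (λ ()) (λ _ _ ()) =
    e ℕ.+ 0 , record
      { basis = append b′ (λ ()) ; basis∈W = append-all W {g = λ ()} b′∈W (λ ())
      ; independent = ind ; spanning = spans }

  dimension-bound : ∀ {W : Pred Carrierᴹ p} {d e} → HasDimension 𝔽 N W d →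
                    (w : Fin e → Carrierᴹ) → (∀ i → w i ∈ W) → Independent w → e ≤ d
  dimension-bound dim w w∈W ind =
    steinitz (HasDimension.basis dim) w (λ i → HasDimension.spanning dim (w i) (w∈W i)) ind

  dimension-mono : ∀ {W : Pred Carrierᴹ p} {W′ : Pred Carrierᴹ q} {d d′} → W ⊆ W′ →
                   HasDimension 𝔽 N W d → HasDimension 𝔽 N W′ d′ → d ≤ d′
  dimension-mono W⊆W′ dim dim′ =
    dimension-bound dim′ (HasDimension.basis dim) (λ i → W⊆W′ (HasDimension.basis∈W dim i)) (HasDimension.independent dim)

  dimension-resp : ∀ {W : Pred Carrierᴹ p} {W′ : Pred Carrierᴹ q} {d} → W ⊆ W′ → W′ ⊆ W →
                   HasDimension 𝔽 N W d → HasDimension 𝔽 N W′ d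
  dimension-resp W⊆W′ W′⊆W dim = record
    { basis = basis ; basis∈W = λ i → W⊆W′ (basis∈W i)
    ; independent = independent ; spanning = λ w w∈W′ → spanning w (W′⊆W w∈W′) }
    where open HasDimension dim

  -- A vector of `W′` outside the span of a basis of `W` would give more than `d′` independent
  -- vectors in `W′`.
  ⊆-full-dimension : (W : Pred Carrierᴹ p) (W′ : Pred Carrierᴹ q) → ∀ {d d′} → W ⊆ W′ →
                     (W-sub : ∀ {b : Fin d → Carrierᴹ} → (∀ i → b i ∈ W) → Span b ⊆ W) →
                     HasDimension 𝔽 N W d → HasDimension 𝔽 N W′ d′ → d′ ≤ d → W′ ⊆ W
  ⊆-full-dimension W W′ {d} W⊆W′ W-sub dim dim′ d′≤d {w} w∈W′
    with lower-em (c ⊔ ℓm) (c ⊔ ℓ ⊔ m ⊔ ℓm) em {w ∈ Span (HasDimension.basis dim)}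
  ... | yes w∈ = W-sub (HasDimension.basis∈W dim) w∈
  ... | no  w∉ = ⊥-elim (ℕₚ.<⇒≱ (dimension-bound dim′ (w F.∷ HasDimension.basis dim)
          (λ { zero → w∈W′ ; (suc i) → W⊆W′ (HasDimension.basis∈W dim i) })
          (independent-∷ _ (HasDimension.independent dim) w∉)) d′≤d)

  _∩ˢ_ _+ˢ_ : Subspace 𝔽 N p → Subspace 𝔽 N p → Pred Carrierᴹ _
  (A ∩ˢ B) x = x ∈ Subspace.member A × x ∈ Subspace.member B
  (A +ˢ B) x = ∃ λ y → ∃ λ z → y ∈ Subspace.member A × z ∈ Subspace.member B × y +ᴹ z ≈ᴹ x

  intersection : Subspace 𝔽 N p → Subspace 𝔽 N p → Subspace 𝔽 N p
  intersection A B = record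
    { member    = A ∩ˢ B
    ; ≈-closed  = λ x≈y (x∈A , x∈B) → A.≈-closed x≈y x∈A , B.≈-closed x≈y x∈B
    ; 0-closed  = A.0-closed , B.0-closed
    ; +-closed  = λ (x∈A , x∈B) (y∈A , y∈B) → A.+-closed x∈A y∈A , B.+-closed x∈B y∈B
    ; *ₗ-closed = λ r (x∈A , x∈B) → A.*ₗ-closed r x∈A , B.*ₗ-closed r x∈B
    }
    where
    module A = Subspace A
    module B = Subspace B

  addition : Subspace 𝔽 N p → Subspace 𝔽 N p → Subspace 𝔽 N (m ⊔ ℓm ⊔ p)
  addition A B = record
    { member    = A +ˢ B
    ; ≈-closed  = λ x≈x′ (y , z , y∈A , z∈B , eq) → y , z , y∈A , z∈B , ≈ᴹ-trans eq x≈x′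
    ; 0-closed  = 0ᴹ , 0ᴹ , A.0-closed , B.0-closed , +ᴹ-identityˡ 0ᴹ
    ; +-closed  = λ (y , z , y∈A , z∈B , eq) (y′ , z′ , y′∈A , z′∈B , eq′) →
        y +ᴹ y′ , z +ᴹ z′ , A.+-closed y∈A y′∈A , B.+-closed z∈B z′∈B ,
        ≈ᴹ-trans (solveᴹ 4 (λ y y′ z z′ → (y ⊞ y′) ⊞ (z ⊞ z′) ≜ (y ⊞ z) ⊞ (y′ ⊞ z′)) ≈ᴹ-refl y y′ z z′) (+ᴹ-cong eq eq′)
    ; *ₗ-closed = λ r (y , z , y∈A , z∈B , eq) →
        r *ₗ y , r *ₗ z , A.*ₗ-closed r y∈A , B.*ₗ-closed r z∈B , ≈ᴹ-trans (≈ᴹ-sym (*ₗ-distribˡ r y z)) (*ₗ-cong ≈-refl eq)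
    }
    where
    module A = Subspace A
    module B = Subspace B

  regroup : ∀ x y z t → x +ᴹ (y +ᴹ (z +ᴹ t)) ≈ᴹ (x +ᴹ z) +ᴹ (y +ᴹ t)
  regroup = solveᴹ 4 (λ x y z t → x ⊞ (y ⊞ (z ⊞ t)) ≜ (x ⊞ z) ⊞ (y ⊞ t)) ≈ᴹ-refl

  module _ {B : ℕ} (bounded : Bounded B) (A A′ : Subspace 𝔽 N m) {d d′ : ℕ}
           (dim : HasDimension 𝔽 N (Subspace.member A) d) (dim′ : HasDimension 𝔽 N (Subspace.member A′) d′) where

    private
      module A = Subspace A
      module A′ = Subspace A′

    -- A basis `c₀` of the intersection is completed by `b` inside `A` and by `b′` inside `A′`; the
    -- three families together are a basis of the sum.
    modular : ∃ λ i → ∃ λ s → HasDimension 𝔽 N (A ∩ˢ A′) i × HasDimension 𝔽 N (A +ˢ A′) s × i ℕ.+ s ≡ d ℕ.+ d′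
    modular = i , e ℕ.+ (e′ ℕ.+ i) , dim-∩ , dim-+ ,
      ≡.trans (≡.sym (ℕₚ.+-assoc i e (e′ ℕ.+ i)))
        (cong₂ ℕ._+_ (≡.trans (ℕₚ.+-comm i e) e+i≡d) e′+i≡d′)
      where
      i = proj₁ (dimension bounded (A ∩ˢ A′))
      dim-∩ = proj₂ (dimension bounded (A ∩ˢ A′))
      c₀ = HasDimension.basis dim-∩
      extension = extend bounded A.member c₀ (HasDimension.independent dim-∩)
      e = proj₁ extension
      b = proj₁ (proj₂ extension)
      b∈A = proj₁ (proj₂ (proj₂ extension))
      ind = proj₁ (proj₂ (proj₂ (proj₂ extension)))
      spans = proj₂ (proj₂ (proj₂ (proj₂ extension)))
      extension′ = extend bounded A′.member c₀ (HasDimension.independent dim-∩)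
      e′ = proj₁ extension′
      b′ = proj₁ (proj₂ extension′)
      b′∈A′ = proj₁ (proj₂ (proj₂ extension′))
      ind′ = proj₁ (proj₂ (proj₂ (proj₂ extension′)))
      spans′ = proj₂ (proj₂ (proj₂ (proj₂ extension′)))
      c₀∈A : ∀ k → c₀ k ∈ A.member
      c₀∈A k = proj₁ (HasDimension.basis∈W dim-∩ k)
      c₀∈A′ : ∀ k → c₀ k ∈ A′.member
      c₀∈A′ k = proj₂ (HasDimension.basis∈W dim-∩ k)
      same : ∀ {e d q} {W : Pred Carrierᴹ q} (b : Fin e → Carrierᴹ) → (∀ k → append b c₀ k ∈ W) →
             Independent (append b c₀) → (∀ w → w ∈ W → w ∈ Span (append b c₀)) →
             HasDimension 𝔽 N W d → e ℕ.+ i ≡ d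
      same b b∈W ind spans dim = ℕₚ.≤-antisym (dimension-bound dim _ b∈W ind)
        (steinitz _ (HasDimension.basis dim) (λ k → spans _ (HasDimension.basis∈W dim k)) (HasDimension.independent dim))
      e+i≡d : e ℕ.+ i ≡ d
      e+i≡d = same b (append-all A.member {f = b} b∈A c₀∈A) ind spans dim
      e′+i≡d′ : e′ ℕ.+ i ≡ d′
      e′+i≡d′ = same b′ (append-all A′.member {f = b′} b′∈A′ c₀∈A′) ind′ spans′ dim′

      b″ = append b (append b′ c₀)

      ∈-+ˢˡ : ∀ {x} → x ∈ A.member → x ∈ (A +ˢ A′)
      ∈-+ˢˡ {x} x∈A = x , 0ᴹ , x∈A , A′.0-closed , +ᴹ-identityʳ x
      ∈-+ˢʳ : ∀ {x} → x ∈ A′.member → x ∈ (A +ˢ A′)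
      ∈-+ˢʳ {x} x∈A′ = 0ᴹ , x , A.0-closed , x∈A′ , +ᴹ-identityˡ x

      spanning″ : ∀ w → w ∈ (A +ˢ A′) → w ∈ Span b″
      spanning″ w (y , z , y∈A , z∈A′ , y+z≈w) = append r₁ (append s₁ t) , (begin
          comb (append r₁ (append s₁ t)) b″
            ≈⟨ append-comb r₁ (append s₁ t) b (append b′ c₀) ⟩
          comb r₁ b +ᴹ comb (append s₁ t) (append b′ c₀)
            ≈⟨ +ᴹ-congˡ (append-comb s₁ t b′ c₀) ⟩
          comb r₁ b +ᴹ (comb s₁ b′ +ᴹ comb t c₀)
            ≈⟨ +ᴹ-congˡ (+ᴹ-congˡ (comb-+ r₂ s₂ c₀)) ⟨
          comb r₁ b +ᴹ (comb s₁ b′ +ᴹ (comb r₂ c₀ +ᴹ comb s₂ c₀))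
            ≈⟨ regroup (comb r₁ b) (comb s₁ b′) (comb r₂ c₀) (comb s₂ c₀) ⟩
          (comb r₁ b +ᴹ comb r₂ c₀) +ᴹ (comb s₁ b′ +ᴹ comb s₂ c₀)
            ≈⟨ +ᴹ-cong (comb-append r b c₀) (comb-append s b′ c₀) ⟨
          comb r (append b c₀) +ᴹ comb s (append b′ c₀)
            ≈⟨ +ᴹ-cong (proj₂ (spans y y∈A)) (proj₂ (spans′ z z∈A′)) ⟩
          y +ᴹ z
            ≈⟨ y+z≈w ⟩
          w ∎)
        where
        r = proj₁ (spans y y∈A)
        s = proj₁ (spans′ z z∈A′)
        r₁ : Fin e → K
        r₁ k = r (k ↑ˡ i)
        r₂ : Fin i → K
        r₂ k = r (e ↑ʳ k)
        s₁ : Fin e′ → K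
        s₁ k = s (k ↑ˡ i)
        s₂ : Fin i → K
        s₂ k = s (e′ ↑ʳ k)
        t : Fin i → K
        t k = r₂ k + s₂ k

      negate : ∀ {n} (r : Fin n → K) (f : Fin n → Carrierᴹ) {x} → x +ᴹ comb r f ≈ᴹ 0ᴹ → comb (λ k → - 1# * r k) f ≈ᴹ x
      negate r f {x} x+rf≈0 = begin
        comb (λ k → - 1# * r k) f                       ≈⟨ comb-scale (- 1#) r f ⟨
        (- 1#) *ₗ comb r f                              ≈⟨ +ᴹ-identityˡ _ ⟨
        0ᴹ +ᴹ (- 1#) *ₗ comb r f                        ≈⟨ +ᴹ-congʳ x+rf≈0 ⟨
        (x +ᴹ comb r f) +ᴹ (- 1#) *ₗ comb r f           ≈⟨ +ᴹ-assoc _ _ _ ⟩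
        x +ᴹ (comb r f +ᴹ (- 1#) *ₗ comb r f)           ≈⟨ +ᴹ-congˡ (+ᴹ-congʳ (*ₗ-identityˡ _)) ⟨
        x +ᴹ (1# *ₗ comb r f +ᴹ (- 1#) *ₗ comb r f)     ≈⟨ +ᴹ-congˡ (*ₗ-distribʳ (comb r f) 1# (- 1#)) ⟨
        x +ᴹ (1# + - 1#) *ₗ comb r f                    ≈⟨ +ᴹ-congˡ (*ₗ-cong (-‿inverseʳ 1#) ≈ᴹ-refl) ⟩
        x +ᴹ 0# *ₗ comb r f                             ≈⟨ +ᴹ-congˡ (*ₗ-zeroˡ _) ⟩
        x +ᴹ 0ᴹ                                         ≈⟨ +ᴹ-identityʳ _ ⟩
        x                                               ∎

      independent″ : Independent b″
      independent″ r r≈0 = go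
        where
        rb = λ k → r (k ↑ˡ (e′ ℕ.+ i))
        rest = λ k → r (e ↑ʳ k)
        x = comb rb b
        x+rest≈0 : x +ᴹ comb rest (append b′ c₀) ≈ᴹ 0ᴹ
        x+rest≈0 = ≈ᴹ-trans (≈ᴹ-sym (comb-append r b (append b′ c₀))) r≈0
        -- The part `x` of the relation carried by `b` is minus the rest, which lies in `A′`. So `x`
        -- lies in the intersection and is a combination of `c₀`, and independence of `b` together
        -- with `c₀` kills its coefficients.
        x∈A′ : x ∈ A′.member
        x∈A′ = A′.≈-closed (negate rest (append b′ c₀) x+rest≈0)
                 (comb-closed A′ (λ k → - 1# * rest k) (append-all A′.member {f = b′} b′∈A′ c₀∈A′))
        x-span : x ∈ Span c₀
        x-span = HasDimension.spanning dim-∩ x (comb-closed A rb b∈A , x∈A′)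
        s = proj₁ x-span
        rb≈0 : ∀ k → rb k ≈ 0#
        rb≈0 k = ≈-trans (≈-reflexive (≡.sym (append-↑ˡ rb _ k))) (ind (append rb (λ k → - 1# * s k)) (begin
          comb (append rb (λ k → - 1# * s k)) (append b c₀) ≈⟨ append-comb rb (λ k → - 1# * s k) b c₀ ⟩
          x +ᴹ comb (λ k → - 1# * s k) c₀                   ≈⟨ +ᴹ-cong (≈ᴹ-sym (*ₗ-identityˡ x)) (≈ᴹ-sym (comb-scale (- 1#) s c₀)) ⟩
          1# *ₗ x +ᴹ (- 1#) *ₗ comb s c₀                    ≈⟨ +ᴹ-congˡ (*ₗ-cong ≈-refl (proj₂ x-span)) ⟩
          1# *ₗ x +ᴹ (- 1#) *ₗ x                            ≈⟨ *ₗ-distribʳ x 1# (- 1#) ⟨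
          (1# + - 1#) *ₗ x                                  ≈⟨ *ₗ-cong (-‿inverseʳ 1#) ≈ᴹ-refl ⟩
          0# *ₗ x                                           ≈⟨ *ₗ-zeroˡ x ⟩
          0ᴹ                                                ∎) (k ↑ˡ i))
          where
          append-↑ˡ : ∀ {m n} (f : Fin m → K) (g : Fin n → K) k → append f g (k ↑ˡ n) ≡ f k
          append-↑ˡ f g zero    = refl
          append-↑ˡ f g (suc k) = append-↑ˡ (f ∘ suc) g k
        rest≈0 : ∀ k → rest k ≈ 0#
        rest≈0 = ind′ rest (≈ᴹ-trans (≈ᴹ-sym (≈ᴹ-trans (+ᴹ-congʳ
          (≈ᴹ-trans (comb-cong {e} {rb} {λ _ → 0#} {b} {b} rb≈0 (λ _ → ≈ᴹ-refl)) (comb-0 b))) (+ᴹ-identityˡ _))) x+rest≈0)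
        go : ∀ k → r k ≈ 0#
        go k = split e r rb≈0 rest≈0 k
          where
          split : ∀ m {n} (r : Fin (m ℕ.+ n) → K) → (∀ k → r (k ↑ˡ n) ≈ 0#) → (∀ k → r (m ↑ʳ k) ≈ 0#) → ∀ k → r k ≈ 0#
          split zero    r l≈0 r≈0 k       = r≈0 k
          split (suc m) r l≈0 r≈0 zero    = l≈0 zero
          split (suc m) r l≈0 r≈0 (suc k) = split m (r ∘ suc) (l≈0 ∘ suc) r≈0 k

      dim-+ : HasDimension 𝔽 N (A +ˢ A′) (e ℕ.+ (e′ ℕ.+ i))
      dim-+ = record
        { basis = b″
        ; basis∈W = append-all (A +ˢ A′) {f = b} (λ k → ∈-+ˢˡ (b∈A k))
                      (append-all (A +ˢ A′) {f = b′} (λ k → ∈-+ˢʳ (b′∈A′ k)) (λ k → ∈-+ˢˡ (c₀∈A k)))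
        ; independent = independent″
        ; spanning = spanning″
        }

-- Polynomials in one variable over an algebraically closed field

module Univariate {c ℓ} (𝔽 : CommutativeRing c ℓ) (isField : IsField 𝔽)
                  (closed : IsAlgebraicallyClosed 𝔽) (em : ExcludedMiddle ℓ) where

  open FieldLemmas 𝔽 isField em
  open SemiringExp semiring using (_^_)

  Poly : Set a → Set (a ⊔ c)
  Poly = Polynomial 𝔽

  eval : ∀ {X : Set a} → Poly X → (X → K) → K
  eval = ⟦_⟧ 𝔽

  eval-cong : ∀ {X : Set a} (q : Poly X) {v w : X → K} → (∀ i → v i ≈ w i) → eval q v ≈ eval q w
  eval-cong (con r)  v≈w = ≈-refl
  eval-cong (var i)  v≈w = v≈w i
  eval-cong (q :+ s) v≈w = +-cong (eval-cong q v≈w) (eval-cong s v≈w)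
  eval-cong (q :* s) v≈w = *-cong (eval-cong q v≈w) (eval-cong s v≈w)

  _⟪_⟫ : ∀ {X : Set a} {Y : Set p} → Poly X → (X → Poly Y) → Poly Y
  con r    ⟪ σ ⟫ = con r
  var i    ⟪ σ ⟫ = σ i
  (q :+ s) ⟪ σ ⟫ = (q ⟪ σ ⟫) :+ (s ⟪ σ ⟫)
  (q :* s) ⟪ σ ⟫ = (q ⟪ σ ⟫) :* (s ⟪ σ ⟫)

  eval-⟪⟫ : ∀ {X : Set a} {Y : Set p} (q : Poly X) (σ : X → Poly Y) w →
            eval (q ⟪ σ ⟫) w ≈ eval q (λ i → eval (σ i) w)
  eval-⟪⟫ (con r)  σ w = ≈-refl
  eval-⟪⟫ (var i)  σ w = ≈-refl
  eval-⟪⟫ (q :+ s) σ w = +-cong (eval-⟪⟫ q σ w) (eval-⟪⟫ s σ w)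
  eval-⟪⟫ (q :* s) σ w = *-cong (eval-⟪⟫ q σ w) (eval-⟪⟫ s σ w)

  -- The variable `nothing` is singled out for elimination, and `just` embeds the parameters.
  _▸_ : ∀ {X : Set a} → (X → K) → K → Maybe X → K
  w ▸ z = maybe′ w z

  module _ {X : Set a} where

    -- Coefficient lists: low starts from the constant term, high from the leading one.
    low : List (Poly X) → (X → K) → K → K
    low []       w z = 0#
    low (q ∷ qs) w z = eval q w + z * low qs w z

    high : List (Poly X) → (X → K) → K → K
    high []       w z = 0#
    high (q ∷ qs) w z = eval q w * z ^ length qs + high qs w z

    private
      _⊞_ : List (Poly X) → List (Poly X) → List (Poly X)
      []       ⊞ rs       = rs
      (q ∷ qs) ⊞ []       = q ∷ qs
      (q ∷ qs) ⊞ (r ∷ rs) = (q :+ r) ∷ (qs ⊞ rs)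

      scale : Poly X → List (Poly X) → List (Poly X)
      scale q []       = []
      scale q (r ∷ rs) = (q :* r) ∷ scale q rs

      _⊠_ : List (Poly X) → List (Poly X) → List (Poly X)
      []       ⊠ rs = []
      (q ∷ qs) ⊠ rs = scale q rs ⊞ (con 0# ∷ (qs ⊠ rs))

      low-⊞ : ∀ qs rs w z → low (qs ⊞ rs) w z ≈ low qs w z + low rs w z
      low-⊞ []       rs       w z = ≈-sym (+-identityˡ _)
      low-⊞ (q ∷ qs) []       w z = ≈-sym (+-identityʳ _)
      low-⊞ (q ∷ qs) (r ∷ rs) w z = ≈-trans (+-congˡ (*-congˡ (low-⊞ qs rs w z)))
        (solve 5 (λ q r z x y → (q ⊕ r) ⊕ z ⊗ (x ⊕ y) := (q ⊕ z ⊗ x) ⊕ (r ⊕ z ⊗ y)) ≈-refl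
          (eval q w) (eval r w) z (low qs w z) (low rs w z))

      low-scale : ∀ q rs w z → low (scale q rs) w z ≈ eval q w * low rs w z
      low-scale q []       w z = ≈-sym (zeroʳ _)
      low-scale q (r ∷ rs) w z = ≈-trans (+-congˡ (*-congˡ (low-scale q rs w z)))
        (solve 4 (λ q r z x → q ⊗ r ⊕ z ⊗ (q ⊗ x) := q ⊗ (r ⊕ z ⊗ x)) ≈-refl
          (eval q w) (eval r w) z (low rs w z))

      low-⊠ : ∀ qs rs w z → low (qs ⊠ rs) w z ≈ low qs w z * low rs w z
      low-⊠ []       rs w z = ≈-sym (zeroˡ _)
      low-⊠ (q ∷ qs) rs w z = ≈-trans (low-⊞ (scale q rs) (con 0# ∷ (qs ⊠ rs)) w z)
        (≈-trans (+-cong (low-scale q rs w z) (≈-trans (+-identityˡ _) (*-congˡ (low-⊠ qs rs w z))))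
        (solve 4 (λ q z x y → q ⊗ y ⊕ z ⊗ (x ⊗ y) := (q ⊕ z ⊗ x) ⊗ y) ≈-refl
          (eval q w) z (low qs w z) (low rs w z)))

      lows : Poly (Maybe X) → List (Poly X)
      lows (con r)        = con r ∷ []
      lows (var (just i)) = var i ∷ []
      lows (var nothing)  = con 0# ∷ con 1# ∷ []
      lows (q :+ s)       = lows q ⊞ lows s
      lows (q :* s)       = lows q ⊠ lows s

      low-lows : ∀ q w z → low (lows q) w z ≈ eval q (w ▸ z)
      low-lows (con r)        w z = ≈-trans (+-congˡ (zeroʳ z)) (+-identityʳ _)
      low-lows (var (just i)) w z = ≈-trans (+-congˡ (zeroʳ z)) (+-identityʳ _)
      low-lows (var nothing)  w z = ≈-trans (+-identityˡ _) (≈-trans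
        (*-congˡ (≈-trans (+-congˡ (zeroʳ z)) (+-identityʳ _))) (*-identityʳ z))
      low-lows (q :+ s)       w z = ≈-trans (low-⊞ (lows q) (lows s) w z) (+-cong (low-lows q w z) (low-lows s w z))
      low-lows (q :* s)       w z = ≈-trans (low-⊠ (lows q) (lows s) w z) (*-cong (low-lows q w z) (low-lows s w z))

      snoc : List (Poly X) → Poly X → List (Poly X)
      snoc []       r = r ∷ []
      snoc (q ∷ qs) r = q ∷ snoc qs r

      length-snoc : ∀ qs r → length (snoc qs r) ≡ suc (length qs)
      length-snoc []       r = refl
      length-snoc (q ∷ qs) r = cong suc (length-snoc qs r)

      high-snoc : ∀ qs r w z → high (snoc qs r) w z ≈ eval r w + z * high qs w z
      high-snoc []       r w z = +-cong (*-identityʳ _) (≈-sym (zeroʳ z))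
      high-snoc (q ∷ qs) r w z = ≈-trans
        (+-cong (*-congˡ (≈-reflexive (cong (z ^_) (length-snoc qs r)))) (high-snoc qs r w z))
        (solve 5 (λ q z zn r x → q ⊗ (z ⊗ zn) ⊕ (r ⊕ z ⊗ x) := r ⊕ z ⊗ (q ⊗ zn ⊕ x)) ≈-refl
          (eval q w) z (z ^ length qs) (eval r w) (high qs w z))

      rev : List (Poly X) → List (Poly X)
      rev []       = []
      rev (q ∷ qs) = snoc (rev qs) q

      high-rev : ∀ qs w z → high (rev qs) w z ≈ low qs w z
      high-rev []       w z = ≈-refl
      high-rev (q ∷ qs) w z = ≈-trans (high-snoc (rev qs) q w z) (+-congˡ (*-congˡ (high-rev qs w z)))

    -- Sums and products are computed from the constant term upwards, whereas division consumes
    -- leading coefficients, hence the reversal.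
    coefficients : Poly (Maybe X) → List (Poly X)
    coefficients q = rev (lows q)

    high-coefficients : ∀ q w z → high (coefficients q) w z ≈ eval q (w ▸ z)
    high-coefficients q w z = ≈-trans (high-rev (lows q) w z) (low-lows q w z)

  ev : List K → K → K
  ev []       z = 0#
  ev (x ∷ xs) z = x * z ^ length xs + ev xs z

  at : ∀ {X : Set a} → (X → K) → List (Poly X) → List K
  at w = List.map (λ q → eval q w)

  length-at : ∀ {X : Set a} (w : X → K) qs → length (at w qs) ≡ length qs
  length-at w []       = refl
  length-at w (q ∷ qs) = cong suc (length-at w qs)

  ev-at : ∀ {X : Set a} (w : X → K) qs z → ev (at w qs) z ≈ high qs w z
  ev-at w []       z = ≈-refl
  ev-at w (q ∷ qs) z = +-cong (*-congˡ (≈-reflexive (cong (z ^_) (length-at w qs)))) (ev-at w qs z)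

  strip : ∀ xs → (∀ z → ev xs z ≈ 0#) ⊎
                 (∃ λ x → ∃ λ ys → ¬ x ≈ 0# × (∀ z → ev (x ∷ ys) z ≈ ev xs z))
  strip []       = inj₁ λ _ → ≈-refl
  strip (x ∷ xs) with zero? x | strip xs
  ... | no x≉0  | _ = inj₂ (x , xs , x≉0 , λ _ → ≈-refl)
  ... | yes x≈0 | inj₁ xs≈0 = inj₁ λ z → ≈-trans (+-cong (≈-trans (*-congʳ x≈0) (zeroˡ _)) (xs≈0 z)) (+-identityˡ _)
  ... | yes x≈0 | inj₂ (y , ys , y≉0 , ys≈xs) = inj₂ (y , ys , y≉0 , λ z →
          ≈-trans (ys≈xs z) (≈-sym (≈-trans (+-congʳ (≈-trans (*-congʳ x≈0) (zeroˡ _))) (+-identityˡ _))))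

  private
    opposite-fromℕ : ∀ n → opposite (fromℕ n) ≡ zero
    opposite-fromℕ zero    = refl
    opposite-fromℕ (suc n) = cong inject₁ (opposite-fromℕ n)

    opposite-inject₁ : ∀ {n} (i : Fin n) → opposite (inject₁ i) ≡ suc (opposite i)
    opposite-inject₁ zero    = refl
    opposite-inject₁ (suc i) = cong inject₁ (opposite-inject₁ i)

    reversed : (xs : List K) → Fin (length xs) → K
    reversed xs i = List.lookup xs (opposite i)

    sum-reversed : ∀ xs z → sum (λ i → reversed xs i * z ^ toℕ i) ≈ ev xs z
    sum-reversed []       z = ≈-refl
    sum-reversed (x ∷ xs) z = begin
      sum (λ i → reversed (x ∷ xs) i * z ^ toℕ i)
        ≈⟨ sum-init-last (λ i → reversed (x ∷ xs) i * z ^ toℕ i) ⟩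
      sum (λ i → reversed (x ∷ xs) (inject₁ i) * z ^ toℕ (inject₁ i)) + reversed (x ∷ xs) (fromℕ (length xs)) * z ^ toℕ (fromℕ (length xs))
        ≈⟨ +-cong (sum-cong-≋ λ i → *-cong (≈-reflexive (cong (List.lookup (x ∷ xs)) (opposite-inject₁ i)))
                                           (≈-reflexive (cong (z ^_) (Finₚ.toℕ-inject₁ i))))
                  (*-cong (≈-reflexive (cong (List.lookup (x ∷ xs)) (opposite-fromℕ (length xs))))
                          (≈-reflexive (cong (z ^_) (Finₚ.toℕ-fromℕ (length xs))))) ⟩
      sum (λ i → reversed xs i * z ^ toℕ i) + x * z ^ length xs
        ≈⟨ ≈-trans (+-congʳ (sum-reversed xs z)) (+-comm _ _) ⟩
      x * z ^ length xs + ev xs z ∎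

  -- The two displayed entries `x` and `y` make the degree at least one; `closed` numbers
  -- coefficients from the constant term, hence the passage through `reversed`.
  root : ∀ x y ys → ¬ x ≈ 0# → ∃ λ α → ev (x ∷ y ∷ ys) α ≈ 0#
  root x y ys x≉0
    with α , α-root ← closed (length ys) (reversed (x ∷ y ∷ ys))
           (λ eq → x≉0 (≈-trans (≈-sym (≈-reflexive (cong (List.lookup (x ∷ y ∷ ys)) (opposite-fromℕ (suc (length ys)))))) eq)) =
    α , ≈-trans (≈-sym (sum-reversed (x ∷ y ∷ ys) α)) α-root

  private
    bump : K → List K → List K
    bump x []       = (x + 1#) ∷ []
    bump x (y ∷ ys) = x ∷ bump y ys

    length-bump : ∀ x xs → length (bump x xs) ≡ suc (length xs)
    length-bump x []       = refl
    length-bump x (y ∷ ys) = cong suc (length-bump y ys)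

    ev-bump : ∀ x xs z → ev (bump x xs) z ≈ ev (x ∷ xs) z + 1#
    ev-bump x []       z = begin
      (x + 1#) * 1# + 0#  ≈⟨ +-identityʳ _ ⟩
      (x + 1#) * 1#       ≈⟨ *-identityʳ _ ⟩
      x + 1#              ≈⟨ +-congʳ (≈-trans (+-identityʳ _) (*-identityʳ x)) ⟨
      x * 1# + 0# + 1#    ∎
    ev-bump x (y ∷ ys) z = ≈-trans
      (+-cong (*-congˡ (≈-reflexive (cong (z ^_) (length-bump y ys)))) (ev-bump y ys z)) (≈-sym (+-assoc _ _ _))

  -- If the values were all zero then adding one would give a polynomial without roots.
  nonroot : ∀ x xs → ¬ x ≈ 0# → ∃ λ z → ¬ ev (x ∷ xs) z ≈ 0#
  nonroot x [] x≉0 = 0# , λ eq → x≉0 (≈-trans (≈-sym (≈-trans (+-identityʳ _) (*-identityʳ x))) eq)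
  nonroot x (y ∷ ys) x≉0 = proj₁ bumped , λ eq → 1≉0 (begin
      1#                                          ≈⟨ +-identityˡ 1# ⟨
      0# + 1#                                     ≈⟨ +-congʳ eq ⟨
      ev (x ∷ y ∷ ys) (proj₁ bumped) + 1#         ≈⟨ ev-bump x (y ∷ ys) (proj₁ bumped) ⟨
      ev (bump x (y ∷ ys)) (proj₁ bumped)         ≈⟨ proj₂ bumped ⟩
      0#                                          ∎)
    where
    go : ∀ y ys → ∃ λ α → ev (x ∷ bump y ys) α ≈ 0#
    go y []        = root x _ [] x≉0
    go y (y′ ∷ ys) = root x y (bump y′ ys) x≉0
    bumped = go y ys

  private
    -- Horner's scheme for division by `z + - α`: the running value `x` is the next coefficient of
    -- the quotient and, at the end of the list, the remainder.
    quotient : K → K → List K → List K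
    quotient α x []       = []
    quotient α x (y ∷ ys) = x ∷ quotient α (y + α * x) ys

    remainder : K → K → List K → K
    remainder α x []       = x
    remainder α x (y ∷ ys) = remainder α (y + α * x) ys

    length-quotient : ∀ α x xs → length (quotient α x xs) ≡ length xs
    length-quotient α x []       = refl
    length-quotient α x (y ∷ ys) = cong suc (length-quotient α (y + α * x) ys)

    division : ∀ α x xs z → ev (x ∷ xs) z ≈ (z + - α) * ev (quotient α x xs) z + remainder α x xs
    division α x [] z = begin
      x * 1# + 0#              ≈⟨ ≈-trans (+-identityʳ _) (*-identityʳ x) ⟩
      x                        ≈⟨ +-identityˡ x ⟨
      0# + x                   ≈⟨ +-congʳ (zeroʳ _) ⟨
      (z + - α) * 0# + x       ∎
    division α x (y ∷ ys) z = begin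
      x * (z * zn) + (y * zn + ev ys z)
        ≈⟨ +-identityʳ _ ⟨
      x * (z * zn) + (y * zn + ev ys z) + 0#
        ≈⟨ +-congˡ (≈-trans (*-congʳ (-‿inverseˡ α)) (zeroˡ _)) ⟨
      x * (z * zn) + (y * zn + ev ys z) + (- α + α) * (x * zn)
        ≈⟨ solve 7 (λ x z zn y e β α → x ⊗ (z ⊗ zn) ⊕ (y ⊗ zn ⊕ e) ⊕ (β ⊕ α) ⊗ (x ⊗ zn) :=
                     (z ⊕ β) ⊗ (x ⊗ zn) ⊕ ((y ⊕ α ⊗ x) ⊗ zn ⊕ e)) ≈-refl x z zn y (ev ys z) (- α) α ⟩
      (z + - α) * (x * zn) + ((y + α * x) * zn + ev ys z)
        ≈⟨ +-congˡ (division α (y + α * x) ys z) ⟩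
      (z + - α) * (x * zn) + ((z + - α) * ev Q z + R)
        ≈⟨ ≈-trans (≈-sym (+-assoc _ _ _)) (+-congʳ (≈-sym (distribˡ _ _ _))) ⟩
      (z + - α) * (x * zn + ev Q z) + R
        ≈⟨ +-congʳ (*-congˡ (+-congʳ (*-congˡ (≈-reflexive (cong (z ^_) (length-quotient α (y + α * x) ys)))))) ⟨
      (z + - α) * (x * z ^ length Q + ev Q z) + R ∎
      where
      zn = z ^ length ys
      Q = quotient α (y + α * x) ys
      R = remainder α (y + α * x) ys

    factor : ∀ α x xs → ev (x ∷ xs) α ≈ 0# → ∀ z → ev (x ∷ xs) z ≈ (z + - α) * ev (quotient α x xs) z
    factor α x xs α-root z = ≈-trans (division α x xs z) (≈-trans (+-congˡ rem≈0) (+-identityʳ _))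
      where
      rem≈0 : remainder α x xs ≈ 0#
      rem≈0 = begin
        remainder α x xs                                            ≈⟨ +-identityˡ _ ⟨
        0# + remainder α x xs                                       ≈⟨ +-congʳ (zeroˡ _) ⟨
        0# * ev (quotient α x xs) α + remainder α x xs              ≈⟨ +-congʳ (*-congʳ (-‿inverseʳ α)) ⟨
        (α + - α) * ev (quotient α x xs) α + remainder α x xs       ≈⟨ division α x xs α ⟨
        ev (x ∷ xs) α                                               ≈⟨ α-root ⟩
        0#                                                          ∎

  -- Polynomial functions, known by their values up to `≈`. With `Maybe ⊥` as the set of variables,
  -- `coefficients` applies and leaves no parameters.
  Univariate : (K → K) → Set (c ⊔ ℓ)
  Univariate f = ∃ λ (q : Poly (Maybe ⊥)) → ∀ z → eval q (⊥-elim ▸ z) ≈ f z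

  u-const : ∀ x → Univariate (λ _ → x)
  u-const x = con x , λ _ → ≈-refl

  u-id : Univariate (λ z → z)
  u-id = var nothing , λ _ → ≈-refl

  u-+ : ∀ {f g} → Univariate f → Univariate g → Univariate (λ z → f z + g z)
  u-+ (q , q≈f) (r , r≈g) = q :+ r , λ z → +-cong (q≈f z) (r≈g z)

  u-* : ∀ {f g} → Univariate f → Univariate g → Univariate (λ z → f z * g z)
  u-* (q , q≈f) (r , r≈g) = q :* r , λ z → *-cong (q≈f z) (r≈g z)

  u-neg : ∀ {f} → Univariate f → Univariate (λ z → - f z)
  u-neg (q , q≈f) = con (- 1#) :* q , λ z → ≈-trans (-1*x≈-x _) (-‿cong (q≈f z))

  u-^ : ∀ {f} n → Univariate f → Univariate (λ z → f z ^ n)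
  u-^ zero    uf = u-const 1#
  u-^ (suc n) uf = u-* uf (u-^ n uf)

  u-ev : ∀ xs → Univariate (ev xs)
  u-ev []       = u-const 0#
  u-ev (x ∷ xs) = u-+ (u-* (u-const x) (u-^ (length xs) u-id)) (u-ev xs)

  coefficient-list : ∀ {f} → Univariate f → ∃ λ xs → ∀ z → ev xs z ≈ f z
  coefficient-list (q , q≈f) = at ⊥-elim (coefficients q) , λ z →
    ≈-trans (ev-at ⊥-elim (coefficients q) z) (≈-trans (high-coefficients q ⊥-elim z) (q≈f z))

  leading : ∀ {f y} → Univariate f → ¬ f y ≈ 0# → ∃ λ x → ∃ λ xs → ¬ x ≈ 0# × (∀ z → ev (x ∷ xs) z ≈ f z)
  leading {y = y} uf fy≉0 with xs , xs≈f ← coefficient-list uf with strip xs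
  ... | inj₁ xs≈0 = ⊥-elim (fy≉0 (≈-trans (≈-sym (xs≈f y)) (xs≈0 y)))
  ... | inj₂ (x , ys , x≉0 , ys≈xs) = x , ys , x≉0 , λ z → ≈-trans (ys≈xs z) (xs≈f z)

  private
    -- `y ∷ multiply β y ys` is the product of `y ∷ ys` with `z + β`. It displays the unchanged
    -- leading coefficient `y`, which is what `nonroot` asks for.
    multiply : K → K → List K → List K
    multiply β y []        = (β * y) ∷ []
    multiply β y (y′ ∷ ys) = (y′ + β * y) ∷ multiply β y′ ys
    length-multiply : ∀ β y ys → length (multiply β y ys) ≡ suc (length ys)
    length-multiply β y []        = refl
    length-multiply β y (y′ ∷ ys) = cong suc (length-multiply β y′ ys)
    ev-multiply : ∀ β y ys z → ev (multiply β y ys) z ≈ z * ev ys z + β * ev (y ∷ ys) z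
    ev-multiply β y [] z = begin
      β * y * 1# + 0#                  ≈⟨ ≈-trans (+-identityʳ _) (*-assoc _ _ _) ⟩
      β * (y * 1#)                     ≈⟨ *-congˡ (+-identityʳ _) ⟨
      β * (y * 1# + 0#)                ≈⟨ +-identityˡ _ ⟨
      0# + β * (y * 1# + 0#)           ≈⟨ +-congʳ (zeroʳ z) ⟨
      z * 0# + β * (y * 1# + 0#)       ∎
    ev-multiply β y (y′ ∷ ys) z = ≈-trans
      (+-cong (*-congˡ (≈-reflexive (cong (z ^_) (length-multiply β y′ ys)))) (ev-multiply β y′ ys z))
      (solve 6 (λ y y′ β z zn e → (y′ ⊕ β ⊗ y) ⊗ (z ⊗ zn) ⊕ (z ⊗ e ⊕ β ⊗ (y′ ⊗ zn ⊕ e)) :=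
                 z ⊗ (y′ ⊗ zn ⊕ e) ⊕ β ⊗ (y ⊗ (z ⊗ zn) ⊕ (y′ ⊗ zn ⊕ e))) ≈-refl
        y y′ β z (z ^ length ys) (ev ys z))
    ev-product : ∀ β y ys z → ev (y ∷ multiply β y ys) z ≈ (z + β) * ev (y ∷ ys) z
    ev-product β y ys z = ≈-trans
      (+-cong (*-congˡ (≈-reflexive (cong (z ^_) (length-multiply β y ys)))) (ev-multiply β y ys z))
      (solve 5 (λ y β z zn e → y ⊗ (z ⊗ zn) ⊕ (z ⊗ e ⊕ β ⊗ (y ⊗ zn ⊕ e)) := (z ⊕ β) ⊗ (y ⊗ zn ⊕ e)) ≈-refl
        y β z (z ^ length ys) (ev ys z))
    nonroot′ : ∀ y ys → ¬ y ≈ 0# → ∀ α → ∃ λ t → ¬ (t + - α) * ev (y ∷ ys) t ≈ 0#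
    nonroot′ y ys y≉0 α with t , t≉0 ← nonroot y (multiply (- α) y ys) y≉0 =
      t , λ eq → t≉0 (≈-trans (ev-product (- α) y ys t) eq)

    -- A root `α` of the first polynomial is split off and the factor `z + - α` handed over to `g`,
    -- which stays nonzero because its leading coefficient is unchanged. Once the first polynomial
    -- is constant, any non-root of `g` serves.
    common-nonroot′ : ∀ n x xs → length xs ≡ n → ¬ x ≈ 0# → ∀ {g y} → Univariate g → ¬ g y ≈ 0# →
                      ∃ λ z → ¬ ev (x ∷ xs) z ≈ 0# × ¬ g z ≈ 0#
    common-nonroot′ n x [] _ x≉0 {g} {y} ug gy≉0 =
      y , (λ eq → x≉0 (≈-trans (≈-sym (≈-trans (+-identityʳ _) (*-identityʳ x))) eq)) , gy≉0
    common-nonroot′ (suc n) x (x′ ∷ xs) len x≉0 {g} ug gy≉0 =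
      proj₁ z , (λ eq → *-nonzero (λ z-α≈0 → zg≉0 (≈-trans (*-congʳ z-α≈0) (zeroˡ _))) (proj₁ (proj₂ z))
                    (≈-trans (≈-sym (factor α x (x′ ∷ xs) (proj₂ α-root) (proj₁ z))) eq)) ,
      λ gz≈0 → zg≉0 (≈-trans (*-congˡ gz≈0) (zeroʳ _))
      where
      α-root = root x x′ xs x≉0
      α = proj₁ α-root
      g-list = leading ug gy≉0
      t = nonroot′ (proj₁ g-list) (proj₁ (proj₂ g-list)) (proj₁ (proj₂ (proj₂ g-list))) α
      z : ∃ λ z → ¬ ev (x ∷ quotient α (x′ + α * x) xs) z ≈ 0# × ¬ (z + - α) * g z ≈ 0#
      z = common-nonroot′ n x (quotient α (x′ + α * x) xs)
            (≡.trans (length-quotient α (x′ + α * x) xs) (ℕₚ.suc-injective len)) x≉0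
            (u-* (u-+ u-id (u-const (- α))) ug)
            (λ eq → proj₂ t (≈-trans (*-congˡ (proj₂ (proj₂ (proj₂ g-list)) (proj₁ t))) eq))
      zg≉0 = proj₂ (proj₂ z)

  common-nonroot : ∀ {f g x y} → Univariate f → Univariate g → ¬ f x ≈ 0# → ¬ g y ≈ 0# →
                   ∃ λ z → ¬ f z ≈ 0# × ¬ g z ≈ 0#
  common-nonroot uf ug fx≉0 gy≉0
    with x , xs , x≉0 , xs≈f ← leading uf fx≉0
    with z , f≉0 , g≉0 ← common-nonroot′ (length xs) x xs refl x≉0 ug gy≉0 =
    z , (λ fz≈0 → f≉0 (≈-trans (xs≈f z) fz≈0)) , g≉0

  private
    -- A nonzero value of `f` would yield a common non-root of `f` and `z + - α`; the linear factor
    -- takes the value one at `1# + α`.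
    cancel-linear : ∀ {f} α → Univariate f → (∀ z → (z + - α) * f z ≈ 0#) → ∀ z → f z ≈ 0#
    cancel-linear {f} α uf vanish z = decidable-stable (zero? (f z)) λ fz≉0 →
      let t , t-α≉0 , ft≉0 = common-nonroot {x = 1# + α} (u-+ u-id (u-const (- α))) uf 1+α-α≉0 fz≉0
      in *-nonzero t-α≉0 ft≉0 (vanish t)
      where
      1+α-α≉0 : ¬ 1# + α + - α ≈ 0#
      1+α-α≉0 eq = 1≉0 (≈-trans (≈-sym (≈-trans (+-assoc _ _ _) (≈-trans (+-congˡ (-‿inverseʳ α)) (+-identityʳ 1#)))) eq)

    factor-univariate : ∀ {f} α → Univariate f → f α ≈ 0# → ∃ λ h → Univariate h × (∀ z → f z ≈ (z + - α) * h z)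
    factor-univariate {f} α uf fα≈0 with coefficient-list uf
    ... | [] , xs≈f = (λ _ → 0#) , u-const 0# , λ z → ≈-trans (≈-sym (xs≈f z)) (≈-sym (zeroʳ _))
    ... | x ∷ xs , xs≈f = ev (quotient α x xs) , u-ev (quotient α x xs) , λ z →
          ≈-trans (≈-sym (xs≈f z)) (factor α x xs (≈-trans (xs≈f α) fα≈0) z)

  -- Each root of the polynomial x ∷ xs is split off from both sides, which lowers its degree
  -- and the exponent together; the degree of rs stays below that of x ∷ xs.
  remainder-vanishes :
    ∀ n x xs → length xs ≡ n → ¬ x ≈ 0# →
    ∀ {q A s} → Univariate q → Univariate A → Univariate s →
    (∀ z → ev (x ∷ xs) z ≈ 0# → q z ≈ 0#) →
    ∀ rs → length rs ≤ n → (∀ z → ev rs z ≈ A z * q z ^ n + s z * ev (x ∷ xs) z) → ∀ z → ev rs z ≈ 0#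
  remainder-vanishes n x xs len x≉0 uq uA us roots [] _ rs≈ z = ≈-refl
  remainder-vanishes (suc n) x (x′ ∷ xs) len x≉0 {q} {A} {s} uq uA us roots (r ∷ rs) (s≤s len-rs) rs≈ z
    with α , α-root ← root x x′ xs x≉0
    with q′ , uq′ , q≈ ← factor-univariate α uq (roots α α-root) =
    ≈-trans (factor α r rs rα≈0 z) (≈-trans (*-congˡ (remainder-vanishes n x Q
      (≡.trans (length-quotient α (x′ + α * x) xs) (ℕₚ.suc-injective len)) x≉0
      uq (u-* uA uq′) us roots′ R (ℕₚ.≤-trans (ℕₚ.≤-reflexive (length-quotient α r rs)) len-rs) R≈ z)) (zeroʳ _))
    where
    Q = quotient α (x′ + α * x) xs
    R = quotient α r rs
    p≈ : ∀ z → ev (x ∷ x′ ∷ xs) z ≈ (z + - α) * ev (x ∷ Q) z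
    p≈ = factor α x (x′ ∷ xs) α-root
    roots′ : ∀ z → ev (x ∷ Q) z ≈ 0# → q z ≈ 0#
    roots′ z eq = roots z (≈-trans (p≈ z) (≈-trans (*-congˡ eq) (zeroʳ _)))
    rα≈0 : ev (r ∷ rs) α ≈ 0#
    rα≈0 = begin
      ev (r ∷ rs) α                                          ≈⟨ rs≈ α ⟩
      A α * (q α * q α ^ n) + s α * ev (x ∷ x′ ∷ xs) α       ≈⟨ +-cong (*-congˡ (≈-trans (*-congʳ (roots α α-root)) (zeroˡ _))) (≈-trans (*-congˡ α-root) (zeroʳ _)) ⟩
      A α * 0# + 0#                                          ≈⟨ ≈-trans (+-identityʳ _) (zeroʳ _) ⟩
      0#                                                     ∎
    -- The right-hand side after cancelling `z + - α`: one factor `q` has lost its root, and its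
    -- complement `q′` is absorbed into `A`, which lowers the exponent by one.
    B : K → K
    B z = (A z * q′ z) * q z ^ n + s z * ev (x ∷ Q) z
    uB : Univariate B
    uB = u-+ (u-* (u-* uA uq′) (u-^ n uq)) (u-* us (u-ev (x ∷ Q)))
    R≈ : ∀ z → ev R z ≈ B z
    R≈ z = x-y≈0⇒x≈y (cancel-linear {λ z → ev R z + - B z} α (u-+ (u-ev R) (u-neg uB)) (λ z → begin
      (z + - α) * (ev R z + - B z)
        ≈⟨ ≈-trans (distribˡ _ _ _) (+-congˡ (≈-sym (-‿distribʳ-* _ _))) ⟩
      (z + - α) * ev R z + - ((z + - α) * B z)
        ≈⟨ +-congʳ (factor α r rs rα≈0 z) ⟨
      ev (r ∷ rs) z + - ((z + - α) * B z)
        ≈⟨ +-congˡ (-‿cong (solve 6 (λ e A q′ qn s p → e ⊗ ((A ⊗ q′) ⊗ qn ⊕ s ⊗ p) := A ⊗ ((e ⊗ q′) ⊗ qn) ⊕ s ⊗ (e ⊗ p)) ≈-refl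
             (z + - α) (A z) (q′ z) (q z ^ n) (s z) (ev (x ∷ Q) z))) ⟩
      ev (r ∷ rs) z + - (A z * (((z + - α) * q′ z) * q z ^ n) + s z * ((z + - α) * ev (x ∷ Q) z))
        ≈⟨ +-congˡ (-‿cong (+-cong (*-congˡ (*-congʳ (q≈ z))) (*-congˡ (p≈ z)))) ⟨
      ev (r ∷ rs) z + - (A z * (q z * q z ^ n) + s z * ev (x ∷ x′ ∷ xs) z)
        ≈⟨ +-congʳ (rs≈ z) ⟩
      (A z * (q z * q z ^ n) + s z * ev (x ∷ x′ ∷ xs) z) + - (A z * (q z * q z ^ n) + s z * ev (x ∷ x′ ∷ xs) z)
        ≈⟨ -‿inverseʳ _ ⟩
      0# ∎) z)

-- Constructible sets and quantifier elimination

module Definable {c ℓ} (𝔽 : CommutativeRing c ℓ) (isField : IsField 𝔽)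
                 (closed : IsAlgebraicallyClosed 𝔽) (em : ExcludedMiddle (c ⊔ ℓ)) where

  open FieldLemmas 𝔽 isField (lower-em ℓ (c ⊔ ℓ) em)
  open Univariate 𝔽 isField closed (lower-em ℓ (c ⊔ ℓ) em)
  open SemiringExp semiring using (_^_; ^-homo-*)

  _⇌_ : Set p → Set q → Set (p ⊔ q)
  A ⇌ B = (A → B) × (B → A)

  -- A decision tree testing polynomials for zero defines a constructible set.
  data Tree (X : Set a) : Set (a ⊔ c) where
    leaf : Bool → Tree X
    test : Poly X → Tree X → Tree X → Tree X

  module _ {X : Set a} where

    Holds : Tree X → Pred (X → K) ℓ
    Holds (leaf true)   w = Lift ℓ ⊤
    Holds (leaf false)  w = Lift ℓ ⊥
    Holds (test q t t′) w = (eval q w ≈ 0# × Holds t w) ⊎ (¬ eval q w ≈ 0# × Holds t′ w)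

    holds? : ∀ t w → Dec (Holds t w)
    holds? t w = lower-em ℓ (c ⊔ ℓ) em

    Holds-cong : ∀ t {v w : X → K} → (∀ i → v i ≈ w i) → Holds t v → Holds t w
    Holds-cong (leaf true)   v≈w _ = lift tt
    Holds-cong (test q t t′) v≈w (inj₁ (q≈0 , h)) =
      inj₁ (≈-trans (≈-sym (eval-cong q v≈w)) q≈0 , Holds-cong t v≈w h)
    Holds-cong (test q t t′) v≈w (inj₂ (q≉0 , h)) =
      inj₂ (q≉0 ∘ ≈-trans (eval-cong q v≈w) , Holds-cong t′ v≈w h)

    -- Agreement is demanded only on `H`, so that a tree may be built under the assumption that some
    -- leading coefficient vanishes or does not; `tame-cases` glues the two halves by a test.
    TameOn : Pred (X → K) q → Pred (X → K) p → Set (a ⊔ c ⊔ ℓ ⊔ q ⊔ p)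
    TameOn H P = ∃ λ t → ∀ w → H w → P w ⇌ Holds t w

    Tame : Pred (X → K) p → Set (a ⊔ c ⊔ ℓ ⊔ p)
    Tame P = TameOn (λ _ → ⊤) P

    tame-on : ∀ {H : Pred (X → K) q} {P : Pred (X → K) p} {p′} {Q : Pred (X → K) p′} →
              Tame P → (∀ w → H w → P w ⇌ Q w) → TameOn H Q
    tame-on (t , t⇌P) P⇌Q = t , λ w h → proj₁ (t⇌P w _) ∘ proj₂ (P⇌Q w h) , proj₁ (P⇌Q w h) ∘ proj₂ (t⇌P w _)

    tame-resp : ∀ {P : Pred (X → K) p} {Q : Pred (X → K) q} → (∀ w → P w ⇌ Q w) → Tame P → Tame Q
    tame-resp P⇌Q tP = tame-on tP λ w _ → P⇌Q w

    tame-cong : ∀ {P : Pred (X → K) p} → Tame P → ∀ {v w} → (∀ i → v i ≈ w i) → P v → P w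
    tame-cong (t , t⇌P) v≈w Pv = proj₂ (t⇌P _ _) (Holds-cong t v≈w (proj₁ (t⇌P _ _) Pv))

    tame? : ∀ {P : Pred (X → K) p} → Tame P → ∀ w → Dec (P w)
    tame? (t , t⇌P) w with holds? t w
    ... | yes h = yes (proj₂ (t⇌P w _) h)
    ... | no ¬h = no (¬h ∘ proj₁ (t⇌P w _))

    tame-cases : ∀ {H : Pred (X → K) q} {P : Pred (X → K) p} (s : Poly X) →
                 TameOn (λ w → H w × eval s w ≈ 0#) P → TameOn (λ w → H w × ¬ eval s w ≈ 0#) P → TameOn H P
    tame-cases s (t , t⇌) (t′ , t′⇌) = test s t t′ , λ w h → to w h , from w h
      where
      to : ∀ w → _ → _ → Holds (test s t t′) w
      to w h P with zero? (eval s w)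
      ... | yes z = inj₁ (z , proj₁ (t⇌ w (h , z)) P)
      ... | no nz = inj₂ (nz , proj₁ (t′⇌ w (h , nz)) P)
      from : ∀ w → _ → Holds (test s t t′) w → _
      from w h (inj₁ (z , P))  = proj₂ (t⇌ w (h , z)) P
      from w h (inj₂ (nz , P)) = proj₂ (t′⇌ w (h , nz)) P

    tame-true : ∀ {P : Pred (X → K) p} → (∀ w → P w) → Tame P
    tame-true P = leaf true , λ w _ → (λ _ → lift tt) , λ _ → P w

    tame-false : ∀ {P : Pred (X → K) p} → (∀ w → ¬ P w) → Tame P
    tame-false ¬P = leaf false , λ w _ → ⊥-elim ∘ ¬P w , λ { (lift ()) }

    tame-zero : ∀ s → Tame (λ w → eval s w ≈ 0#)
    tame-zero s = test s (leaf true) (leaf false) , λ w _ →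
      (λ z → inj₁ (z , lift tt)) , λ { (inj₁ (z , _)) → z ; (inj₂ (_ , lift ())) }

    private
      -- If-then-else on trees: `u` replaces the leaves `true` and `u′` the leaves `false`. The
      -- Boolean operations below all come from it.
      _⊛_⊛_ : Tree X → Tree X → Tree X → Tree X
      leaf true    ⊛ u ⊛ u′ = u
      leaf false   ⊛ u ⊛ u′ = u′
      test s t t′  ⊛ u ⊛ u′ = test s (t ⊛ u ⊛ u′) (t′ ⊛ u ⊛ u′)

      graft : ∀ t u u′ w → Holds (t ⊛ u ⊛ u′) w ⇌ ((Holds t w × Holds u w) ⊎ (¬ Holds t w × Holds u′ w))
      graft (leaf true)   u u′ w = (λ h → inj₁ (lift tt , h)) , λ { (inj₁ (_ , h)) → h ; (inj₂ (n , _)) → ⊥-elim (n (lift tt)) }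
      graft (leaf false)  u u′ w = (λ h → inj₂ ((λ { (lift ()) }) , h)) , λ { (inj₁ (lift () , _)) ; (inj₂ (_ , h)) → h }
      graft (test s t t′) u u′ w = to , from
        where
        to : Holds (test s t t′ ⊛ u ⊛ u′) w → _
        to (inj₁ (z , h)) with proj₁ (graft t u u′ w) h
        ... | inj₁ (ht , hu)  = inj₁ (inj₁ (z , ht) , hu)
        ... | inj₂ (¬ht , hu) = inj₂ ((λ { (inj₁ (_ , ht)) → ¬ht ht ; (inj₂ (nz , _)) → nz z }) , hu)
        to (inj₂ (nz , h)) with proj₁ (graft t′ u u′ w) h
        ... | inj₁ (ht , hu)  = inj₁ (inj₂ (nz , ht) , hu)
        ... | inj₂ (¬ht , hu) = inj₂ ((λ { (inj₁ (z , _)) → nz z ; (inj₂ (_ , ht)) → ¬ht ht }) , hu)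
        from : _ → Holds (test s t t′ ⊛ u ⊛ u′) w
        from (inj₁ (inj₁ (z , ht) , hu))  = inj₁ (z , proj₂ (graft t u u′ w) (inj₁ (ht , hu)))
        from (inj₁ (inj₂ (nz , ht) , hu)) = inj₂ (nz , proj₂ (graft t′ u u′ w) (inj₁ (ht , hu)))
        from (inj₂ (¬h , hu)) with zero? (eval s w)
        ... | yes z = inj₁ (z , proj₂ (graft t u u′ w) (inj₂ ((λ ht → ¬h (inj₁ (z , ht))) , hu)))
        ... | no nz = inj₂ (nz , proj₂ (graft t′ u u′ w) (inj₂ ((λ ht → ¬h (inj₂ (nz , ht))) , hu)))

    tame-¬ : ∀ {P : Pred (X → K) p} → Tame P → Tame (λ w → ¬ P w)
    tame-¬ (t , t⇌) = (t ⊛ leaf false ⊛ leaf true) , λ w _ →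
      (λ ¬P → proj₂ (graft t (leaf false) (leaf true) w) (inj₂ (¬P ∘ proj₂ (t⇌ w _) , lift tt))) ,
      λ h P → [ (λ { (_ , lift ()) }) , (λ (¬h , _) → ¬h (proj₁ (t⇌ w _) P)) ] (proj₁ (graft t (leaf false) (leaf true) w) h)

    tame-× : ∀ {P : Pred (X → K) p} {Q : Pred (X → K) q} → Tame P → Tame Q → Tame (λ w → P w × Q w)
    tame-× (t , t⇌) (u , u⇌) = (t ⊛ u ⊛ leaf false) , λ w _ →
      (λ (P , Q) → proj₂ (graft t u (leaf false) w) (inj₁ (proj₁ (t⇌ w _) P , proj₁ (u⇌ w _) Q))) ,
      λ h → [ (λ (ht , hu) → proj₂ (t⇌ w _) ht , proj₂ (u⇌ w _) hu) , (λ { (_ , lift ()) }) ]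
              (proj₁ (graft t u (leaf false) w) h)

    tame-⊎ : ∀ {P : Pred (X → K) p} {Q : Pred (X → K) q} → Tame P → Tame Q → Tame (λ w → P w ⊎ Q w)
    tame-⊎ {P = P} {Q = Q} tP tQ = tame-resp
      (λ w → (λ n → [ inj₁ , (λ ¬P → inj₂ (decidable-stable (tame? tQ w) λ ¬Q → n (¬P , ¬Q))) ] (split w)) ,
             λ { (inj₁ P) (¬P , _) → ¬P P ; (inj₂ Q) (_ , ¬Q) → ¬Q Q })
      (tame-¬ (tame-× (tame-¬ tP) (tame-¬ tQ)))
      where
      split : ∀ w → P w ⊎ ¬ P w
      split w with tame? tP w
      ... | yes P = inj₁ P
      ... | no ¬P = inj₂ ¬P

    tame-→ : ∀ {P : Pred (X → K) p} {Q : Pred (X → K) q} → Tame P → Tame Q → Tame (λ w → P w → Q w)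
    tame-→ tP tQ = tame-resp (λ w → (λ n P → decidable-stable (tame? tQ w) λ ¬Q → n (P , ¬Q)) , λ f (P , ¬Q) → ¬Q (f P))
      (tame-¬ (tame-× tP (tame-¬ tQ)))

    tame-const : ∀ {A : Set p} → Dec A → Tame (λ _ → A)
    tame-const (yes x) = tame-true λ _ → x
    tame-const (no ¬x) = tame-false λ _ → ¬x

    tame-∀Fin : ∀ {n} {P : Fin n → Pred (X → K) p} → (∀ i → Tame (P i)) → Tame (λ w → ∀ i → P i w)
    tame-∀Fin {n = zero}  tP = tame-true λ w ()
    tame-∀Fin {n = suc n} tP = tame-resp
      (λ w → (λ { (P₀ , P) zero → P₀ ; (P₀ , P) (suc i) → P i }) , λ P → P zero , P ∘ suc)
      (tame-× (tP zero) (tame-∀Fin (tP ∘ suc)))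

  module _ {X : Set a} {Y : Set p} where

    private
      _⟦_⟧ᵗ : Tree Y → (Y → Poly X) → Tree X
      leaf b      ⟦ σ ⟧ᵗ = leaf b
      test s t t′ ⟦ σ ⟧ᵗ = test (s ⟪ σ ⟫) (t ⟦ σ ⟧ᵗ) (t′ ⟦ σ ⟧ᵗ)

      holds-⟦⟧ : ∀ t σ w → Holds (t ⟦ σ ⟧ᵗ) w ⇌ Holds t (λ i → eval (σ i) w)
      holds-⟦⟧ (leaf true)   σ w = id , id
      holds-⟦⟧ (leaf false)  σ w = id , id
      holds-⟦⟧ (test s t t′) σ w =
        (λ { (inj₁ (z , h))  → inj₁ (≈-trans (≈-sym (eval-⟪⟫ s σ w)) z , proj₁ (holds-⟦⟧ t σ w) h)
           ; (inj₂ (nz , h)) → inj₂ (nz ∘ ≈-trans (eval-⟪⟫ s σ w) , proj₁ (holds-⟦⟧ t′ σ w) h) }) ,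
        (λ { (inj₁ (z , h))  → inj₁ (≈-trans (eval-⟪⟫ s σ w) z , proj₂ (holds-⟦⟧ t σ w) h)
           ; (inj₂ (nz , h)) → inj₂ (nz ∘ ≈-trans (≈-sym (eval-⟪⟫ s σ w)) , proj₂ (holds-⟦⟧ t′ σ w) h) })

    tame-subst : ∀ {P : Pred (Y → K) q} (f : (X → K) → Y → K) (σ : Y → Poly X) →
                 (∀ w i → eval (σ i) w ≈ f w i) → Tame P → Tame (P ∘ f)
    tame-subst f σ σ≈f (t , t⇌) = t ⟦ σ ⟧ᵗ , λ w _ →
      (λ P → proj₂ (holds-⟦⟧ t σ w) (Holds-cong t (λ i → ≈-sym (σ≈f w i)) (proj₁ (t⇌ (f w) _) P))) ,
      (λ h → proj₂ (t⇌ (f w) _) (Holds-cong t (σ≈f w) (proj₁ (holds-⟦⟧ t σ w) h)))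

  -- Pseudo-division reduces a system of equations in one variable to a single equation x = 0 of degree d;
  -- then x = 0, q ≠ 0 is solvable iff x does not divide q ^ d.
  module _ {X : Set a} where

    private
      -- The lists start at the leading coefficient, so the entrywise difference is `y` times
      -- `x ∷ qs` minus `x` times a shifted `y ∷ rs`, with the cancelling leading terms left out.
      reduce : Poly X → Poly X → List (Poly X) → List (Poly X) → List (Poly X)
      reduce x y []       ys       = []
      reduce x y (q ∷ qs) []       = (y :* q) ∷ reduce x y qs []
      reduce x y (q ∷ qs) (r ∷ rs) = ((y :* q) :+ (con (- 1#) :* (x :* r))) ∷ reduce x y qs rs

      length-reduce : ∀ x y qs rs → length (reduce x y qs rs) ≡ length qs
      length-reduce x y []       rs       = refl
      length-reduce x y (q ∷ qs) []       = cong suc (length-reduce x y qs [])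
      length-reduce x y (q ∷ qs) (r ∷ rs) = cong suc (length-reduce x y qs rs)

      ^-split : ∀ z {m n} → m ≤ n → z ^ n ≈ z ^ (n ∸ m) * z ^ m
      ^-split z {m} {n} m≤n = ≈-trans (≈-reflexive (cong (z ^_) (≡.sym (ℕₚ.m∸n+n≡m m≤n)))) (^-homo-* z (n ∸ m) m)

      high-reduce : ∀ x y qs rs w z → length rs ≤ length qs →
                    high (reduce x y qs rs) w z ≈
                    eval y w * high qs w z + - 1# * (eval x w * (z ^ (length qs ∸ length rs) * high rs w z))
      high-reduce x y [] [] w z _ = ≈-sym (≈-trans (+-cong (zeroʳ _) (≈-trans (*-congˡ (≈-trans (*-congˡ (zeroʳ _)) (zeroʳ _))) (zeroʳ _))) (+-identityˡ 0#))
      high-reduce x y (q ∷ qs) [] w z _ = begin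
        eval y w * eval q w * z ^ length (reduce x y qs []) + high (reduce x y qs []) w z
          ≈⟨ +-cong (*-congˡ (≈-reflexive (cong (z ^_) (length-reduce x y qs [])))) (high-reduce x y qs [] w z z≤n) ⟩
        eval y w * eval q w * z ^ length qs + (eval y w * high qs w z + - 1# * (eval x w * (z ^ length qs * 0#)))
          ≈⟨ ≈-sym (+-assoc _ _ _) ⟩
        (eval y w * eval q w * z ^ length qs + eval y w * high qs w z) + - 1# * (eval x w * (z ^ length qs * 0#))
          ≈⟨ +-cong (≈-trans (+-congʳ (*-assoc _ _ _)) (≈-sym (distribˡ _ _ _)))
                    (*-congˡ (*-congˡ (≈-trans (zeroʳ _) (≈-sym (zeroʳ _))))) ⟩
        eval y w * (eval q w * z ^ length qs + high qs w z) + - 1# * (eval x w * (z ^ suc (length qs) * 0#)) ∎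
      high-reduce x y (q ∷ qs) (r ∷ rs) w z (s≤s le) = begin
        (y′ * q′ + n * (x′ * r′)) * z ^ length (reduce x y qs rs) + high (reduce x y qs rs) w z
          ≈⟨ +-cong (*-congˡ (≈-reflexive (cong (z ^_) (length-reduce x y qs rs)))) (high-reduce x y qs rs w z le) ⟩
        (y′ * q′ + n * (x′ * r′)) * zn + (y′ * Q + n * (x′ * (ze * R)))
          ≈⟨ +-congʳ (≈-trans (distribʳ _ _ _) (+-congˡ (*-congˡ (^-split z le)))) ⟩
        (y′ * q′ * zn + n * (x′ * r′) * (ze * zm)) + (y′ * Q + n * (x′ * (ze * R)))
          ≈⟨ +-cong (+-cong (*-assoc _ _ _) (≈-trans (*-assoc _ _ _) (*-congˡ (≈-trans (*-assoc _ _ _)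
               (*-congˡ (solve 3 (λ r e m → r ⊗ (e ⊗ m) := e ⊗ (r ⊗ m)) ≈-refl r′ ze zm)))))) ≈-refl ⟩
        (y′ * (q′ * zn) + n * (x′ * (ze * (r′ * zm)))) + (y′ * Q + n * (x′ * (ze * R)))
          ≈⟨ solve 4 (λ a b c d → (a ⊕ b) ⊕ (c ⊕ d) := (a ⊕ c) ⊕ (b ⊕ d)) ≈-refl _ _ _ _ ⟩
        (y′ * (q′ * zn) + y′ * Q) + (n * (x′ * (ze * (r′ * zm))) + n * (x′ * (ze * R)))
          ≈⟨ +-cong (distribˡ _ _ _) (≈-trans (*-congˡ (≈-trans (*-congˡ (distribˡ _ _ _)) (distribˡ _ _ _))) (distribˡ _ _ _)) ⟨
        y′ * (q′ * zn + Q) + n * (x′ * (ze * (r′ * zm + R))) ∎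
        where
        n = - 1#
        x′ = eval x w
        y′ = eval y w
        q′ = eval q w
        r′ = eval r w
        zn = z ^ length qs
        zm = z ^ length rs
        ze = z ^ (length qs ∸ length rs)
        Q = high qs w z
        R = high rs w z

      reduce-leading : ∀ x y qs rs w z → length rs ≤ length qs →
        high (reduce x y qs rs) w z ≈
        eval y w * high (x ∷ qs) w z + (- 1# * (eval x w * z ^ (length qs ∸ length rs))) * high (y ∷ rs) w z
      reduce-leading x y qs rs w z le = begin
        high (reduce x y qs rs) w z
          ≈⟨ high-reduce x y qs rs w z le ⟩
        y′ * Q + n * (x′ * (ze * R))
          ≈⟨ +-identityˡ _ ⟨
        0# + (y′ * Q + n * (x′ * (ze * R)))
          ≈⟨ +-congʳ (≈-trans (*-congʳ (-‿inverseʳ 1#)) (zeroˡ _)) ⟨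
        (1# + n) * (y′ * (x′ * (ze * zm))) + (y′ * Q + n * (x′ * (ze * R)))
          ≈⟨ +-congʳ (≈-trans (distribʳ _ _ _) (+-congʳ (*-identityˡ _))) ⟩
        (y′ * (x′ * (ze * zm)) + n * (y′ * (x′ * (ze * zm)))) + (y′ * Q + n * (x′ * (ze * R)))
          ≈⟨ solve 4 (λ a b c d → (a ⊕ b) ⊕ (c ⊕ d) := (a ⊕ c) ⊕ (b ⊕ d)) ≈-refl _ _ _ _ ⟩
        (y′ * (x′ * (ze * zm)) + y′ * Q) + (n * (y′ * (x′ * (ze * zm))) + n * (x′ * (ze * R)))
          ≈⟨ +-cong (≈-trans (≈-sym (distribˡ _ _ _)) (*-congˡ (+-congʳ (*-congˡ (≈-sym (^-split z le))))))
                    (≈-trans (≈-sym (distribˡ _ _ _)) (≈-trans (*-congˡ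
                      (solve 5 (λ y x e m R → y ⊗ (x ⊗ (e ⊗ m)) ⊕ x ⊗ (e ⊗ R) := (x ⊗ e) ⊗ (y ⊗ m ⊕ R)) ≈-refl y′ x′ ze zm R))
                      (≈-sym (*-assoc _ _ _)))) ⟩
        y′ * (x′ * z ^ length qs + Q) + (n * (x′ * ze)) * (y′ * zm + R) ∎
        where
        n = - 1#
        x′ = eval x w
        y′ = eval y w
        zm = z ^ length rs
        ze = z ^ (length qs ∸ length rs)
        Q = high qs w z
        R = high rs w z

      -- Division without inverting the leading coefficient `x`, whose powers collect in
      -- `multiplier`. The coefficients of `rem` will be tested for zero and so are polynomials in
      -- the parameters, whereas `cofactor` is only asked to be polynomial in `z` for each fixed
      -- `w`.
      record Remainder (x : Poly X) (xs qs : List (Poly X)) : Set (a ⊔ c ⊔ ℓ) where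
        field
          rem      : List (Poly X)
          small    : length rem ≤ length xs
          multiplier : Poly X
          nonzero  : ∀ w → ¬ eval x w ≈ 0# → ¬ eval multiplier w ≈ 0#
          cofactor : (X → K) → K → K
          univariate : ∀ w → Univariate (cofactor w)
          identity : ∀ w z → high rem w z ≈ eval multiplier w * high qs w z + cofactor w z * high (x ∷ xs) w z

      pseudo-divide : ∀ x xs n qs → length qs ≡ n → Remainder x xs qs
      pseudo-divide x xs n qs len with length qs ℕₚ.≤? length xs
      ... | yes small = record
        { rem = qs ; small = small ; multiplier = con 1# ; nonzero = λ _ _ → 1≉0
        ; cofactor = λ _ _ → 0# ; univariate = λ _ → u-const 0#
        ; identity = λ w z → ≈-sym (≈-trans (+-cong (*-identityˡ _) (zeroˡ _)) (+-identityʳ _)) }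
      pseudo-divide x xs n [] len | no big = ⊥-elim (big z≤n)
      pseudo-divide x xs (suc n) (q ∷ qs) len | no big = record
        { rem = rem ; small = small ; multiplier = multiplier :* x
        ; nonzero = λ w x≉0 → *-nonzero (nonzero w x≉0) x≉0
        ; cofactor = λ w z → eval multiplier w * s w z + cofactor w z
        ; univariate = λ w → u-+ (u-* (u-const (eval multiplier w)) (us w)) (univariate w)
        ; identity = λ w z → ≈-trans (identity w z) (≈-trans (+-congʳ (*-congˡ (reduce-leading q x qs xs w z le)))
            (solve 6 (λ A x Q s p t → A ⊗ (x ⊗ Q ⊕ s ⊗ p) ⊕ t ⊗ p := (A ⊗ x) ⊗ Q ⊕ (A ⊗ s ⊕ t) ⊗ p) ≈-refl
              (eval multiplier w) (eval x w) (high (q ∷ qs) w z) (s w z) (high (x ∷ xs) w z) (cofactor w z))) }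
        where
        le : length xs ≤ length qs
        le = ℕₚ.≤-pred (ℕₚ.≰⇒> big)
        open Remainder (pseudo-divide x xs n (reduce q x qs xs) (≡.trans (length-reduce q x qs xs) (ℕₚ.suc-injective len)))
        s : (X → K) → K → K
        s w z = - 1# * (eval q w * z ^ (length qs ∸ length xs))
        us : ∀ w → Univariate (s w)
        us w = u-* (u-const (- 1#)) (u-* (u-const (eval q w)) (u-^ {λ z → z} (length qs ∸ length xs) u-id))

      -- By `nonroot` such a `z` exists as soon as one coefficient is nonzero, and coefficients can
      -- be tested one after another.
      tame-nonroot : ∀ (qs : List (Poly X)) → Tame (λ w → ∃ λ z → ¬ high qs w z ≈ 0#)
      tame-nonroot [] = tame-false λ w (_ , n) → n ≈-refl
      tame-nonroot (q ∷ qs) = tame-cases q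
        (tame-on (tame-nonroot qs) λ w (_ , q≈0) →
          let drop = λ z → ≈-trans (+-congʳ (≈-trans (*-congʳ q≈0) (zeroˡ (z ^ length qs)))) (+-identityˡ (high qs w z))
          in (λ (z , n) → z , n ∘ ≈-trans (≈-sym (drop z))) , λ (z , n) → z , n ∘ ≈-trans (drop z))
        (tame-on {P = λ _ → ⊤} (tame-true _) λ w (_ , q≉0) →
          (λ _ → let z , n = nonroot (eval q w) (at w qs) q≉0 in z , n ∘ ≈-trans (ev-at w (q ∷ qs) z)) , _)

      Roots : List (List (Poly X)) → (X → K) → K → Set ℓ
      Roots []         w z = Lift ℓ ⊤
      Roots (qs ∷ qss) w z = high qs w z ≈ 0# × Roots qss w z

      Solvable : List (List (Poly X)) → Poly (Maybe X) → Pred (X → K) (c ⊔ ℓ)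
      Solvable qss s w = ∃ λ z → Roots qss w z × ¬ eval s (w ▸ z) ≈ 0#

      power : Poly (Maybe X) → ℕ → Poly (Maybe X)
      power s zero    = con 1#
      power s (suc n) = s :* power s n

      eval-power : ∀ s n (w : Maybe X → K) → eval (power s n) w ≈ eval s w ^ n
      eval-power s zero    w = ≈-refl
      eval-power s (suc n) w = *-congˡ (eval-power s n w)

      ^-nonzero : ∀ {x} n → ¬ x ≈ 0# → ¬ x ^ n ≈ 0#
      ^-nonzero zero    x≉0 = 1≉0
      ^-nonzero (suc n) x≉0 = *-nonzero x≉0 (^-nonzero n x≉0)

      u-eval : ∀ (s : Poly (Maybe X)) (w : X → K) → Univariate (λ z → eval s (w ▸ z))
      u-eval (con r)        w = u-const r
      u-eval (var (just i)) w = u-const (w i)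
      u-eval (var nothing)  w = u-id
      u-eval (s :+ t)       w = u-+ (u-eval s w) (u-eval t w)
      u-eval (s :* t)       w = u-* (u-eval s w) (u-eval t w)

      -- The degree `d` of `x ∷ xs` bounds the multiplicities of its roots: if `s` vanishes at all
      -- of them, then `s` to the power `d` leaves remainder zero. Conversely, at a root where `s`
      -- is nonzero the remainder is nonzero too.
      one-equation : ∀ {H : Pred (X → K) q} (x : Poly X) xs s → TameOn (λ w → H w × ¬ eval x w ≈ 0#) (Solvable ((x ∷ xs) ∷ []) s)
      one-equation x xs s = tame-on (tame-nonroot rem) λ w (_ , x≉0) → from w x≉0 , to w x≉0
        where
        d = length xs
        open Remainder (pseudo-divide x xs _ (coefficients (power s d)) refl)
        rem≈ : ∀ w z → high rem w z ≈ eval multiplier w * eval s (w ▸ z) ^ d + cofactor w z * high (x ∷ xs) w z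
        rem≈ w z = ≈-trans (identity w z) (+-congʳ (*-congˡ
          (≈-trans (high-coefficients (power s d) w z) (eval-power s d (w ▸ z)))))
        to : ∀ w → ¬ eval x w ≈ 0# → Solvable ((x ∷ xs) ∷ []) s w → ∃ λ z → ¬ high rem w z ≈ 0#
        to w x≉0 (z , (p≈0 , _) , s≉0) = z , λ rem≈0 →
          *-nonzero (nonzero w x≉0) (^-nonzero d s≉0) (begin
            eval multiplier w * eval s (w ▸ z) ^ d
              ≈⟨ ≈-trans (+-congˡ (≈-trans (*-congˡ p≈0) (zeroʳ _))) (+-identityʳ _) ⟨
            eval multiplier w * eval s (w ▸ z) ^ d + cofactor w z * high (x ∷ xs) w z
              ≈⟨ rem≈ w z ⟨
            high rem w z
              ≈⟨ rem≈0 ⟩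
            0# ∎)
        from : ∀ w → ¬ eval x w ≈ 0# → (∃ λ z → ¬ high rem w z ≈ 0#) → Solvable ((x ∷ xs) ∷ []) s w
        from w x≉0 (z , rem≉0) = decidable-stable em λ unsolvable → rem≉0 (≈-trans (≈-sym (ev-at w rem z))
          (remainder-vanishes d (eval x w) (at w xs) (length-at w xs) x≉0 {λ z → eval s (w ▸ z)} {λ _ → eval multiplier w}
            (u-eval s w) (u-const (eval multiplier w)) (univariate w)
            (λ z p≈0 → decidable-stable (zero? _) λ s≉0 →
              unsolvable (z , (≈-trans (≈-sym (ev-at w (x ∷ xs) z)) p≈0 , lift tt) , s≉0))
            (at w rem) (ℕₚ.≤-trans (ℕₚ.≤-reflexive (length-at w rem)) small)
            (λ z → ≈-trans (ev-at w rem z) (≈-trans (rem≈ w z) (+-congˡ (*-congˡ (≈-sym (ev-at w (x ∷ xs) z)))))) z))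

      -- The extra one for each equation makes the removal of an empty list count as progress.
      size : List (List (Poly X)) → ℕ
      size []         = 0
      size (qs ∷ qss) = suc (length qs ℕ.+ size qss)

      drop-leading : ∀ x (xs : List (Poly X)) {w} → eval x w ≈ 0# → ∀ z → high (x ∷ xs) w z ≈ high xs w z
      drop-leading x xs x≈0 z = ≈-trans (+-congʳ (≈-trans (*-congʳ x≈0) (zeroˡ _))) (+-identityˡ _)

      combine-≈0 : ∀ {x y s t : K} → x ≈ 0# → y ≈ 0# → s * x + t * y ≈ 0#
      combine-≈0 x≈0 y≈0 = ≈-trans (+-cong (≈-trans (*-congˡ x≈0) (zeroʳ _)) (≈-trans (*-congˡ y≈0) (zeroʳ _))) (+-identityˡ 0#)

      uncombine-≈0 : ∀ {x y s t : K} → ¬ s ≈ 0# → y ≈ 0# → s * x + t * y ≈ 0# → x ≈ 0#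
      uncombine-≈0 s≉0 y≈0 eq = cancel-zero s≉0 (≈-trans (≈-sym (≈-trans (+-congˡ (≈-trans (*-congˡ y≈0) (zeroʳ _))) (+-identityʳ _))) eq)

      by-Roots : ∀ rss qss s {H : Pred (X → K) q} → Tame (Solvable rss s) →
                 (∀ w z → H w → Roots rss w z ⇌ Roots qss w z) → TameOn H (Solvable qss s)
      by-Roots rss qss s t ⇌ = tame-on t λ w h →
        (λ (z , r , n) → z , proj₁ (⇌ w z h) r , n) , λ (z , r , n) → z , proj₂ (⇌ w z h) r , n

      -- Euclid's algorithm with parameters: once tests have made the leading coefficients nonzero,
      -- the longer of the first two equations is reduced by the other, until a single equation is
      -- left.
      solvable : ∀ fuel qss s → size qss ≤ fuel → Tame (Solvable qss s)
      solvable fuel [] s _ = tame-resp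
        (λ w → (λ (z , n) → z , lift tt , n ∘ ≈-trans (high-coefficients s w z)) ,
               λ (z , _ , n) → z , n ∘ ≈-trans (≈-sym (high-coefficients s w z)))
        (tame-nonroot (coefficients s))
      solvable (suc fuel) ([] ∷ qss) s (s≤s le) =
        by-Roots qss ([] ∷ qss) s (solvable fuel qss s le) λ w z _ → (λ r → ≈-refl , r) , proj₂
      solvable (suc fuel) ((x ∷ xs) ∷ []) s (s≤s le) = tame-cases x
        (by-Roots (xs ∷ []) ((x ∷ xs) ∷ []) s (solvable fuel (xs ∷ []) s le) λ w z (_ , x≈0) →
          (λ (r , u) → ≈-trans (drop-leading x xs x≈0 z) r , u) ,
          λ (r , u) → ≈-trans (≈-sym (drop-leading x xs x≈0 z)) r , u)
        (one-equation x xs s)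
      solvable (suc fuel) ((x ∷ xs) ∷ [] ∷ qss) s (s≤s le) =
        by-Roots ((x ∷ xs) ∷ qss) ((x ∷ xs) ∷ [] ∷ qss) s (solvable fuel ((x ∷ xs) ∷ qss) s (subst (_≤ fuel) (ℕₚ.+-suc (suc (length xs)) (size qss)) le))
          λ w z _ → (λ (r , rs) → r , ≈-refl , rs) , λ (r , _ , rs) → r , rs
      solvable (suc fuel) ((x ∷ xs) ∷ (y ∷ ys) ∷ qss) s (s≤s le) = tame-cases x
        (by-Roots (xs ∷ (y ∷ ys) ∷ qss) ((x ∷ xs) ∷ (y ∷ ys) ∷ qss) s (solvable fuel (xs ∷ (y ∷ ys) ∷ qss) s le) λ w z (_ , x≈0) →
          (λ (r , rs) → ≈-trans (drop-leading x xs x≈0 z) r , rs) ,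
          λ (r , rs) → ≈-trans (≈-sym (drop-leading x xs x≈0 z)) r , rs)
        (tame-cases y
          (by-Roots ((x ∷ xs) ∷ ys ∷ qss) ((x ∷ xs) ∷ (y ∷ ys) ∷ qss) s (solvable fuel ((x ∷ xs) ∷ ys ∷ qss) s
              (subst (_≤ fuel) (ℕₚ.+-suc (suc (length xs)) (suc (length ys ℕ.+ size qss))) le)) λ w z (_ , y≈0) →
            (λ (r , r′ , rs) → r , ≈-trans (drop-leading y ys y≈0 z) r′ , rs) ,
            λ (r , r′ , rs) → r , ≈-trans (≈-sym (drop-leading y ys y≈0 z)) r′ , rs)
          reduced)
        where
        reduced : TameOn (λ w → ((⊤ × ¬ eval x w ≈ 0#) × ¬ eval y w ≈ 0#)) (Solvable ((x ∷ xs) ∷ (y ∷ ys) ∷ qss) s)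
        reduced with ℕₚ.≤-total (length ys) (length xs)
        -- Where the leading coefficient `y` is nonzero, the old first equation follows from the
        -- reduced one and the second, so the system keeps its solutions.
        ... | inj₁ ys≤xs = by-Roots (reduce x y xs ys ∷ (y ∷ ys) ∷ qss) ((x ∷ xs) ∷ (y ∷ ys) ∷ qss) s (solvable fuel (reduce x y xs ys ∷ (y ∷ ys) ∷ qss) s
                (subst (λ n → suc (n ℕ.+ size ((y ∷ ys) ∷ qss)) ≤ fuel) (≡.sym (length-reduce x y xs ys)) le))
                λ w z (_ , y≉0) →
                  (λ (r , r′ , rs) → uncombine-≈0 y≉0 r′ (≈-trans (≈-sym (reduce-leading x y xs ys w z ys≤xs)) r) , r′ , rs) ,
                  λ (r , r′ , rs) → ≈-trans (reduce-leading x y xs ys w z ys≤xs) (combine-≈0 r r′) , r′ , rs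
        ... | inj₂ xs≤ys = by-Roots ((x ∷ xs) ∷ reduce y x ys xs ∷ qss) ((x ∷ xs) ∷ (y ∷ ys) ∷ qss) s (solvable fuel ((x ∷ xs) ∷ reduce y x ys xs ∷ qss) s
                (subst (λ n → suc (suc (length xs) ℕ.+ suc (n ℕ.+ size qss)) ≤ fuel) (≡.sym (length-reduce y x ys xs))
                  (subst (_≤ fuel) (ℕₚ.+-suc (suc (length xs)) (suc (length ys ℕ.+ size qss))) le)))
                λ w z ((_ , x≉0) , _) →
                  (λ (r , r′ , rs) → r , uncombine-≈0 x≉0 r (≈-trans (≈-sym (reduce-leading y x ys xs w z xs≤ys)) r′) , rs) ,
                  λ (r , r′ , rs) → r , ≈-trans (reduce-leading y x ys xs w z xs≤ys) (combine-≈0 r′ r) , rs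

      -- Along a branch of the tree the equations are collected in `qss`, while the inequations are
      -- multiplied into the single polynomial `s`; each leaf `true` then poses one system for
      -- `solvable`.
      tree-∃ : ∀ t qss s → Tame (λ w → ∃ λ z → (Roots qss w z × ¬ eval s (w ▸ z) ≈ 0#) × Holds t (w ▸ z))
      tree-∃ (leaf true) qss s = tame-resp (λ w → (λ (z , r) → z , r , lift tt) , λ (z , r , _) → z , r)
        (solvable (size qss) qss s ℕₚ.≤-refl)
      tree-∃ (leaf false) qss s = tame-false λ { w (_ , _ , lift ()) }
      tree-∃ (test q t t′) qss s = tame-resp
        (λ w → (λ { (inj₁ (z , ((q≈0 , r) , n) , h)) → z , (r , n) , inj₁ (≈-trans (≈-sym (high-coefficients q w z)) q≈0 , h)
                  ; (inj₂ (z , (r , n) , h)) → z , (r , λ s≈0 → n (≈-trans (*-congʳ s≈0) (zeroˡ _))) ,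
                      inj₂ ((λ q≈0 → n (≈-trans (*-congˡ q≈0) (zeroʳ _))) , h) }) ,
               (λ { (z , (r , n) , inj₁ (q≈0 , h)) → inj₁ (z , ((≈-trans (high-coefficients q w z) q≈0 , r) , n) , h)
                  ; (z , (r , n) , inj₂ (q≉0 , h)) → inj₂ (z , (r , *-nonzero n q≉0) , h) }))
        (tame-⊎ (tree-∃ t (coefficients q ∷ qss) s) (tree-∃ t′ qss (s :* q)))

    tame-∃₁ : ∀ {P : Pred (Maybe X → K) p} → Tame P → Tame (λ w → ∃ λ z → P (w ▸ z))
    tame-∃₁ (t , t⇌) = tame-resp
      (λ w → (λ (z , _ , h) → z , proj₂ (t⇌ _ _) h) , λ (z , P) → z , (lift tt , 1≉0) , proj₁ (t⇌ _ _) P)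
      (tree-∃ t [] (con 1#))

-- Quantifiers over finitely many scalars, irreducibility and generic truth values

module Genericity {a c ℓ} (𝔽 : CommutativeRing c ℓ) (isField : IsField 𝔽)
                  (closed : IsAlgebraicallyClosed 𝔽) (em : ExcludedMiddle (a ⊔ c ⊔ ℓ)) where

  open FieldLemmas 𝔽 isField (lower-em ℓ (a ⊔ c ⊔ ℓ) em)
  open Univariate 𝔽 isField closed (lower-em ℓ (a ⊔ c ⊔ ℓ) em)
  open Definable 𝔽 isField closed (lower-em (c ⊔ ℓ) (a ⊔ c ⊔ ℓ) em)

  module _ {X : Set a} where

    private
      -- Quantifiers are removed one at a time. Assignments that agree pointwise need not be equal
      -- as functions, so each regrouping of variables goes through `tame-cong`.
      tame-∃Fin : ∀ N {P : (X → K) → (Fin N → K) → Set p} →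
                  Tame {X = X ⊎ Fin N} (λ v → P (v ∘ inj₁) (v ∘ inj₂)) → Tame (λ w → ∃ (P w))
      tame-∃Fin zero {P} tP = tame-resp {P = λ w → P w (λ ())} {Q = λ w → ∃ (P w)}
        (λ w → (λ h → (λ ()) , h) ,
               λ (z , h) → tame-cong tP {[ w , z ]} {[ w , (λ ()) ]} (λ { (inj₁ x) → ≈-refl ; (inj₂ ()) }) h)
        (tame-subst (λ w → [ w , (λ ()) ]) (λ { (inj₁ x) → var x ; (inj₂ ()) }) (λ { w (inj₁ x) → ≈-refl ; w (inj₂ ()) }) tP)
      tame-∃Fin (suc N) {P} tP = tame-resp {Q = λ w → ∃ (P w)}
        (λ w → (λ (z , z₀ , h) → z₀ F.∷ z , h) ,
               λ (z , h) → z ∘ suc , z zero , tame-cong tP {[ w , z ]} {[ w , z zero F.∷ (z ∘ suc) ]}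
                 (λ { (inj₁ x) → ≈-refl ; (inj₂ zero) → ≈-refl ; (inj₂ (suc i)) → ≈-refl }) h)
        (tame-∃Fin N {λ w z → ∃ λ z₀ → P w (z₀ F.∷ z)} (tame-∃₁
          (tame-subst (λ v → [ v ∘ just ∘ inj₁ , v nothing F.∷ (v ∘ just ∘ inj₂) ])
            (λ { (inj₁ x) → var (just (inj₁ x)) ; (inj₂ zero) → var nothing ; (inj₂ (suc i)) → var (just (inj₂ i)) })
            (λ { w (inj₁ x) → ≈-refl ; w (inj₂ zero) → ≈-refl ; w (inj₂ (suc i)) → ≈-refl }) tP)))

    tame-∃ : ∀ {N} {Y : Set q} → Y ↔ Fin N → {P : (X → K) → (Y → K) → Set p} →
             Tame {X = X ⊎ Y} (λ v → P (v ∘ inj₁) (v ∘ inj₂)) → Tame (λ w → ∃ (P w))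
    tame-∃ {N = N} finite {P} tP = tame-resp {P = λ w → ∃ λ z → P w (z ∘ to)} {Q = λ w → ∃ (P w)}
      (λ w → (λ (z , h) → z ∘ to , h) ,
             λ (z , h) → z ∘ from , tame-cong tP {[ w , z ]} {[ w , z ∘ from ∘ to ]}
               (λ { (inj₁ x) → ≈-refl ; (inj₂ y) → ≈-reflexive (cong z (≡.sym (strictlyInverseʳ y))) }) h)
      (tame-∃Fin N (tame-subst (λ v → [ v ∘ inj₁ , v ∘ inj₂ ∘ to ])
        (λ { (inj₁ x) → var (inj₁ x) ; (inj₂ y) → var (inj₂ (to y)) })
        (λ { w (inj₁ x) → ≈-refl ; w (inj₂ y) → ≈-refl }) tP))
      where open Inverse finite

    tame-∀ : ∀ {N} {Y : Set q} → Y ↔ Fin N → {P : (X → K) → (Y → K) → Set p} →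
             Tame {X = X ⊎ Y} (λ v → P (v ∘ inj₁) (v ∘ inj₂)) → Tame (λ w → ∀ z → P w z)
    tame-∀ finite tP = tame-resp
      (λ w → (λ none z → decidable-stable (tame? tP [ w , z ]) λ ¬P → none (z , ¬P)) , λ all (z , ¬P) → ¬P (all z))
      (tame-¬ (tame-∃ finite (tame-¬ tP)))

    -- On the line through `x` and `y` both polynomials become univariate and neither vanishes
    -- identically, so they have a common non-root there.
    irreducible : ∀ (q r : Poly X) {x y} → ¬ eval q x ≈ 0# → ¬ eval r y ≈ 0# →
                  ∃ λ z → ¬ eval q z ≈ 0# × ¬ eval r z ≈ 0#
    irreducible q r {x} {y} qx≉0 ry≉0 = line (proj₁ t) , proj₂ t
      where
      line : K → X → K
      line t i = x i + t * (y i + - x i)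
      σ : X → Poly (Maybe ⊥)
      σ i = con (x i) :+ (var nothing :* con (y i + - x i))
      on-line : ∀ q → Univariate (λ t → eval q (line t))
      on-line q = q ⟪ σ ⟫ , λ t → eval-⟪⟫ q σ (⊥-elim ▸ t)
      at-0 : ∀ i → line 0# i ≈ x i
      at-0 i = ≈-trans (+-congˡ (zeroˡ _)) (+-identityʳ _)
      at-1 : ∀ i → line 1# i ≈ y i
      at-1 i = begin
        x i + 1# * (y i + - x i)  ≈⟨ +-congˡ (≈-trans (*-identityˡ _) (+-comm _ _)) ⟩
        x i + (- x i + y i)       ≈⟨ +-assoc _ _ _ ⟨
        x i + - x i + y i         ≈⟨ +-congʳ (-‿inverseʳ _) ⟩
        0# + y i                  ≈⟨ +-identityˡ _ ⟩
        y i                       ∎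
      t = common-nonroot {x = 0#} {y = 1#} (on-line q) (on-line r)
        (λ eq → qx≉0 (≈-trans (≈-sym (eval-cong q at-0)) eq))
        (λ eq → ry≉0 (≈-trans (≈-sym (eval-cong r at-1)) eq))

    -- A nonempty principal open set lies inside `P`, while `P` itself may fail to be open.
    Generic : Pred (X → K) p → Set (a ⊔ c ⊔ ℓ ⊔ p)
    Generic P = ∃ λ (q : Poly X) → (∃ λ x → ¬ eval q x ≈ 0#) × (∀ x → ¬ eval q x ≈ 0# → P x)

    generic-nonempty : ∀ {P : Pred (X → K) p} → Generic P → ∃ P
    generic-nonempty (q , (x , qx≉0) , P) = x , P x qx≉0

    generic-map : ∀ {P : Pred (X → K) p} {Q : Pred (X → K) q} → (∀ w → P w → Q w) → Generic P → Generic Q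
    generic-map P⇒Q (q , nz , P) = q , nz , λ x → P⇒Q x ∘ P x

    generic-true : ∀ {P : Pred (X → K) p} → (∀ w → P w) → Generic P
    generic-true P = con 1# , ((λ _ → 0#) , 1≉0) , λ x _ → P x

    generic-× : ∀ {P : Pred (X → K) p} {Q : Pred (X → K) q} → Generic P → Generic Q → Generic (λ w → P w × Q w)
    generic-× (q , (x , qx≉0) , P) (r , (y , ry≉0) , Q) with z , qz≉0 , rz≉0 ← irreducible q r qx≉0 ry≉0 =
      q :* r , (z , *-nonzero qz≉0 rz≉0) , λ w qr≉0 →
        P w (λ q≈0 → qr≉0 (≈-trans (*-congʳ q≈0) (zeroˡ _))) , Q w (λ r≈0 → qr≉0 (≈-trans (*-congˡ r≈0) (zeroʳ _)))

    generic-∀Fin : ∀ {n} {P : Fin n → Pred (X → K) p} → (∀ i → Generic (P i)) → Generic (λ w → ∀ i → P i w)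
    generic-∀Fin {n = zero}  gP = generic-true λ w ()
    generic-∀Fin {n = suc n} gP = generic-map (λ { w (P₀ , P) zero → P₀ ; w (P₀ , P) (suc i) → P i })
      (generic-× (gP zero) (generic-∀Fin (gP ∘ suc)))

    generic-∀Vec : ∀ {n d} {P : Vec (Fin n) d → Pred (X → K) p} → (∀ v → Generic (P v)) → Generic (λ w → ∀ v → P v w)
    generic-∀Vec {d = zero}  gP = generic-map (λ { w P [] → P }) (gP [])
    generic-∀Vec {d = suc d} gP = generic-map (λ { w P (i ∷ v) → P i v })
      (generic-∀Fin λ i → generic-∀Vec λ v → gP (i ∷ v))

    generic-∀≤ : ∀ B {P : ℕ → Pred (X → K) p} → (∀ n → Generic (P n)) → Generic (λ w → ∀ n → n ≤ B → P n w)
    generic-∀≤ B {P} gP = generic-map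
      (λ w h n n≤B → subst (λ n → P n w) (Finₚ.toℕ-fromℕ< (s≤s n≤B)) (h (fromℕ< (s≤s n≤B))))
      (generic-∀Fin {n = suc B} (gP ∘ toℕ))

    -- The finitely many maps are enumerated by vectors, which reproduce a map only up to pointwise
    -- equality; hence the condition that `P` respects it.
    generic-∀→ : ∀ {I : Set q} {N} → I ↔ Fin N → ∀ {d} {P : (Fin d → I) → Pred (X → K) p} →
                 (∀ {T T′} w → (∀ j → T j ≡ T′ j) → P T w → P T′ w) → (∀ T → Generic (P T)) → Generic (λ w → ∀ T → P T w)
    generic-∀→ finite {P = P} resp gP = generic-map
      (λ w h T → resp w (λ j → ≡.trans (cong from (lookup∘tabulate (to ∘ T) j)) (strictlyInverseʳ (T j))) (h (tabulate (to ∘ T))))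
      (generic-∀Vec λ v → gP (from ∘ lookup v))
      where open Inverse finite

    -- The tree is followed along its generic branch: a test polynomial with a nonzero value is
    -- nonzero on an open set, and one that vanishes identically always selects the first subtree.
    tame-dichotomy : ∀ {P : Pred (X → K) p} → Tame P → Generic P ⊎ Generic (λ w → ¬ P w)
    tame-dichotomy (t , t⇌) = [ (λ g → inj₁ (generic-map (λ w → proj₂ (t⇌ w _)) g)) ,
                                (λ g → inj₂ (generic-map (λ w ¬h → ¬h ∘ proj₁ (t⇌ w _)) g)) ] (go t)
      where
      go : ∀ t → Generic (Holds t) ⊎ Generic (λ w → ¬ Holds t w)
      go (leaf true)   = inj₁ (generic-true λ _ → lift tt)
      go (leaf false)  = inj₂ (generic-true λ { _ (lift ()) })
      go (test s t t′) with em {∃ λ x → ¬ eval s x ≈ 0#}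
      ... | yes nz = [ (λ g → inj₁ (generic-map (λ w (n , h) → inj₂ (n , h)) (generic-× s-generic g))) ,
                       (λ g → inj₂ (generic-map (λ w (n , ¬h) → [ (λ (z , _) → n z) , (λ (_ , h) → ¬h h) ]) (generic-× s-generic g))) ]
                     (go t′)
        where
        s-generic : Generic (λ w → ¬ eval s w ≈ 0#)
        s-generic = s , nz , λ w n → n
      ... | no none = [ (λ g → inj₁ (generic-map (λ w h → inj₁ (vanish w , h)) g)) ,
                        (λ g → inj₂ (generic-map (λ w ¬h → [ (λ (_ , h) → ¬h h) , (λ (n , _) → n (vanish w)) ]) g)) ] (go t)
        where
        vanish : ∀ w → eval s w ≈ 0#
        vanish w = decidable-stable (zero? _) λ n → none (w , n)

    tame-generic : ∀ {P : Pred (X → K) p} → Tame P → Generic (λ w → (P w → Generic P) × (Generic P → P w))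
    tame-generic {P = P} tP = [ true-case , false-case ] (tame-dichotomy tP)
      where
      true-case : Generic P → Generic (λ w → (P w → Generic P) × (Generic P → P w))
      true-case gP = generic-map (λ w h → (λ _ → gP) , λ _ → h) gP
      false-case : Generic (λ w → ¬ P w) → Generic (λ w → (P w → Generic P) × (Generic P → P w))
      false-case g¬P = generic-map (λ w ¬h → (λ h → ⊥-elim (¬h h)) ,
        λ gP → ⊥-elim (let _ , h , ¬h = generic-nonempty (generic-× gP g¬P) in ¬h h)) g¬P

    generic-dense : ∀ {P : Pred (X → K) p} → Generic P → ZariskiDense 𝔽 P
    generic-dense (q , (x , qx≉0) , P) T P⊆T y r r∈T = decidable-stable (zero? _) λ ry≉0 →
      let z , qz≉0 , rz≉0 = irreducible q r qx≉0 ry≉0 in rz≉0 (P⊆T (P z qz≉0) r r∈T)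

    -- If `S` missed the open set of `q`, the closed set defined by `q` alone would contain `S` and
    -- hence be the whole space.
    dense-meets-generic : ∀ {S : Pred (X → K) p} {P : Pred (X → K) q} → ZariskiDense 𝔽 S → Generic P →
                          ¬ ¬ (∃ λ x → S x × P x)
    dense-meets-generic dense (q , (x , qx≉0) , P) none = qx≉0 (dense (λ r → Lift (a ⊔ c ⊔ ℓ) (r ≡ q))
      (λ { {y} Sy _ (lift refl) → decidable-stable (zero? _) λ qy≉0 → none (y , Sy , P y qy≉0) }) x q (lift refl))

-- Lower bounds for the sizes of finite sets

Injects : ∀ {A : Set a} → ℕ → Pred A p → Set (a ⊔ p)
Injects {A = A} n P = ∃ λ (f : Fin n → A) → Injective _≡_ _≡_ f × (∀ i → f i ∈ P)

module _ {A : Set a} where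

  injects-≤ : ∀ (P : Pred A p) {m n} → m ≤ n → Injects n P → Injects m P
  injects-≤ P m≤n (f , f-inj , f∈P) =
    (λ i → f (inject≤ i m≤n)) , (λ eq → Finₚ.inject≤-injective m≤n m≤n _ _ (f-inj eq)) , λ i → f∈P _

  injects-map : ∀ {B : Set q} (P : Pred A p) {p′} (Q : Pred B p′) {n} (h : A → B) →
                Injective _≡_ _≡_ h → (∀ {x} → x ∈ P → h x ∈ Q) → Injects n P → Injects n Q
  injects-map P Q h h-inj P⇒Q (f , f-inj , f∈P) = h ∘ f , (λ eq → f-inj (h-inj eq)) , λ i → P⇒Q (f∈P i)

  append-injective : ∀ {m n} {f : Fin m → A} {g : Fin n → A} → Injective _≡_ _≡_ f → Injective _≡_ _≡_ g →
                     (∀ i j → f i ≢ g j) → Injective _≡_ _≡_ (append f g)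
  append-injective {zero}  f-inj g-inj f≢g eq = g-inj eq
  append-injective {suc m} f-inj g-inj f≢g {zero}  {zero}  eq = refl
  append-injective {suc m} {f = f} f-inj g-inj f≢g {zero}  {suc j} eq =
    ⊥-elim (append-all (λ x → f zero ≢ x) {f = f ∘ suc} (λ i eq → Finₚ.0≢1+n (f-inj eq)) (f≢g zero) j eq)
  append-injective {suc m} {f = f} f-inj g-inj f≢g {suc i} {zero}  eq =
    ⊥-elim (append-all (λ x → f zero ≢ x) {f = f ∘ suc} (λ i eq → Finₚ.0≢1+n (f-inj eq)) (f≢g zero) i (≡.sym eq))
  append-injective {suc m} f-inj g-inj f≢g {suc i} {suc j} eq =
    cong suc (append-injective (λ eq → Finₚ.suc-injective (f-inj eq)) g-inj (λ i → f≢g (suc i)) eq)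

  injects-⋃ : ∀ {m} (P : Fin m → Pred A p) (s : Fin m → ℕ) → (∀ {i j x} → x ∈ P i → x ∈ P j → i ≡ j) →
              (∀ i → Injects (s i) (P i)) → Injects (CommutativeMonoidSum.sum ℕₚ.+-0-commutativeMonoid s) (λ x → ∃ λ i → x ∈ P i)
  injects-⋃ {m = zero}  P s disjoint each = (λ ()) , (λ { {()} }) , λ ()
  injects-⋃ {m = suc m} P s disjoint each
    with f , f-inj , f∈P ← each zero
       | g , g-inj , g∈P ← injects-⋃ (P ∘ suc) (s ∘ suc) (λ x∈i x∈j → Finₚ.suc-injective (disjoint x∈i x∈j)) (each ∘ suc) =
    append f g ,
    append-injective f-inj g-inj (λ i j eq → Finₚ.0≢1+n (disjoint (f∈P i) (subst (_∈ P (suc (proj₁ (g∈P j)))) (≡.sym eq) (proj₂ (g∈P j))))) ,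
    append-all (λ x → ∃ λ i → x ∈ P i) {f = f} (λ i → zero , f∈P i) (λ j → suc (proj₁ (g∈P j)) , proj₂ (g∈P j))

partition : ∀ n {P : Pred (Fin n) p} → (∀ i → Dec (P i)) →
            ∃ λ r → ∃ λ s → r ℕ.+ s ≡ n × Injects r P × Injects s (λ i → ¬ P i)
partition zero    P? = 0 , 0 , refl , ((λ ()) , (λ { {()} }) , λ ()) , ((λ ()) , (λ { {()} }) , λ ())
partition (suc n) {P} P? with partition n {P ∘ suc} (P? ∘ suc) | P? zero
... | r , s , eq , (f , f-inj , f∈P) , ¬P | yes P₀ = suc r , s , cong suc eq ,
      (zero F.∷ (suc ∘ f) , append-injective {m = 1} {f = λ _ → zero} (λ { {zero} {zero} _ → refl }) (f-inj ∘ Finₚ.suc-injective) (λ _ _ ()) ,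
       λ { zero → P₀ ; (suc i) → f∈P i }) ,
      injects-map (λ i → ¬ P (suc i)) (λ i → ¬ P i) suc Finₚ.suc-injective id ¬P
... | r , s , eq , P′ , (f , f-inj , f∉P) | no ¬P₀ = r , suc s , ≡.trans (ℕₚ.+-suc r s) (cong suc eq) ,
      injects-map (P ∘ suc) P suc Finₚ.suc-injective id P′ ,
      (zero F.∷ (suc ∘ f) , append-injective {m = 1} {f = λ _ → zero} (λ { {zero} {zero} _ → refl }) (f-inj ∘ Finₚ.suc-injective) (λ _ _ ()) ,
       λ { zero → ¬P₀ ; (suc i) → f∉P i })

-- Counting the translates through a vertex or an edge

module CayleyColumns {a} (𝒢 : FiniteGroup a) (g : Fin 2 → FiniteGroup.Carrier 𝒢)
                     (L : Subgraph (CayleyBigraph 𝒢 g)) where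

  open FiniteGroup 𝒢
  open Subgraph L

  private
    other-colour : ∀ {i j k : Fin 2} → j ≢ i → k ≢ i → j ≡ k
    other-colour {zero}     {zero}     {k}        j≢i k≢i = contradiction refl j≢i
    other-colour {zero}     {suc zero} {zero}     j≢i k≢i = contradiction refl k≢i
    other-colour {zero}     {suc zero} {suc zero} j≢i k≢i = refl
    other-colour {suc zero} {zero}     {zero}     j≢i k≢i = refl
    other-colour {suc zero} {zero}     {suc zero} j≢i k≢i = contradiction refl k≢i
    other-colour {suc zero} {suc zero} {k}        j≢i k≢i = contradiction refl j≢i

  -- In a component the edges of one colour are determined by their tails, so there are at most as many
  -- of them as vertices; hence each colour has at least |E| - |V| edges.
  coloured-edges : ∀ {r} → IsRho L r → ∀ i → Injects r (λ h → E (h , i))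
  coloured-edges {r} ρ i = subst (λ n → Injects n (λ h → E (h , i))) (≡.sym total)
    (injects-map (λ h → ∃ λ j → Piece j h) (λ h → E (h , i)) id id (λ (_ , h∈E , _) → h∈E) (injects-⋃ Piece (λ j → edges j ∸ vertices j)
      (λ (_ , j~x) (_ , j′~x) → rep-distinct _ _ (EqClosure-transitive j~x (EqClosure-symmetric j′~x))) component-edges))
    where
    open IsRho ρ
    import Relation.Binary.Construct.Closure.Equivalence as EqClosure
    EqClosure-transitive : ∀ {x y z} → Connected L x y → Connected L y z → Connected L x z
    EqClosure-transitive = EqClosure.transitive (Adjacent L)
    EqClosure-symmetric : ∀ {x y} → Connected L x y → Connected L y x
    EqClosure-symmetric = EqClosure.symmetric (Adjacent L)
    Piece : Fin number → Pred Carrier a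
    Piece j h = E (h , i) × Connected L (rep j) h
    component-edges : ∀ j → Injects (edges j ∸ vertices j) (Piece j)
    component-edges j
      with n₁ , n₂ , sum≡ , (f , f-inj , f-colour) , (f′ , f′-inj , f′-colour) ←
             partition (edges j) (λ e → proj₂ (HasSize.enum (edges-size j) e) Finₚ.≟ i) =
      injects-≤ (Piece j) (ℕₚ.≤-trans (ℕₚ.∸-monoʳ-≤ (edges j) n₂≤vertices)
                  (ℕₚ.≤-reflexive (≡.trans (cong (_∸ n₂) (≡.sym sum≡)) (ℕₚ.m+n∸n≡m n₁ n₂))))
        ((λ e → proj₁ (edge (f e))) ,
         (λ {x} {y} eq → f-inj (HasSize.injective (edges-size j) (cong₂ _,_ eq (≡.trans (f-colour x) (≡.sym (f-colour y)))))) ,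
         λ e → subst (λ i → E (proj₁ (edge (f e)) , i) × Connected L (rep j) (proj₁ (edge (f e)))) (f-colour e) (edge∈ (f e)))
      where
      edge = HasSize.enum (edges-size j)
      edge∈ : ∀ e → Subgraph.E (component L (rep j)) (edge e)
      edge∈ e = Equivalence.from (HasSize.image (edges-size j) (edge e)) (e , refl)
      index : ∀ e → ∃ λ v → HasSize.enum (vertices-size j) v ≡ proj₁ (edge e)
      index e = Equivalence.to (HasSize.image (vertices-size j) _) (Subgraph.tail∈V (component L (rep j)) (edge∈ e))
      n₂≤vertices : n₂ ≤ vertices j
      n₂≤vertices = Finₚ.injective⇒≤ {f = λ e → proj₁ (index (f′ e))} λ {x} {y} eq →
        f′-inj (HasSize.injective (edges-size j) (cong₂ _,_
          (≡.trans (≡.sym (proj₂ (index (f′ x)))) (≡.trans (cong (HasSize.enum (vertices-size j)) eq) (proj₂ (index (f′ y)))))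
          (other-colour (f′-colour x) (f′-colour y))))

  private
    group : Group a a
    group = record { isGroup = isGroup }
    open GroupProperties group using (∙-cancelʳ; ⁻¹-injective)
    open Group group using (inverseʳ; identityˡ)

    shift : ∀ v h → h ∙ (h ⁻¹ ∙ v) ≡ v
    shift v h = ≡.trans (≡.sym (assoc h (h ⁻¹) v)) (≡.trans (cong (_∙ v) (inverseʳ h)) (identityˡ v))

  -- Translation by `h ⁻¹ ∙ v` moves `h` to `v`, so distinct `h` give distinct columns. For a
  -- vertex, the tails of the edges of colour `zero` already provide enough `h`.
  columns : ∀ {k} → k ≤ρ L → ∀ P → Injects k (Translates 𝒢 g L P)
  columns (r , ρ , k≤r) (inj₁ v) = injects-≤ (Translates 𝒢 g L (inj₁ v)) k≤r (injects-map (λ h → E (h , zero)) (Translates 𝒢 g L (inj₁ v)) (λ h → h ⁻¹ ∙ v)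
    (λ eq → ⁻¹-injective (∙-cancelʳ v _ _ eq)) (λ {h} h∈E → h , tail∈V h∈E , shift v h) (coloured-edges ρ zero))
  columns (r , ρ , k≤r) (inj₂ (v , i)) = injects-≤ (Translates 𝒢 g L (inj₂ (v , i))) k≤r (injects-map (λ h → E (h , i)) (Translates 𝒢 g L (inj₂ (v , i))) (λ h → h ⁻¹ ∙ v)
    (λ eq → ⁻¹-injective (∙-cancelʳ v _ _ eq)) (λ {h} h∈E → h , h∈E , shift v h) (coloured-edges ρ i))

-- Surjectivity of a generic matrix

module GenericSurjectivity {a c ℓ} (𝔽 : CommutativeRing c ℓ) (isField : IsField 𝔽)
         (closed : IsAlgebraicallyClosed 𝔽) (em : ExcludedMiddle (a ⊔ c ⊔ ℓ))
         (𝒢 : FiniteGroup a) (g : Fin 2 → FiniteGroup.Carrier 𝒢)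
         (L : Subgraph (CayleyBigraph 𝒢 g)) (k : ℕ) where

  open FieldLemmas 𝔽 isField (lower-em ℓ (a ⊔ c ⊔ ℓ) em)
  open Univariate 𝔽 isField closed (lower-em ℓ (a ⊔ c ⊔ ℓ) em)
  open Genericity {a} 𝔽 isField closed em
  open FiniteGroup 𝒢 using (order; finite) renaming (Carrier to C)
  open Inverse finite using (to; from; strictlyInverseˡ; strictlyInverseʳ)

  module _ {X : Set a} where

    -- Fraction-free Gaussian elimination gives a polynomial whose nonvanishing makes A surjective.
    pivots : ∀ n → (Fin n → Fin n → Poly X) → Poly X
    schur : ∀ {n} → (Fin (suc n) → Fin (suc n) → Poly X) → Fin n → Fin n → Poly X
    schur A i j = (A zero zero :* A (suc i) (suc j)) :+ (con (- 1#) :* (A (suc i) zero :* A zero (suc j)))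

    pivots zero    A = con 1#
    pivots (suc n) A = A zero zero :* pivots n (schur A)

    pivots-solve : ∀ n A w → ¬ eval (pivots n A) w ≈ 0# → ∀ (b : Fin n → K) →
                   ∃ λ (r : Fin n → K) → ∀ i → sum (λ j → r j * eval (A i j) w) ≈ b i
    pivots-solve zero    A w _ b = (λ ()) , λ ()
    pivots-solve (suc n) A w nz b = r₀ F.∷ r , solved
      where
      M : Fin (suc n) → Fin (suc n) → K
      M i j = eval (A i j) w
      p≉0 : ¬ M zero zero ≈ 0#
      p≉0 p≈0 = nz (≈-trans (*-congʳ p≈0) (zeroˡ _))
      π = M zero zero
      p⁻¹ = proj₁ (inverse π p≉0)
      b′ : Fin n → K
      b′ i = π * b (suc i) + - 1# * (M (suc i) zero * b zero)
      IH = pivots-solve n (schur A) w (λ z → nz (≈-trans (*-congˡ z) (zeroʳ _))) b′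
      r = proj₁ IH
      S : Fin (suc n) → K
      S i = sum (λ j → r j * M i (suc j))
      r₀ = p⁻¹ * (b zero + - S zero)
      pr₀ : π * r₀ ≈ b zero + - S zero
      pr₀ = ≈-trans (≈-sym (*-assoc _ _ _)) (≈-trans (*-congʳ (proj₂ (inverse π p≉0))) (*-identityˡ _))
      expand : ∀ i → π * S (suc i) + - 1# * (M (suc i) zero * S zero) ≈ b′ i
      expand i = begin
        π * S (suc i) + - 1# * (M (suc i) zero * S zero)
          ≈⟨ +-cong (*-distribˡ-sum π (λ j → r j * M (suc i) (suc j)))
                    (≈-trans (≈-sym (*-assoc _ _ _)) (*-distribˡ-sum (- 1# * M (suc i) zero) (λ j → r j * M zero (suc j)))) ⟩
        sum (λ j → π * (r j * M (suc i) (suc j))) + sum (λ j → - 1# * M (suc i) zero * (r j * M zero (suc j)))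
          ≈⟨ ∑-distrib-+ (λ j → π * (r j * M (suc i) (suc j))) (λ j → - 1# * M (suc i) zero * (r j * M zero (suc j))) ⟨
        sum (λ j → π * (r j * M (suc i) (suc j)) + - 1# * M (suc i) zero * (r j * M zero (suc j)))
          ≈⟨ sum-cong-≋ (λ j → solve 6 (λ π r m n a b → π ⊗ (r ⊗ m) ⊕ n ⊗ a ⊗ (r ⊗ b) := r ⊗ (π ⊗ m ⊕ n ⊗ (a ⊗ b))) ≈-refl
               π (r j) (M (suc i) (suc j)) (- 1#) (M (suc i) zero) (M zero (suc j))) ⟩
        sum (λ j → r j * (π * M (suc i) (suc j) + - 1# * (M (suc i) zero * M zero (suc j))))
          ≈⟨ proj₂ IH i ⟩
        b′ i ∎
      solved : ∀ i → r₀ * M i zero + S i ≈ b i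
      solved zero = begin
        r₀ * π + S zero             ≈⟨ +-congʳ (≈-trans (*-comm _ _) pr₀) ⟩
        b zero + - S zero + S zero  ≈⟨ ≈-trans (+-assoc _ _ _) (+-congˡ (-‿inverseˡ _)) ⟩
        b zero + 0#                 ≈⟨ +-identityʳ _ ⟩
        b zero                      ∎
      -- Multiplied by the pivot, the claim turns into the equation of the Schur complement in
      -- `expand`; `cancel-zero` then removes the pivot.
      solved (suc i) = x-y≈0⇒x≈y (cancel-zero p≉0 (begin
        π * (r₀ * m + S (suc i) + - b (suc i))
          ≈⟨ *-congˡ (+-congˡ (-1*x≈-x _)) ⟨
        π * (r₀ * m + S (suc i) + - 1# * b (suc i))
          ≈⟨ solve 6 (λ π r m s n b → π ⊗ (r ⊗ m ⊕ s ⊕ n ⊗ b) := m ⊗ (π ⊗ r) ⊕ (π ⊗ s ⊕ n ⊗ (π ⊗ b))) ≈-refl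
               π r₀ m (S (suc i)) (- 1#) (b (suc i)) ⟩
        m * (π * r₀) + (π * S (suc i) + - 1# * (π * b (suc i)))
          ≈⟨ +-congʳ (*-congˡ (≈-trans pr₀ (+-congˡ (≈-sym (-1*x≈-x _))))) ⟩
        m * (b zero + - 1# * S zero) + (π * S (suc i) + - 1# * (π * b (suc i)))
          ≈⟨ solve 5 (λ m b n s t → m ⊗ (b ⊕ n ⊗ s) ⊕ t := (m ⊗ b) ⊕ (n ⊗ (m ⊗ s) ⊕ t)) ≈-refl
               m (b zero) (- 1#) (S zero) _ ⟩
        m * b zero + (- 1# * (m * S zero) + (π * S (suc i) + - 1# * (π * b (suc i))))
          ≈⟨ +-congˡ (≈-trans (≈-sym (+-assoc _ _ _)) (+-congʳ (≈-trans (+-comm _ _) (expand i)))) ⟩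
        m * b zero + (π * b (suc i) + - 1# * (m * b zero) + - 1# * (π * b (suc i)))
          ≈⟨ solve 3 (λ x y n → x ⊕ (y ⊕ n ⊗ x ⊕ n ⊗ y) := (x ⊕ y) ⊕ n ⊗ (x ⊕ y)) ≈-refl (m * b zero) (π * b (suc i)) (- 1#) ⟩
        (m * b zero + π * b (suc i)) + - 1# * (m * b zero + π * b (suc i))
          ≈⟨ ≈-trans (+-congˡ (-1*x≈-x _)) (-‿inverseʳ _) ⟩
        0# ∎))
        where m = M (suc i) zero

    -- This is to show that the pivot polynomial is not identically zero; the Schur complement of an
    -- identity matrix is again an identity matrix.
    pivots-identity : ∀ n A w → (∀ i j → eval (A i j) w ≈ δ i j) → eval (pivots n A) w ≈ 1#
    pivots-identity zero    A w A≈δ = ≈-refl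
    pivots-identity (suc n) A w A≈δ = ≈-trans (*-cong (A≈δ zero zero) (pivots-identity n (schur A) w λ i j → begin
      eval (A zero zero) w * eval (A (suc i) (suc j)) w + - 1# * (eval (A (suc i) zero) w * eval (A zero (suc j)) w)
        ≈⟨ +-cong (*-cong (A≈δ zero zero) (A≈δ (suc i) (suc j))) (*-congˡ (*-congʳ (A≈δ (suc i) zero))) ⟩
      1# * δ i j + - 1# * (0# * eval (A zero (suc j)) w)
        ≈⟨ +-cong (*-identityˡ _) (≈-trans (*-congˡ (zeroˡ _)) (zeroʳ _)) ⟩
      δ i j + 0#
        ≈⟨ +-identityʳ _ ⟩
      δ i j ∎)) (*-identityˡ 1#)

  𝟙 : C → C → K
  𝟙 y x = δ (to y) (to x)

  Σᴳ-𝟙 : ∀ y (f : C → K) → Σᴳ 𝔽 𝒢 g L k (λ x → 𝟙 y x * f x) ≈ f y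
  Σᴳ-𝟙 y f = begin
    sum (λ i → δ (to y) (to (from i)) * f (from i))
      ≈⟨ sum-cong-≋ (λ i → *-congʳ (≈-reflexive (cong (δ (to y)) (strictlyInverseˡ i)))) ⟩
    sum (λ i → δ (to y) i * f (from i))
      ≈⟨ sum-δ (to y) (f ∘ from) ⟩
    f (from (to y))
      ≈⟨ ≈-reflexive (cong f (strictlyInverseʳ y)) ⟩
    f y ∎

  generic-spanning : ∀ (P : Pred C a) → Injects k P → Generic {X = Fin k × C} λ M → ∀ (b : Fin k → K) →
    ∃ λ (r : C → K) → (∀ x → x ∉ P → r x ≈ 0#) × (∀ i → Σᴳ 𝔽 𝒢 g L k (λ x → r x * M (i , x)) ≈ b i)
  generic-spanning P (f , f-inj , f∈P) = pivots k A , (identity , nonzero) , spans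
    where
    A : Fin k → Fin k → Poly (Fin k × C)
    A i j = var (i , f j)
    -- Row `i` has its only nonzero entry, a one, in column `f i`, so the square matrix of the
    -- chosen columns becomes the identity.
    identity : Fin k × C → K
    identity (i , x) = sum λ j → δ i j * 𝟙 (f j) x
    nonzero : ¬ eval (pivots k A) identity ≈ 0#
    nonzero eq = 1≉0 (≈-trans (≈-sym (pivots-identity k A identity λ i j → begin
      sum (λ j′ → δ i j′ * 𝟙 (f j′) (f j))
        ≈⟨ sum-δ i (λ j′ → 𝟙 (f j′) (f j)) ⟩
      δ (to (f i)) (to (f j))
        ≈⟨ ≈-reflexive (δ-injective (λ eq → f-inj (↔-injective finite eq)) i j) ⟩
      δ i j ∎)) eq)
    spans : ∀ M → ¬ eval (pivots k A) M ≈ 0# → ∀ b → _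
    spans M nz b with s , s-solves ← pivots-solve k A M nz b =
      (λ x → sum λ j → s j * 𝟙 (f j) x) ,
      (λ x x∉P → sum-zero λ j → ≈-trans (*-congˡ (≈-reflexive (δ-≢ λ eq → x∉P (subst P (↔-injective finite eq) (f∈P j))))) (zeroʳ _)) ,
      λ i → begin
        sum (λ l → sum (λ j → s j * 𝟙 (f j) (from l)) * M (i , from l))
          ≈⟨ sum-cong-≋ (λ l → ≈-trans (*-distribʳ-sum (M (i , from l)) (λ j → s j * 𝟙 (f j) (from l)))
               (sum-cong-≋ λ j → *-assoc (s j) (𝟙 (f j) (from l)) (M (i , from l)))) ⟩
        sum (λ l → sum (λ j → s j * (𝟙 (f j) (from l) * M (i , from l))))
          ≈⟨ ∑-comm (λ l j → s j * (𝟙 (f j) (from l) * M (i , from l))) ⟩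
        sum (λ j → sum (λ l → s j * (𝟙 (f j) (from l) * M (i , from l))))
          ≈⟨ sum-cong-≋ (λ j → ≈-trans (≈-sym (*-distribˡ-sum (s j) (λ l → 𝟙 (f j) (from l) * M (i , from l))))
               (*-congˡ (Σᴳ-𝟙 (f j) (λ x → M (i , x))))) ⟩
        sum (λ j → s j * M (i , f j))
          ≈⟨ s-solves i ⟩
        b i ∎

  generic-surjective : k ≤ρ L → Generic {X = Fin k × C} (IsSurjective 𝔽 𝒢 g L k)
  generic-surjective k≤ρ = generic-map (λ { M (V , E) (inj₁ v) → transfer M (V (to v)) (strictlyInverseʳ v)
                                          ; M (V , E) (inj₂ (v , i)) → transferᴱ M v i (E (to v) i) (strictlyInverseʳ v) })
    (generic-× (generic-∀Fin {n = order} λ l → spanning (inj₁ (from l)))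
               (generic-∀Fin {n = order} λ l → generic-∀Fin {n = 2} λ i → spanning (inj₂ (from l , i))))
    where
    Spans : ∀ P → Pred (Fin k × C → K) _
    Spans P M = ∀ (b : Fin k → K) → ∃ λ (r : C → K) → (∀ x → x ∉ 𝒢[_] 𝔽 𝒢 g L k P → r x ≈ 0#) ×
                                      (∀ i → Σᴳ 𝔽 𝒢 g L k (λ x → r x * M (i , x)) ≈ b i)
    spanning : ∀ P → Generic (Spans P)
    spanning P = generic-spanning (Translates 𝒢 g L P) (CayleyColumns.columns 𝒢 g L k≤ρ P)
    transfer : ∀ M {v} → Spans (inj₁ v) M → ∀ {v′} → v ≡ v′ → Spans (inj₁ v′) M
    transfer M h refl = h
    transferᴱ : ∀ M v i {v′} → Spans (inj₂ (v′ , i)) M → v′ ≡ v → Spans (inj₂ (v , i)) M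
    transferᴱ M v i h refl = h

-- Profiles, their definability and their translation

module Profiles {a c ℓ} (𝔽 : CommutativeRing c ℓ) (isField : IsField 𝔽)
         (closed : IsAlgebraicallyClosed 𝔽) (em : ExcludedMiddle (a ⊔ c ⊔ ℓ))
         (𝒢 : FiniteGroup a) (g : Fin 2 → FiniteGroup.Carrier 𝒢)
         (L : Subgraph (CayleyBigraph 𝒢 g)) (k : ℕ) where

  open FieldLemmas 𝔽 isField (lower-em ℓ (a ⊔ c ⊔ ℓ) em)
  open Univariate 𝔽 isField closed (lower-em ℓ (a ⊔ c ⊔ ℓ) em)
  open Definable 𝔽 isField closed (lower-em (c ⊔ ℓ) (a ⊔ c ⊔ ℓ) em)
  open Genericity {a} 𝔽 isField closed em
  open FiniteGroup 𝒢 using (order; finite; isGroup; assoc; _∙_; _⁻¹) renaming (Carrier to C)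
  open FiniteGraph (CayleyBigraph 𝒢 g) using (Edge; head; tail; V-finite; E-finite)

  module _ {I : Set a} {N : ℕ} (fin : I ↔ Fin N) where
    open Inverse fin

    indicator : I → I → K
    indicator i j = δ (to i) (to j)

    indicator-injective : ∀ {f : I → I} → Injective _≡_ _≡_ f → ∀ i j → indicator (f i) (f j) ≡ indicator i j
    indicator-injective {f} f-inj i j with to i Finₚ.≟ to j
    ... | yes eq with refl ← ↔-injective fin eq = ≡.trans (δ-refl (to (f i))) (≡.sym (δ-refl (to i)))
    ... | no i≢j = ≡.trans (δ-≢ (λ eq → i≢j (cong to (f-inj (↔-injective fin eq))))) (≡.sym (δ-≢ i≢j))

    -- The `j`-th vector is `u (j , _)` placed in the summand `T j` of a direct sum and zero
    -- elsewhere. Writing this with `indicator` leaves only scalars, so that quantifier elimination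
    -- applies.
    Independent̂ : ∀ {d} → (Fin d → I) → (Fin d × C → K) → Set (a ⊔ c ⊔ ℓ)
    Independent̂ {d} T u = ∀ (r : Fin d → K) →
      (∀ i x → sum (λ j → r j * (indicator (T j) i * u (j , x))) ≈ 0#) → ∀ j → r j ≈ 0#

  𝟙 : C → C → K
  𝟙 = indicator V-finite

  Matrix′ : Set (a ⊔ c)
  Matrix′ = Matrix 𝔽 𝒢 g L k

  In : Matrix′ → C ⊎ Edge → Pred (C → K) (a ⊔ ℓ)
  In M P = Subspace.member (𝒦-space 𝔽 𝒢 g L k M P)

  Span̂ : ∀ {d} → (Fin d → C) → (Fin d × C → K) → C → (C → K) → Set (a ⊔ c ⊔ ℓ)
  Span̂ {d} τ u v₀ f = ∃ λ (r : Fin d → K) →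
    ∀ v x → sum (λ i → r i * (𝟙 (τ i) v * u (i , x))) ≈ 𝟙 v₀ v * f x

  record Solution (M : Matrix′) {d e} (τ : Fin d → C) (σ : Fin e → Edge)
                  (u : Fin d × C → K) (w : Fin e × C → K) : Set (a ⊔ c ⊔ ℓ) where
    constructor solution
    field
      u∈𝒦   : ∀ j → In M (inj₁ (τ j)) (λ x → u (j , x))
      w∈𝒦   : ∀ j → In M (inj₂ (σ j)) (λ x → w (j , x))
      u-ind : Independent̂ V-finite τ u
      w-ind : Independent̂ E-finite σ w
      heads : ∀ j → Span̂ τ u (head (σ j)) (λ x → w (j , x))
      tails : ∀ j → Span̂ τ u (tail (σ j)) (λ x → w (j , x))

  -- The sheaf of M has independent sections u at the vertices τ and w at the edges σ such that the span U of u
  -- has w in Γʰᵗ(U).  Unlike subspaces, these are finitely many scalars, so the condition on M is constructible.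
  Profile : ∀ {d e} → (Fin d → C) → (Fin e → Edge) → Pred Matrix′ (a ⊔ c ⊔ ℓ)
  Profile τ σ M = ∃ λ u → ∃ λ w → Solution M τ σ u w

  module _ {X : Set a} where

    PolynomialMap : ((X → K) → K) → Set (a ⊔ c ⊔ ℓ)
    PolynomialMap f = ∃ λ (q : Poly X) → ∀ w → eval q w ≈ f w

    p-const : ∀ x → PolynomialMap (λ _ → x)
    p-const x = con x , λ _ → ≈-refl

    p-var : ∀ i → PolynomialMap (λ w → w i)
    p-var i = var i , λ _ → ≈-refl

    p-* : ∀ {f h} → PolynomialMap f → PolynomialMap h → PolynomialMap (λ w → f w * h w)
    p-* (q , q≈) (r , r≈) = q :* r , λ w → *-cong (q≈ w) (r≈ w)

    p-sum : ∀ {n} {f : Fin n → (X → K) → K} → (∀ i → PolynomialMap (f i)) → PolynomialMap (λ w → sum (λ i → f i w))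
    p-sum {zero}  pf = con 0# , λ _ → ≈-refl
    p-sum {suc n} pf with q , q≈ ← pf zero | r , r≈ ← p-sum (pf ∘ suc) = q :+ r , λ w → +-cong (q≈ w) (r≈ w)

    tame-≈ : ∀ {f h} → PolynomialMap f → PolynomialMap h → Tame (λ w → f w ≈ h w)
    tame-≈ {f} {h} (q , q≈) (r , r≈) = tame-resp
      (λ w → (λ z → x-y≈0⇒x≈y (≈-trans (≈-sym (difference w)) z)) ,
             λ f≈h → ≈-trans (difference w) (≈-trans (+-congʳ f≈h) (-‿inverseʳ _)))
      (tame-zero (q :+ (con (- 1#) :* r)))
      where
      difference : ∀ w → eval q w + - 1# * eval r w ≈ f w + - h w
      difference w = +-cong (q≈ w) (≈-trans (-1*x≈-x _) (-‿cong (r≈ w)))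

    tame-∀I : ∀ {I : Set q} {N} → I ↔ Fin N → {P : I → Pred (X → K) p} → (∀ i → Tame (P i)) → Tame (λ w → ∀ i → P i w)
    tame-∀I fin {P} tP = tame-resp
      (λ w → (λ h i → subst (λ i → P i w) (strictlyInverseʳ i) (h (to i))) , λ h j → h (from j))
      (tame-∀Fin (tP ∘ from))
      where open Inverse fin

    tame-In : ∀ P {M : Fin k → C → (X → K) → K} {f : C → (X → K) → K} →
              (∀ i x → PolynomialMap (M i x)) → (∀ x → PolynomialMap (f x)) →
              Tame (λ w → In (λ (i , x) → M i x w) P (λ x → f x w))
    tame-In P pM pf = tame-×
      -- Membership in the set of translates does not involve the matrix, so excluded middle settles
      -- it once and for all.
      (tame-∀I finite λ x → tame-→ (tame-const (lower-em a (a ⊔ c ⊔ ℓ) em)) (tame-≈ (pf x) (p-const 0#)))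
      (tame-∀Fin λ i → tame-≈ (p-sum λ l → p-* (pf (Inverse.from finite l)) (pM i (Inverse.from finite l))) (p-const 0#))

  pairs : ∀ d → (Fin d × C) ↔ Fin (d ℕ.* order)
  pairs d = ↔-sym Finₚ.*↔× ↔-∘ (↔-id (Fin d) ×-↔ finite)

  private
    weaken : ∀ {X : Set a} {d} {f : (X → K) → K} → PolynomialMap f → PolynomialMap {X ⊎ Fin d} (λ v → f (v ∘ inj₁))
    weaken (q , q≈) = q ⟪ var ∘ inj₁ ⟫ , λ v → ≈-trans (eval-⟪⟫ q (var ∘ inj₁) v) (q≈ (v ∘ inj₁))

    tame-Independent̂ : ∀ {X I : Set a} {N} (fin : I ↔ Fin N) {d} (T : Fin d → I) {u : Fin d → C → (X → K) → K} →
                       (∀ j x → PolynomialMap (u j x)) → Tame (λ v → Independent̂ fin T (λ (j , x) → u j x v))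
    tame-Independent̂ fin {d} T pu = tame-∀ (↔-id (Fin d)) (tame-→
      (tame-∀I fin λ i → tame-∀I finite λ x → tame-≈
        (p-sum λ j → p-* (p-var (inj₂ j)) (p-* (p-const _) (weaken (pu j x)))) (p-const 0#))
      (tame-∀Fin λ j → tame-≈ (p-var (inj₂ j)) (p-const 0#)))

    tame-Span̂ : ∀ {X : Set a} {d} (τ : Fin d → C) v₀ {u : Fin d → C → (X → K) → K} {f : C → (X → K) → K} →
                (∀ j x → PolynomialMap (u j x)) → (∀ x → PolynomialMap (f x)) →
                Tame (λ v → Span̂ τ (λ (j , x) → u j x v) v₀ (λ x → f x v))
    tame-Span̂ {d = d} τ v₀ pu pf = tame-∃ (↔-id (Fin d))
      (tame-∀I finite λ v → tame-∀I finite λ x → tame-≈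
        (p-sum λ i → p-* (p-var (inj₂ i)) (p-* (p-const _) (weaken (pu i x)))) (p-* (p-const _) (weaken (pf x))))

  tame-Profile : ∀ {d e} (τ : Fin d → C) (σ : Fin e → Edge) → Tame (Profile τ σ)
  tame-Profile {d} {e} τ σ = tame-∃ (pairs d) (tame-∃ (pairs e) (tame-resp
    (λ _ → (λ (u∈ , w∈ , ui , wi , h , t) → solution u∈ w∈ ui wi h t) , λ (solution u∈ w∈ ui wi h t) → u∈ , w∈ , ui , wi , h , t)
    (tame-× (tame-∀Fin λ j → tame-In (inj₁ (τ j)) (λ i x → p-var (inj₁ (inj₁ (i , x)))) (λ x → p-var (inj₁ (inj₂ (j , x)))))
    (tame-× (tame-∀Fin λ j → tame-In (inj₂ (σ j)) (λ i x → p-var (inj₁ (inj₁ (i , x)))) (λ x → p-var (inj₂ (j , x))))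
    (tame-× (tame-Independent̂ V-finite τ (λ j x → p-var (inj₁ (inj₂ (j , x)))))
    (tame-× (tame-Independent̂ E-finite σ (λ j x → p-var (inj₂ (j , x))))
    (tame-× (tame-∀Fin λ j → tame-Span̂ τ (head (σ j)) (λ j x → p-var (inj₁ (inj₂ (j , x)))) (λ x → p-var (inj₂ (j , x))))
            (tame-∀Fin λ j → tame-Span̂ τ (tail (σ j)) (λ j x → p-var (inj₁ (inj₂ (j , x)))) (λ x → p-var (inj₂ (j , x)))))))))))

  private
    group : Group a a
    group = record { isGroup = isGroup }
    open GroupProperties group using (∙-cancelʳ)
    open Group group using (inverseˡ; inverseʳ; identityʳ)

  _·_ : C → C → C
  v · y = v ∙ y ⁻¹

  ·-∙ : ∀ v y → (v · y) ∙ y ≡ v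
  ·-∙ v y = ≡.trans (assoc v (y ⁻¹) y) (≡.trans (cong (v ∙_) (inverseˡ y)) (identityʳ v))

  ∙-· : ∀ v y → (v ∙ y) · y ≡ v
  ∙-· v y = ≡.trans (assoc v y (y ⁻¹)) (≡.trans (cong (v ∙_) (inverseʳ y)) (identityʳ v))

  shiftᴱ : C → Edge → Edge
  shiftᴱ y (v , i) = v ∙ y , i

  indicator-shift : ∀ y v v′ → 𝟙 (v ∙ y) v′ ≡ 𝟙 v (v′ · y)
  indicator-shift y v v′ = ≡.trans (cong (𝟙 (v ∙ y)) (≡.sym (·-∙ v′ y)))
    (indicator-injective V-finite (λ {x} {x′} → ∙-cancelʳ y x x′) v (v′ · y))

  translateᴹ : C → Matrix′ → Matrix′
  translateᴹ y M (i , x) = M (i , x ∙ y)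

  Σᴳ-shift : ∀ y (f : C → K) → Σᴳ 𝔽 𝒢 g L k (λ x → f (x ∙ y)) ≈ Σᴳ 𝔽 𝒢 g L k f
  Σᴳ-shift y f = ≈-trans (≈-reflexive (sum-cong-≗ {order} λ i → cong f (≡.sym (strictlyInverseʳ (from i ∙ y)))))
                         (≈-sym (sum-permute (f ∘ from) shift))
    where
    open Inverse finite
    open SemiringSum semiring using (sum-cong-≗)
    shift : Fin order ↔ Fin order
    shift = finite ↔-∘ (mk↔ₛ′ (_∙ y) (_· y) (λ v → ·-∙ v y) (λ v → ∙-· v y) ↔-∘ ↔-sym finite)

  -- Column `x` of `translateᴹ y M` is column `x ∙ y` of `M`, so a relation among columns moves
  -- along with its support, and the sum over the group is merely reordered.
  In-translate : ∀ y M P P′ {f} → (∀ x → Translates 𝒢 g L P (x · y) → Translates 𝒢 g L P′ x) →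
                 In (translateᴹ y M) P f → In M P′ (λ x → f (x · y))
  In-translate y M P P′ {f} P⇒P′ (supp , ker) =
    (λ x x∉P′ → supp (x · y) (x∉P′ ∘ P⇒P′ x)) ,
    λ i → ≈-trans (≈-sym (Σᴳ-shift y (λ x → f (x · y) * M (i , x))))
      (≈-trans (Σᴳ-cong 𝔽 𝒢 g L k (λ x → *-congʳ {M (i , x ∙ y)} (≈-reflexive (cong f (∙-· x y))))) (ker i))

  private
    translates : ∀ {h x v y} → h ∙ (x · y) ≡ v → h ∙ x ≡ v ∙ y
    translates {h} {x} {v} {y} eq = ≡.trans (≡.sym (·-∙ (h ∙ x) y)) (cong (_∙ y) (≡.trans (assoc h x (y ⁻¹)) eq))

    Independent̂-translate : ∀ {I : Set a} {N} (fin : I ↔ Fin N) {φ : I → I} → Injective _≡_ _≡_ φ →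
      ∀ y {d} (T : Fin d → I) {u : Fin d × C → K} → Independent̂ fin T u → Independent̂ fin (φ ∘ T) (λ (j , x) → u (j , x · y))
    Independent̂-translate fin {φ} φ-inj y T {u} ind r r≈0 = ind r λ i x → ≈-trans
      (sum-cong-≋ λ j → *-congˡ (*-cong (≈-reflexive (≡.sym (indicator-injective fin φ-inj (T j) i)))
                                        (≈-reflexive (cong (λ x → u (j , x)) (≡.sym (∙-· x y))))))
      (r≈0 (φ i) (x ∙ y))

    Span̂-translate : ∀ y {d} (τ : Fin d → C) {u : Fin d × C → K} {v₀ v₁ f} → v₀ ∙ y ≡ v₁ →
                     Span̂ τ u v₀ f → Span̂ (λ j → τ j ∙ y) (λ (j , x) → u (j , x · y)) v₁ (λ x → f (x · y))
    Span̂-translate y τ {u} {v₀} refl (r , r≈) = r , λ v x → ≈-trans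
      (sum-cong-≋ λ i → *-congˡ (*-congʳ (≈-reflexive (indicator-shift y (τ i) v))))
      (≈-trans (r≈ (v · y) (x · y)) (*-congʳ (≈-reflexive (≡.sym (indicator-shift y v₀ v)))))

  Profile-translate : ∀ y M {d e} {τ : Fin d → C} {σ : Fin e → Edge} →
                      Profile τ σ (translateᴹ y M) → Profile (λ j → τ j ∙ y) (λ j → shiftᴱ y (σ j)) M
  Profile-translate y M {τ = τ} {σ} (u , w , solution u∈ w∈ ui wi h t) = _ , _ , solution
    (λ j → In-translate y M (inj₁ (τ j)) (inj₁ (τ j ∙ y)) (λ x (h , h∈V , eq) → h , h∈V , translates eq) (u∈ j))
    (λ j → In-translate y M (inj₂ (σ j)) (inj₂ (shiftᴱ y (σ j))) (λ x (h , h∈E , eq) → h , h∈E , translates eq) (w∈ j))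
    (Independent̂-translate V-finite (λ {x} {x′} → ∙-cancelʳ y x x′) y τ ui)
    (Independent̂-translate E-finite (λ eq → cong₂ _,_ (∙-cancelʳ y _ _ (cong proj₁ eq)) (cong proj₂ eq)) y σ wi)
    -- Generators multiply on the left and `y` on the right, so associativity carries heads to
    -- heads; for tails the equation is definitional.
    (λ j → Span̂-translate y τ (assoc _ _ y) (h j))
    (λ j → Span̂-translate y τ refl (t j))

  Profile-resp : ∀ M {d e} {τ τ′ : Fin d → C} {σ σ′ : Fin e → Edge} → (∀ j → τ j ≡ τ′ j) → (∀ j → σ j ≡ σ′ j) →
                 Profile τ σ M → Profile τ′ σ′ M
  Profile-resp M {τ = τ} {τ′} {σ} {σ′} τ≗ σ≗ (u , w , solution u∈ w∈ ui wi h t) = u , w , solution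
    (λ j → subst (λ v → In M (inj₁ v) (λ x → u (j , x))) (τ≗ j) (u∈ j))
    (λ j → subst (λ e → In M (inj₂ e) (λ x → w (j , x))) (σ≗ j) (w∈ j))
    (λ r r≈0 → ui r λ i x → ≈-trans (sum-cong-≋ λ j → *-congˡ (*-congʳ (≈-reflexive (cong (λ v → 𝟙 v i) (τ≗ j))))) (r≈0 i x))
    (λ r r≈0 → wi r λ i x → ≈-trans (sum-cong-≋ λ j → *-congˡ (*-congʳ (≈-reflexive (cong (λ e → indicator E-finite e i) (σ≗ j))))) (r≈0 i x))
    (λ j → span (cong head (σ≗ j)) (h j))
    (λ j → span (cong tail (σ≗ j)) (t j))
    where
    span : ∀ {v₀ v₁ f} → v₀ ≡ v₁ → Span̂ τ u v₀ f → Span̂ τ′ u v₁ f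
    span refl (r , r≈) = r , λ v x → ≈-trans (sum-cong-≋ λ i → *-congˡ (*-congʳ (≈-reflexive (cong (λ t → 𝟙 t v) (≡.sym (τ≗ i)))))) (r≈ v x)

  generic-translate : ∀ y {P : Pred Matrix′ p} → Generic P → Generic (λ M → P (translateᴹ y M))
  generic-translate y (q , (M , qM≉0) , P) = q ⟪ σ ⟫ ,
    -- Permuting columns is invertible: translating the given point back by `y ⁻¹` yields one where
    -- the substituted polynomial does not vanish.
    (translateᴹ (y ⁻¹) M , λ eq → qM≉0 (≈-trans (≈-sym (≈-trans (eval-⟪⟫ q σ (translateᴹ (y ⁻¹) M))
      (eval-cong q λ (i , x) → ≈-reflexive (cong (λ x → M (i , x)) (∙-· x y))))) eq)) ,
    λ M nz → P (translateᴹ y M) (nz ∘ ≈-trans (eval-⟪⟫ q σ M))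
    where
    σ : Fin k × C → Poly (Fin k × C)
    σ (i , x) = var (i , x ∙ y)

  generic-Profile-translate : ∀ y {d e} {τ : Fin d → C} {σ : Fin e → Edge} →
                              Generic (Profile τ σ) → Generic (Profile (λ j → τ j ∙ y) (λ j → shiftᴱ y (σ j)))
  generic-Profile-translate y gP = generic-map (λ M → Profile-translate y M) (generic-translate y gP)

-- fiberAt lists the fibre of T over i: the first index occurs δℕ (T zero) i times, that is once or never.
module Fibers where

  δℕ : ∀ {n} → Fin n → Fin n → ℕ
  δℕ zero    zero    = 1
  δℕ zero    (suc j) = 0
  δℕ (suc i) zero    = 0
  δℕ (suc i) (suc j) = δℕ i j

  δℕ-injective : ∀ {m n} {f : Fin m → Fin n} → Injective _≡_ _≡_ f → ∀ i j → δℕ (f i) (f j) ≡ δℕ i j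
  δℕ-injective {f = f} f-inj i j with i Finₚ.≟ j
  ... | yes refl = ≡.trans (diagonal (f i)) (≡.sym (diagonal i))
    where
    diagonal : ∀ {n} (i : Fin n) → δℕ i i ≡ 1
    diagonal zero    = refl
    diagonal (suc i) = diagonal i
  ... | no i≢j = ≡.trans (off-diagonal (i≢j ∘ f-inj)) (≡.sym (off-diagonal i≢j))
    where
    off-diagonal : ∀ {n} {i j : Fin n} → i ≢ j → δℕ i j ≡ 0
    off-diagonal {i = zero}  {zero}  i≢j = contradiction refl i≢j
    off-diagonal {i = zero}  {suc j} i≢j = refl
    off-diagonal {i = suc i} {zero}  i≢j = refl
    off-diagonal {i = suc i} {suc j} i≢j = off-diagonal (i≢j ∘ cong suc)

  fiberSize : ∀ {d n} → (Fin d → Fin n) → Fin n → ℕ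
  fiberSize {zero}  T i = 0
  fiberSize {suc d} T i = δℕ (T zero) i ℕ.+ fiberSize (T ∘ suc) i

  fiberAt : ∀ {d n} (T : Fin d → Fin n) i → Fin (fiberSize T i) → Fin d
  fiberAt {suc d} T i = append (λ _ → zero) (suc ∘ fiberAt (T ∘ suc) i)

  private
    at-most-one : ∀ {n} (i j : Fin n) (x y : Fin (δℕ i j)) → x ≡ y
    at-most-one zero    zero    zero zero = refl
    at-most-one (suc i) (suc j) x    y    = at-most-one i j x y

    occurs : ∀ {n} (i j : Fin n) → Fin (δℕ i j) → i ≡ j
    occurs zero    zero    _ = refl
    occurs (suc i) (suc j) l = cong suc (occurs i j l)

  fiberAt-injective : ∀ {d n} (T : Fin d → Fin n) i → Injective _≡_ _≡_ (fiberAt T i)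
  fiberAt-injective {suc d} T i = append-injective {f = λ _ → zero} (λ _ → at-most-one (T zero) i _ _)
    (λ eq → fiberAt-injective (T ∘ suc) i (Finₚ.suc-injective eq)) (λ _ _ ())

  fiberAt-fiber : ∀ {d n} (T : Fin d → Fin n) i l → T (fiberAt T i l) ≡ i
  fiberAt-fiber {suc d} T i = append-all (λ j → T j ≡ i) {f = λ _ → zero}
    (occurs (T zero) i) (fiberAt-fiber (T ∘ suc) i)

  open CommutativeMonoidSum ℕₚ.+-0-commutativeMonoid using () renaming (sum to sumℕ; ∑-distrib-+ to sumℕ-+; sum-cong-≗ to sumℕ-cong)

  private
    sumℕ-const : ∀ n t → sumℕ {n} (λ _ → t) ≡ n ℕ.* t
    sumℕ-const zero    t = refl
    sumℕ-const (suc n) t = cong (t ℕ.+_) (sumℕ-const n t)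

    sumℕ-δ : ∀ {n} (i : Fin n) → sumℕ (δℕ i) ≡ 1
    sumℕ-δ {suc n} zero    = cong suc (≡.trans (sumℕ-const n 0) (ℕₚ.*-zeroʳ n))
    sumℕ-δ {suc n} (suc i) = sumℕ-δ i

  fibers-total : ∀ {d n} (T : Fin d → Fin n) → sumℕ (fiberSize T) ≡ d
  fibers-total {zero}  {n} T = ≡.trans (sumℕ-const n 0) (ℕₚ.*-zeroʳ n)
  fibers-total {suc d} T = ≡.trans (sumℕ-+ (δℕ (T zero)) (fiberSize (T ∘ suc))) (cong₂ ℕ._+_ (sumℕ-δ (T zero)) (fibers-total (T ∘ suc)))

  fibers-equal : ∀ {d n} (T : Fin d → Fin n) t → (∀ i → fiberSize T i ≡ t) → d ≡ n ℕ.* t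
  fibers-equal {n = n} T t eq = ≡.trans (≡.sym (fibers-total T)) (≡.trans (sumℕ-cong eq) (sumℕ-const n t))

  fiberSize-map : ∀ {d m n} {f : Fin m → Fin n} → Injective _≡_ _≡_ f → ∀ (T : Fin d → Fin m) (T′ : Fin d → Fin n) →
                  (∀ j → T′ j ≡ f (T j)) → ∀ i → fiberSize T′ (f i) ≡ fiberSize T i
  fiberSize-map {zero}  f-inj T T′ T′≡ i = refl
  fiberSize-map {suc d} {f = f} f-inj T T′ T′≡ i = cong₂ ℕ._+_
    (≡.trans (cong (λ j → δℕ j (f i)) (T′≡ zero)) (δℕ-injective f-inj (T zero) i))
    (fiberSize-map f-inj (T ∘ suc) (T′ ∘ suc) (T′≡ ∘ suc) i)

-- Direct sums of stalks and their gradings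

module DirectSum {a c ℓ} (𝔽 : CommutativeRing c ℓ) (isField : IsField 𝔽)
         (closed : IsAlgebraicallyClosed 𝔽) (em : ExcludedMiddle (a ⊔ c ⊔ ℓ))
         (𝒢 : FiniteGroup a) (g : Fin 2 → FiniteGroup.Carrier 𝒢)
         (L : Subgraph (CayleyBigraph 𝒢 g)) (k : ℕ)
         {I : Set a} {N : ℕ} (fin : I ↔ Fin N) (W : I → Subspace 𝔽 (F^𝒢 𝔽 𝒢 g L k) (a ⊔ ℓ)) where

  open FieldLemmas 𝔽 isField (lower-em ℓ (a ⊔ c ⊔ ℓ) em)
  open Profiles 𝔽 isField closed em 𝒢 g L k using (indicator; Independent̂)
  open FiniteGroup 𝒢 using (order; finite) renaming (Carrier to C)
  open Inverse fin

  module N = LeftModule (⨁ 𝔽 (λ i → subspaceModule 𝔽 (W i)))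
  open LinearAlgebra 𝔽 isField em (⨁ 𝔽 (λ i → subspaceModule 𝔽 (W i))) public
  open Fibers

  κ : N.Carrierᴹ → I → C → K
  κ u i x = proj₁ (u i) x

  κ-comb : ∀ {d} (r : Fin d → K) (b : Fin d → N.Carrierᴹ) i x → κ (comb r b) i x ≈ sum (λ j → r j * κ (b j) i x)
  κ-comb {zero}  r b i x = ≈-refl
  κ-comb {suc d} r b i x = +-congˡ (κ-comb (r ∘ suc) (b ∘ suc) i x)

  -- The direct sum embeds in the scalar functions on `I × C`, a space of dimension `N ℕ.* order`.
  bounded : Bounded (N ℕ.* order)
  bounded e b ind with e ℕₚ.≤? (N ℕ.* order)
  ... | yes e≤ = e≤
  ... | no  e≰ = ⊥-elim (go e b ind (ℕₚ.≰⇒> e≰))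
    where
    coordinate : N.Carrierᴹ → Fin N × Fin order → K
    coordinate u (l , x) = κ u (from l) (Inverse.from finite x)
    go : ∀ e (b : Fin e → N.Carrierᴹ) → Independent b → ¬ (N ℕ.* order < e)
    go (suc e) b ind (s≤s le) with r , (j , rj≉0) , r≈0 ← dependent le (λ j l → coordinate (b j) (remQuot order l)) =
      rj≉0 (ind r (λ i x → begin
        κ (comb r b) i x
          ≈⟨ κ-comb r b i x ⟩
        sum (λ j → r j * κ (b j) i x)
          ≈⟨ sum-cong-≋ {suc e} {λ j → r j * κ (b j) i x} {λ j → r j * coordinate (b j) (to i , Inverse.to finite x)} (λ j → *-congˡ {r j} (≈-reflexive (cong₂ (κ (b j))
               (≡.sym (strictlyInverseʳ i)) (≡.sym (Inverse.strictlyInverseʳ finite x))))) ⟩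
        sum (λ j → r j * coordinate (b j) (to i , Inverse.to finite x))
          ≈⟨ sum-cong-≋ {suc e} {λ j → r j * coordinate (b j) (to i , Inverse.to finite x)}
               {λ j → r j * coordinate (b j) (remQuot order (combine (to i) (Inverse.to finite x)))} (λ j → *-congˡ {r j} (≈-reflexive (cong (coordinate (b j))
               (≡.sym (Finₚ.remQuot-combine (to i) (Inverse.to finite x)))))) ⟩
        sum (λ j → r j * coordinate (b j) (remQuot order (combine (to i) (Inverse.to finite x))))
          ≈⟨ r≈0 (combine (to i) (Inverse.to finite x)) ⟩
        0# ∎) j)

  Homogeneous : I → Pred N.Carrierᴹ (a ⊔ ℓ)
  Homogeneous i h = ∀ j → j ≢ i → ∀ x → κ h j x ≈ 0#

  indicator-diagonal : ∀ i → indicator fin i i ≡ 1#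
  indicator-diagonal i = δ-refl (to i)

  indicator-off : ∀ {i j} → i ≢ j → indicator fin i j ≡ 0#
  indicator-off i≢j = δ-≢ (i≢j ∘ ↔-injective fin)

  _≟ᴵ_ : ∀ (i j : I) → Dec (i ≡ j)
  i ≟ᴵ j with to i Finₚ.≟ to j
  ... | yes eq = yes (↔-injective fin eq)
  ... | no neq = no (neq ∘ cong to)

  homogeneous-κ : ∀ {i h} → Homogeneous i h → ∀ j x → κ h j x ≈ indicator fin i j * κ h i x
  homogeneous-κ {i} {h} hom j x with i ≟ᴵ j
  ... | yes refl = ≈-sym (≈-trans (*-congʳ (≈-reflexive (indicator-diagonal i))) (*-identityˡ _))
  ... | no i≢j = ≈-trans (hom j (i≢j ∘ ≡.sym) x) (≈-sym (≈-trans (*-congʳ (≈-reflexive (indicator-off i≢j))) (zeroˡ _)))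

  single : ∀ i → Σ (C → K) (Subspace.member (W i)) → N.Carrierᴹ
  single i f j with i ≟ᴵ j
  ... | yes i≡j = subst (λ j → Σ (C → K) (Subspace.member (W j))) i≡j f
  ... | no  _   = N.0ᴹ j

  -- Later arguments use this description by scalars, which hides the transport along `i ≡ j` inside
  -- `single`.
  κ-single : ∀ i f j x → κ (single i f) j x ≈ indicator fin i j * proj₁ f x
  κ-single i f j x with i ≟ᴵ j
  ... | yes refl = ≈-sym (≈-trans (*-congʳ (≈-reflexive (indicator-diagonal i))) (*-identityˡ _))
  ... | no i≢j = ≈-sym (≈-trans (*-congʳ (≈-reflexive (indicator-off i≢j))) (zeroˡ _))

  single-homogeneous : ∀ i f → Homogeneous i (single i f)
  single-homogeneous i f j j≢i x =
    ≈-trans (κ-single i f j x) (≈-trans (*-congʳ (≈-reflexive (indicator-off (j≢i ∘ ≡.sym)))) (zeroˡ _))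

  decompose : ∀ (S : Subspace 𝔽 (⨁ 𝔽 (λ i → subspaceModule 𝔽 (W i))) p) u →
              (∀ i → single i (u i) ∈ Subspace.member S) → u ∈ Subspace.member S
  decompose S u singles = Subspace.≈-closed S {comb (λ _ → 1#) parts} {u} (λ j x → begin
      κ (comb (λ _ → 1#) parts) j x
        ≈⟨ κ-comb (λ _ → 1#) parts j x ⟩
      sum (λ l → 1# * κ (parts l) j x)
        ≈⟨ sum-cong-≋ (λ l → ≈-trans (*-identityˡ _) (κ-single (from l) (u (from l)) j x)) ⟩
      sum (λ l → δ (to (from l)) (to j) * κ u (from l) x)
        ≈⟨ sum-cong-≋ (λ l → *-congʳ (≈-trans (≈-reflexive (cong (λ l → δ l (to j)) (strictlyInverseˡ l))) (δ-sym l (to j)))) ⟩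
      sum (λ l → δ (to j) l * κ u (from l) x)
        ≈⟨ sum-δ (to j) (λ l → κ u (from l) x) ⟩
      κ u (from (to j)) x
        ≈⟨ ≈-reflexive (cong (λ i → κ u i x) (strictlyInverseʳ j)) ⟩
      κ u j x ∎)
    (comb-closed S (λ _ → 1#) (λ l → singles (from l)))
    where
    parts : Fin N → N.Carrierᴹ
    parts l = single (from l) (u (from l))
    δ-sym : ∀ {d} (i j : Fin d) → δ i j ≈ δ j i
    δ-sym zero    zero    = ≈-refl
    δ-sym zero    (suc j) = ≈-refl
    δ-sym (suc i) zero    = ≈-refl
    δ-sym (suc i) (suc j) = δ-sym i j

  module _ {d} (b : Fin d → N.Carrierᴹ) (T : Fin d → I) (u : Fin d × C → K)
           (b≈ : ∀ j i x → κ (b j) i x ≈ indicator fin (T j) i * u (j , x)) where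

    κ-comb-single : ∀ r i x → κ (comb r b) i x ≈ sum (λ j → r j * (indicator fin (T j) i * u (j , x)))
    κ-comb-single r i x = ≈-trans (κ-comb r b i x) (sum-cong-≋ λ j → *-congˡ (b≈ j i x))

    coordinates⇒independent : Independent̂ fin T u → Independent b
    coordinates⇒independent ind r r≈0 = ind r λ i x → ≈-trans (≈-sym (κ-comb-single r i x)) (r≈0 i x)

    independent⇒coordinates : Independent b → Independent̂ fin T u
    independent⇒coordinates ind r r≈0 = ind r λ i x → ≈-trans (κ-comb-single r i x) (r≈0 i x)

  -- Edges will be graded by their tails, so that vertices and edges have gradings permuted transitively by 𝒢.
  module _ {n} (π : I → Fin n) where

    Graded : Fin n → Pred N.Carrierᴹ (a ⊔ ℓ)
    Graded t h = ∀ j → π j ≢ t → ∀ x → κ h j x ≈ 0#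

    private
      AgreeAt : Fin n → N.Carrierᴹ → N.Carrierᴹ → Set (a ⊔ ℓ)
      AgreeAt t u v = ∀ j → π j ≡ t → ∀ x → κ u j x ≈ κ v j x

      -- Vectors of a degree other than `t` vanish over `t`, so there only the coefficients on the
      -- fibre of `T` over `t` matter.
      graded-combination : ∀ {d} (b : Fin d → N.Carrierᴹ) (T : Fin d → Fin n) → (∀ j → Graded (T j) (b j)) →
        ∀ t (r : Fin d → K) → ∃ λ s → AgreeAt t (comb s (b ∘ fiberAt T t)) (comb r b)
      graded-combination {zero}  b T graded t r = (λ ()) , λ _ _ _ → ≈-refl
      graded-combination {suc d} b T graded t r
        with s , agree ← graded-combination (b ∘ suc) (T ∘ suc) (graded ∘ suc) t (r ∘ suc) =
        append (λ _ → r zero) s , λ j πj≡t x →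
          ≈-trans (cong-append {δℕ (T zero) t} (λ _ → zero) (suc ∘ fiberAt (T ∘ suc) t) s j x)
            (+-cong (once (T zero) t (r zero * κ (b zero) j x) λ T₀≢t →
               ≈-trans (*-congˡ (graded zero j (λ eq → T₀≢t (≡.trans (≡.sym eq) πj≡t)) x)) (zeroʳ _)) (agree j πj≡t x))
        where
        cong-append : ∀ {m m′} (f : Fin m → Fin (suc d)) (f′ : Fin m′ → Fin (suc d)) (s : Fin m′ → K) j x →
          κ (comb (append (λ _ → r zero) s) (b ∘ append f f′)) j x ≈
          sum (λ l → r zero * κ (b (f l)) j x) + κ (comb s (b ∘ f′)) j x
        cong-append {zero}  f f′ s j x = ≈-sym (+-identityˡ _)
        cong-append {suc m} f f′ s j x = ≈-trans (+-congˡ (cong-append (f ∘ suc) f′ s j x)) (≈-sym (+-assoc _ _ _))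
        once : ∀ {n} (i j : Fin n) (y : K) → (i ≢ j → y ≈ 0#) → sum {δℕ i j} (λ _ → y) ≈ y
        once zero    zero    y _   = +-identityʳ y
        once zero    (suc j) y y≈0 = ≈-sym (y≈0 λ ())
        once (suc i) zero    y y≈0 = ≈-sym (y≈0 λ ())
        once (suc i) (suc j) y y≈0 = once i j y (λ i≢j → y≈0 (i≢j ∘ Finₚ.suc-injective))

      -- Coefficients are pushed forward along `f`, and injectivity allows them to be read off again
      -- at `f l`.
      independent-∘ : ∀ {d e} {b : Fin d → N.Carrierᴹ} → Independent b → {f : Fin e → Fin d} → Injective _≡_ _≡_ f →
                      Independent (b ∘ f)
      independent-∘ {d} {e} {b} ind {f} f-inj r r≈0 l = begin
        r l                               ≈⟨ sum-δ l r ⟨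
        sum (λ j → δ l j * r j)           ≈⟨ sum-cong-≋ (λ j → ≈-trans (*-congʳ (δ-swap l j)) (*-comm _ _)) ⟩
        sum (λ j → r j * δ (f j) (f l))   ≈⟨ ind (λ i → sum (λ j → r j * δ (f j) i)) pushed (f l) ⟩
        0#                                ∎
        where
        δ-swap : ∀ l j → δ l j ≈ δ (f j) (f l)
        δ-swap l j with l Finₚ.≟ j
        ... | yes refl = ≈-reflexive (≡.trans (δ-refl l) (≡.sym (δ-refl (f l))))
        ... | no l≢j = ≈-reflexive (≡.trans (δ-≢ l≢j) (≡.sym (δ-≢ (l≢j ∘ ≡.sym ∘ f-inj))))
        pushed : comb (λ i → sum (λ j → r j * δ (f j) i)) b N.≈ᴹ N.0ᴹ
        pushed = N.≈ᴹ-trans {comb (λ i → sum (λ j → r j * δ (f j) i)) b} {comb r (λ j → comb (δ (f j)) b)} {N.0ᴹ}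
          (N.≈ᴹ-sym {comb r (λ j → comb (δ (f j)) b)} {comb (λ i → sum (λ j → r j * δ (f j) i)) b} (comb-comb r (λ j → δ (f j)) b))
          (N.≈ᴹ-trans {comb r (λ j → comb (δ (f j)) b)} {comb r (b ∘ f)} {N.0ᴹ}
            (comb-cong {e} {r} {r} {λ j → comb (δ (f j)) b} {b ∘ f} (λ _ → ≈-refl) (λ j → comb-δ b (f j))) r≈0)

    -- In each degree separately, the vectors of `b′` lie in the span of those of `b`, and the
    -- exchange lemma applies.
    fiberSize-≤ : ∀ {d d′} (b : Fin d → N.Carrierᴹ) (T : Fin d → Fin n) → (∀ j → Graded (T j) (b j)) →
                  (b′ : Fin d′ → N.Carrierᴹ) (T′ : Fin d′ → Fin n) → (∀ j → Graded (T′ j) (b′ j)) →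
                  Independent b′ → (∀ j → b′ j ∈ Span b) → ∀ t → fiberSize T′ t ≤ fiberSize T t
    fiberSize-≤ b T graded b′ T′ graded′ ind b′∈b t = steinitz (b ∘ fiberAt T t) (b′ ∘ fiberAt T′ t) spans
      (independent-∘ {b = b′} ind (fiberAt-injective T′ t))
      where
      spans : ∀ l → b′ (fiberAt T′ t l) ∈ Span (b ∘ fiberAt T t)
      spans l with r , r≈ ← b′∈b (fiberAt T′ t l)
        with s , agree ← graded-combination b T graded t r = s , eq
        where
        eq : ∀ j x → κ (comb s (b ∘ fiberAt T t)) j x ≈ κ (b′ (fiberAt T′ t l)) j x
        eq j x with π j Finₚ.≟ t
        ... | yes πj≡t = ≈-trans (agree j πj≡t x) (r≈ j x)
        ... | no πj≢t = ≈-trans (κ-comb s (b ∘ fiberAt T t) j x) (≈-trans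
          (sum-zero λ i → ≈-trans (*-congˡ (graded (fiberAt T t i) j (λ e → πj≢t (≡.trans e (fiberAt-fiber T t i))) x)) (zeroʳ _))
          (≈-sym (graded′ (fiberAt T′ t l) j (λ e → πj≢t (≡.trans e (fiberAt-fiber T′ t l))) x)))

-- Homogeneous bases for subspaces of the sheaf

module SheafExcess {a c ℓ} (𝔽 : CommutativeRing c ℓ) (isField : IsField 𝔽)
         (closed : IsAlgebraicallyClosed 𝔽) (em : ExcludedMiddle (a ⊔ c ⊔ ℓ))
         (𝒢 : FiniteGroup a) (g : Fin 2 → FiniteGroup.Carrier 𝒢)
         (L : Subgraph (CayleyBigraph 𝒢 g)) (k : ℕ) (M : Matrix 𝔽 𝒢 g L k) where

  open FieldLemmas 𝔽 isField (lower-em ℓ (a ⊔ c ⊔ ℓ) em)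
  open Profiles 𝔽 isField closed em 𝒢 g L k
  open FiniteGroup 𝒢 using (order; finite) renaming (Carrier to C)
  open FiniteGraph (CayleyBigraph 𝒢 g) using (Edge; head; tail; V-finite; E-finite; ∣V∣; ∣E∣; _≟_)

  ℱ = 𝒦 𝔽 𝒢 g L k M

  module V = DirectSum 𝔽 isField closed em 𝒢 g L k V-finite (λ v → 𝒦-space 𝔽 𝒢 g L k M (inj₁ v))
  module E = DirectSum 𝔽 isField closed em 𝒢 g L k E-finite (λ e → 𝒦-space 𝔽 𝒢 g L k M (inj₂ e))

  SubspaceV : Set (lsuc (a ⊔ c ⊔ ℓ))
  SubspaceV = Subspace 𝔽 (ℱ[V] 𝔽 ℱ) (a ⊔ c ⊔ ℓ)

  SectionE : Edge → Set (a ⊔ c ⊔ ℓ)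
  SectionE e = Σ (C → K) (In M (inj₂ e))

  κ-ι : ∀ v f v′ x → V.κ (ι 𝔽 ℱ v f) v′ x ≈ 𝟙 v v′ * proj₁ f x
  κ-ι v f v′ x with v ≟ v′
  ... | yes refl = ≈-sym (≈-trans (*-congʳ (≈-reflexive (V.indicator-diagonal v))) (*-identityˡ _))
  ... | no v≢v′ = ≈-sym (≈-trans (*-congʳ (≈-reflexive (V.indicator-off v≢v′))) (zeroˡ _))

  module _ (U : SubspaceV) where
    private module U = Subspace U

    -- Quantifying over all h with these coordinates makes the proofs of membership in the stalks irrelevant.
    BothIn : Edge → (C → K) → Set (a ⊔ c ⊔ ℓ)
    BothIn e f = ∀ (v : C) → v ≡ head e ⊎ v ≡ tail e → ∀ h → (∀ v′ x → V.κ h v′ x ≈ 𝟙 v v′ * f x) → h ∈ U.member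

    private
      toBoth : ∀ {e} (f : SectionE e) → dʰ 𝔽 ℱ e f ∈ U.member × dᵗ 𝔽 ℱ e f ∈ U.member → BothIn e (proj₁ f)
      toBoth f (h∈ , t∈) v (inj₁ refl) h h≈ = U.≈-closed (λ v′ x → ≈-trans (κ-ι _ _ v′ x) (≈-sym (h≈ v′ x))) h∈
      toBoth f (h∈ , t∈) v (inj₂ refl) h h≈ = U.≈-closed (λ v′ x → ≈-trans (κ-ι _ _ v′ x) (≈-sym (h≈ v′ x))) t∈

      fromBoth : ∀ {e} (f : SectionE e) → BothIn e (proj₁ f) → dʰ 𝔽 ℱ e f ∈ U.member × dᵗ 𝔽 ℱ e f ∈ U.member
      fromBoth f both = both _ (inj₁ refl) _ (κ-ι _ _) , both _ (inj₂ refl) _ (κ-ι _ _)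

      Both-cong : ∀ {e f f′} → (∀ x → f x ≈ f′ x) → BothIn e f → BothIn e f′
      Both-cong f≈f′ both v v∈ h h≈ = both v v∈ h λ v′ x → ≈-trans (h≈ v′ x) (*-congˡ (≈-sym (f≈f′ x)))

    Γ : Subspace 𝔽 (ℱ[E] 𝔽 ℱ) (a ⊔ c ⊔ ℓ)
    Γ = record
      { member = Γʰᵗ 𝔽 ℱ U.member
      ; ≈-closed = λ {w} {w′} w≈w′ w∈ e → fromBoth (w′ e) (Both-cong (w≈w′ e) (toBoth (w e) (w∈ e)))
      ; 0-closed = λ e → zero-in (head e) , zero-in (tail e)
      ; +-closed = λ {w} {w′} w∈ w′∈ e →
          sum-in (head e) (proj₁ (w∈ e)) (proj₁ (w′∈ e)) , sum-in (tail e) (proj₂ (w∈ e)) (proj₂ (w′∈ e))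
      ; *ₗ-closed = λ t {w} w∈ e → scale-in (head e) t (proj₁ (w∈ e)) , scale-in (tail e) t (proj₂ (w∈ e))
      }
      where
      zero-in : ∀ v {p} → ι 𝔽 ℱ v ((λ _ → 0#) , p) ∈ U.member
      zero-in v = U.≈-closed (λ v′ x → ≈-sym (≈-trans (κ-ι v _ v′ x) (zeroʳ _))) U.0-closed
      sum-in : ∀ v {f f′ p p′ p″} → ι 𝔽 ℱ v (f , p) ∈ U.member → ι 𝔽 ℱ v (f′ , p′) ∈ U.member →
               ι 𝔽 ℱ v ((λ x → f x + f′ x) , p″) ∈ U.member
      sum-in v f∈ f′∈ = U.≈-closed (λ v′ x → ≈-trans (+-cong (κ-ι v _ v′ x) (κ-ι v _ v′ x))
        (≈-trans (≈-sym (distribˡ _ _ _)) (≈-sym (κ-ι v _ v′ x)))) (U.+-closed f∈ f′∈)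
      scale-in : ∀ v t {f p p′} → ι 𝔽 ℱ v (f , p) ∈ U.member → ι 𝔽 ℱ v ((λ x → t * f x) , p′) ∈ U.member
      scale-in v t {f} f∈ = U.≈-closed (λ v′ x → ≈-trans (*-congˡ (κ-ι v _ v′ x))
        (≈-trans (≈-sym (*-assoc _ _ _)) (≈-trans (*-congʳ (*-comm _ _)) (≈-trans (*-assoc _ _ _) (≈-sym (κ-ι v _ v′ x))))))
        (U.*ₗ-closed t f∈)

    homogeneous-∈Γ : ∀ {e h} → E.Homogeneous e h → BothIn e (E.κ h e) → h ∈ Subspace.member Γ
    homogeneous-∈Γ {e} {h} hom both e′ with e E.≟ᴵ e′
    ... | yes refl = fromBoth (h e) both
    ... | no e≢e′ = fromBoth (h e′) λ v _ h′ h′≈ → U.≈-closed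
            (λ v′ x → ≈-sym (≈-trans (h′≈ v′ x) (≈-trans (*-congˡ (hom e′ (e≢e′ ∘ ≡.sym) x)) (zeroʳ _)))) U.0-closed

    ∈Γ-BothIn : ∀ {w} → w ∈ Subspace.member Γ → ∀ e → BothIn e (E.κ w e)
    ∈Γ-BothIn {w} w∈ e = toBoth (w e) (w∈ e)

    single-∈Γ : ∀ {w} → w ∈ Subspace.member Γ → ∀ e → E.single e (w e) ∈ Subspace.member Γ
    single-∈Γ {w} w∈ e = homogeneous-∈Γ {h = E.single e (w e)} (E.single-homogeneous e (w e)) (Both-cong
      (λ x → ≈-sym (≈-trans (E.κ-single e (w e) e x) (≈-trans (*-congʳ (≈-reflexive (E.indicator-diagonal e))) (*-identityˡ _))))
      (∈Γ-BothIn {w} w∈ e))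

  Γ-mono : ∀ {U U′ : SubspaceV} → Subspace.member U ⊆ Subspace.member U′ → Subspace.member (Γ U) ⊆ Subspace.member (Γ U′)
  Γ-mono U⊆U′ w∈ e = U⊆U′ (proj₁ (w∈ e)) , U⊆U′ (proj₂ (w∈ e))

  -- A profile in the language of the sheaf, where the linear algebra applies. The family `s` need
  -- not span `Γ (V.span b)`, so `e` is only a lower bound for its dimension.
  record HomogeneousPair {d e} (τ : Fin d → C) (σ : Fin e → Edge) : Set (lsuc (a ⊔ c ⊔ ℓ)) where
    field
      b     : Fin d → V.N.Carrierᴹ
      s     : Fin e → E.N.Carrierᴹ
      b-hom : ∀ j → V.Homogeneous (τ j) (b j)
      s-hom : ∀ j → E.Homogeneous (σ j) (s j)
      b-ind : V.Independent b
      s-ind : E.Independent s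
      s∈Γ   : ∀ j → s j ∈ Subspace.member (Γ (V.span b))

    dim-span : HasDimension 𝔽 (ℱ[V] 𝔽 ℱ) (V.Span b) d
    dim-span = record { basis = b ; basis∈W = V.∈-span b ; independent = b-ind ; spanning = λ _ w∈ → w∈ }

  pair⇒profile : ∀ {d e} {τ : Fin d → C} {σ : Fin e → Edge} → HomogeneousPair τ σ → Profile τ σ M
  pair⇒profile {τ = τ} {σ} pair = u , w , solution
    (λ j → proj₂ (b j (τ j)))
    (λ j → proj₂ (s j (σ j)))
    (V.independent⇒coordinates b τ u b≈ b-ind)
    (E.independent⇒coordinates s σ w (λ j → E.homogeneous-κ {h = s j} (s-hom j)) s-ind)
    (λ j → restriction j (head (σ j)) (s j (σ j)) (proj₁ (s∈Γ j (σ j))))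
    (λ j → restriction j (tail (σ j)) (s j (σ j)) (proj₂ (s∈Γ j (σ j))))
    where
    open HomogeneousPair pair
    u : Fin _ × C → K
    u (j , x) = V.κ (b j) (τ j) x
    w : Fin _ × C → K
    w (j , x) = E.κ (s j) (σ j) x
    b≈ : ∀ j v x → V.κ (b j) v x ≈ 𝟙 (τ j) v * u (j , x)
    b≈ j = V.homogeneous-κ {h = b j} (b-hom j)
    restriction : ∀ j v (f : SectionE (σ j)) {p} → ι 𝔽 ℱ v (proj₁ f , p) ∈ V.Span b → Span̂ τ u v (proj₁ f)
    restriction j v f (r , r≈) = r , λ v′ x →
      ≈-trans (≈-sym (V.κ-comb-single b τ u b≈ r v′ x)) (≈-trans (r≈ v′ x) (κ-ι v _ v′ x))

  profile⇒pair : ∀ {d e} {τ : Fin d → C} {σ : Fin e → Edge} → Profile τ σ M → HomogeneousPair τ σ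
  profile⇒pair {τ = τ} {σ} (u , w , solution u∈ w∈ u-ind w-ind heads tails) = record
    { b = b ; s = s
    ; b-hom = λ j → V.single-homogeneous (τ j) _ ; s-hom = λ j → E.single-homogeneous (σ j) _
    ; b-ind = V.coordinates⇒independent b τ u b≈ u-ind
    ; s-ind = E.coordinates⇒independent s σ w s≈ w-ind
    ; s∈Γ = λ j → homogeneous-∈Γ (V.span b) {h = s j} (E.single-homogeneous (σ j) _) (both j)
    }
    where
    b : Fin _ → V.N.Carrierᴹ
    b j = V.single (τ j) ((λ x → u (j , x)) , u∈ j)
    s : Fin _ → E.N.Carrierᴹ
    s j = E.single (σ j) ((λ x → w (j , x)) , w∈ j)
    b≈ : ∀ j v x → V.κ (b j) v x ≈ 𝟙 (τ j) v * u (j , x)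
    b≈ j = V.κ-single (τ j) _
    s≈ : ∀ j e x → E.κ (s j) e x ≈ indicator E-finite (σ j) e * w (j , x)
    s≈ j = E.κ-single (σ j) _
    s-diagonal : ∀ j x → E.κ (s j) (σ j) x ≈ w (j , x)
    s-diagonal j x = ≈-trans (s≈ j (σ j) x) (≈-trans (*-congʳ (≈-reflexive (E.indicator-diagonal (σ j)))) (*-identityˡ _))
    in-span : ∀ {v} j → Span̂ τ u v (λ x → w (j , x)) → ∀ h → (∀ v′ x → V.κ h v′ x ≈ 𝟙 v v′ * E.κ (s j) (σ j) x) → h ∈ V.Span b
    in-span j (r , r≈) h h≈ = r , λ v′ x → ≈-trans (V.κ-comb-single b τ u b≈ r v′ x)
      (≈-trans (r≈ v′ x) (≈-trans (*-congˡ (≈-sym (s-diagonal j x))) (≈-sym (h≈ v′ x))))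
    both : ∀ j → BothIn (V.span b) (σ j) (E.κ (s j) (σ j))
    both j v (inj₁ refl) = in-span j (heads j)
    both j v (inj₂ refl) = in-span j (tails j)

  -- This leaves finitely many pairs of lists that can be profiles of any matrix, so that the
  -- corresponding open sets can be intersected.
  profile-bounded : ∀ {d e} {τ : Fin d → C} {σ : Fin e → Edge} → Profile τ σ M → d ≤ ∣V∣ ℕ.* order × e ≤ ∣E∣ ℕ.* order
  profile-bounded profile = V.bounded _ b b-ind , E.bounded _ s s-ind
    where open HomogeneousPair (profile⇒pair profile)

  record Homogenization (U : SubspaceV) : Set (lsuc (a ⊔ c ⊔ ℓ)) where
    field
      {d e}    : ℕ
      τ        : Fin d → C
      σ        : Fin e → Edge
      pair     : HomogeneousPair τ σ
    open HomogeneousPair pair public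
    field
      b∈U      : ∀ j → b j ∈ Subspace.member U
      Γ-spanned : ∀ w → w ∈ Subspace.member (Γ U) → w ∈ E.Span s

    span⊆U : V.Span b ⊆ Subspace.member U
    span⊆U {x} = V.Span-⊆ U {b = b} b∈U {x}

    dim-Γ-span : HasDimension 𝔽 (ℱ[E] 𝔽 ℱ) (Subspace.member (Γ (V.span b))) e
    dim-Γ-span = record
      { basis = s ; basis∈W = s∈Γ ; independent = s-ind
      ; spanning = λ w w∈ → Γ-spanned w (Γ-mono {V.span b} {U} (λ {x} → span⊆U {x}) {w} w∈) }

    dim-Γ-≤ : ∀ {n} → HasDimension 𝔽 (ℱ[E] 𝔽 ℱ) (Subspace.member (Γ U)) n → n ≤ e
    dim-Γ-≤ dim = E.steinitz s basis (λ i → Γ-spanned (basis i) (basis∈W i)) independent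
      where open HasDimension dim

  -- Γʰᵗ(U) only involves the intersections of U with the summands, so U may be replaced by their sum.
  homogenize : ∀ U → Homogenization U
  homogenize U = record
    { τ = λ j → proj₁ (proj₁ (proj₁ (proj₂ (proj₂ basisV)) j))
    ; σ = λ j → proj₁ (proj₁ (proj₁ (proj₂ (proj₂ basisE)) j))
    ; pair = record
      { b = b ; s = s
      ; b-hom = λ j → proj₂ (proj₁ (b∈H j)) ; s-hom = λ j → proj₂ (proj₁ (s∈H j))
      ; b-ind = proj₁ (proj₂ (proj₂ (proj₂ basisV))) ; s-ind = proj₁ (proj₂ (proj₂ (proj₂ basisE)))
      ; s∈Γ = λ j → homogeneous-∈Γ (V.span b) {h = s j} (proj₂ (proj₁ (s∈H j))) (λ v v∈ h h≈ →
          H⊆span h ((v , λ v′ v′≢v x → ≈-trans (h≈ v′ x) (≈-trans (*-congʳ (≈-reflexive (V.indicator-off (v′≢v ∘ ≡.sym)))) (zeroˡ _))) ,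
            ∈Γ-BothIn U {s j} (proj₂ (s∈H j)) _ v v∈ h h≈))
      }
    ; b∈U = λ j → proj₂ (b∈H j)
    ; Γ-spanned = λ w w∈ → E.decompose (E.span s) w λ e →
        proj₂ (proj₂ (proj₂ (proj₂ basisE))) (E.single e (w e)) ((e , E.single-homogeneous e (w e)) , single-∈Γ U {w} w∈ e)
    }
    where
    -- A union of subspaces rather than a subspace: `extend` picks from it a basis of the sum of the
    -- intersections of `U` with the stalks.
    HV : Pred V.N.Carrierᴹ (a ⊔ c ⊔ ℓ)
    HV h = (∃ λ v → V.Homogeneous v h) × h ∈ Subspace.member U
    HE : Pred E.N.Carrierᴹ (a ⊔ c ⊔ ℓ)
    HE h = (∃ λ e → E.Homogeneous e h) × h ∈ Subspace.member (Γ U)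
    extendV = V.extend V.bounded HV {0} (λ ()) (λ _ _ ())
    extendE = E.extend E.bounded HE {0} (λ ()) (λ _ _ ())
    basisV : ∃ λ d → ∃ λ (b : Fin d → V.N.Carrierᴹ) → (∀ j → b j ∈ HV) × V.Independent b × (∀ h → h ∈ HV → h ∈ V.Span b)
    basisV = _ , append (proj₁ (proj₂ extendV)) (λ ()) ,
      append-all HV {f = proj₁ (proj₂ extendV)} {g = λ ()} (proj₁ (proj₂ (proj₂ extendV))) (λ ()) , proj₂ (proj₂ (proj₂ extendV))
    basisE : ∃ λ d → ∃ λ (s : Fin d → E.N.Carrierᴹ) → (∀ j → s j ∈ HE) × E.Independent s × (∀ h → h ∈ HE → h ∈ E.Span s)
    basisE = _ , append (proj₁ (proj₂ extendE)) (λ ()) ,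
      append-all HE {f = proj₁ (proj₂ extendE)} {g = λ ()} (proj₁ (proj₂ (proj₂ extendE))) (λ ()) , proj₂ (proj₂ (proj₂ extendE))
    b = proj₁ (proj₂ basisV)
    s = proj₁ (proj₂ basisE)
    b∈H = proj₁ (proj₂ (proj₂ basisV))
    s∈H = proj₁ (proj₂ (proj₂ basisE))
    H⊆span = proj₂ (proj₂ (proj₂ (proj₂ basisV)))

-- Differences of natural numbers and extremal elements

⊖-+ : ∀ m n o → (m ⊖ n) ℤ.+ + (n ℕ.+ o) ≡ + (m ℕ.+ o)
⊖-+ m n o = ≡.trans (ℤₚ.distribˡ-⊖-+-pos (n ℕ.+ o) m n)
  (≡.trans (cong₂ _⊖_ (≡.trans (≡.sym (ℕₚ.+-assoc m n o)) (≡.trans (cong (ℕ._+ o) (ℕₚ.+-comm m n)) (ℕₚ.+-assoc n m o)))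
                      (≡.sym (ℕₚ.+-identityʳ n)))
    (ℤₚ.+-cancelˡ-⊖ n (m ℕ.+ o) 0))

⊖≤⊖⇒+≤+ : ∀ {m n o r} → m ⊖ n ℤ.≤ o ⊖ r → m ℕ.+ r ≤ o ℕ.+ n
⊖≤⊖⇒+≤+ {m} {n} {o} {r} le = ℤₚ.drop‿+≤+ (≡.subst₂ ℤ._≤_ (⊖-+ m n r)
  (≡.trans (cong (λ s → (o ⊖ r) ℤ.+ + s) (ℕₚ.+-comm n r)) (⊖-+ o r n)) (ℤₚ.+-monoˡ-≤ (+ (n ℕ.+ r)) le))

+≤+⇒⊖≤⊖ : ∀ {m n o r} → m ℕ.+ r ≤ o ℕ.+ n → m ⊖ n ℤ.≤ o ⊖ r
+≤+⇒⊖≤⊖ {m} {n} {o} {r} le = ℤₚ.≮⇒≥ λ lt → ℕₚ.<⇒≱ (ℤₚ.drop‿+<+ (≡.subst₂ ℤ._<_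
  (≡.trans (cong (λ s → (o ⊖ r) ℤ.+ + s) (ℕₚ.+-comm n r)) (⊖-+ o r n)) (⊖-+ m n r)
  (ℤₚ.+-monoˡ-< (+ (n ℕ.+ r)) lt))) le

⊖-divisible : ∀ n t t′ → + n ∣ (n ℕ.* t ⊖ n ℕ.* t′)
⊖-divisible n t t′ with ℕₚ.≤-total t′ t
... | inj₁ t′≤t = ℕDiv.divides (t ∸ t′) (≡.trans (cong ℤ.∣_∣ (ℤₚ.⊖-≥ (ℕₚ.*-monoʳ-≤ n t′≤t)))
        (≡.trans (≡.sym (ℕₚ.*-distribˡ-∸ n t t′)) (ℕₚ.*-comm n (t ∸ t′))))
... | inj₂ t≤t′ = ℕDiv.divides (t′ ∸ t) (≡.trans (ℤₚ.∣⊖∣-≤ (ℕₚ.*-monoʳ-≤ n t≤t′))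
        (≡.trans (≡.sym (ℕₚ.*-distribˡ-∸ n t′ t)) (ℕₚ.*-comm n (t′ ∸ t))))

module _ (em : ExcludedMiddle p) where

  largest-exists : (P : Pred ℤ p) → ∀ {m n} → P (m ⊖ n) → ∀ B → (∀ i → P i → i ℤ.≤ + B) → ∃ (IsLargest P)
  -- The bound `+ B` exceeds `m ⊖ n` by at most `n ℕ.+ B`, so this much fuel covers every possible
  -- chain of increases.
  largest-exists P {m} {n} Pmn B bound = go (n ℕ.+ B) (m ⊖ n) Pmn
    (subst (+ B ℤ.≤_) (≡.sym (⊖-+ m n B)) (ℤ.+≤+ (ℕₚ.m≤n+m B m)))
    where
    go : ∀ fuel i → P i → + B ℤ.≤ i ℤ.+ + fuel → ∃ (IsLargest P)
    go zero i Pi le = i , Pi , λ j Pj → ℤₚ.≤-trans (bound j Pj) (subst (+ B ℤ.≤_) (ℤₚ.+-identityʳ i) le)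
    go (suc fuel) i Pi le with em {∃ λ j → P j × i ℤ.< j}
    ... | no none = i , Pi , λ j Pj → ℤₚ.≮⇒≥ λ i<j → none (j , Pj , i<j)
    ... | yes (j , Pj , i<j) = go fuel j Pj (ℤₚ.≤-trans le
            (subst (ℤ._≤ j ℤ.+ + fuel) (≡.trans (cong (ℤ._+ + fuel) (ℤₚ.+-comm (+ 1) i)) (ℤₚ.+-assoc i (+ 1) (+ fuel)))
              (ℤₚ.+-monoˡ-≤ (+ fuel) (ℤₚ.i<j⇒suc[i]≤j i<j))))

  least-exists : (P : Pred ℕ p) → ∀ {n} → P n → ∃ λ d → P d × (∀ d′ → P d′ → d ≤ d′)
  least-exists P {n} Pn = go n Pn ℕₚ.≤-refl
    where
    go : ∀ fuel {n} → P n → n ≤ fuel → ∃ λ d → P d × (∀ d′ → P d′ → d ≤ d′)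
    go zero Pn z≤n = 0 , Pn , λ _ _ → z≤n
    go (suc fuel) {n} Pn n≤ with em {∃ λ d → P d × d < n}
    ... | no none = n , Pn , λ d Pd → ℕₚ.≮⇒≥ λ d<n → none (d , Pd , d<n)
    ... | yes (d , Pd , d<n) = go fuel Pd (ℕₚ.≤-pred (ℕₚ.≤-trans d<n n≤))

-- The maximizer of least dimension and divisibility

module MaximumExcess {a c ℓ} (𝔽 : CommutativeRing c ℓ) (isField : IsField 𝔽)
         (closed : IsAlgebraicallyClosed 𝔽) (em : ExcludedMiddle (lsuc (a ⊔ c ⊔ ℓ)))
         (𝒢 : FiniteGroup a) (g : Fin 2 → FiniteGroup.Carrier 𝒢)
         (L : Subgraph (CayleyBigraph 𝒢 g)) (k : ℕ) (M : Matrix 𝔽 𝒢 g L k) where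

  em′ : ExcludedMiddle (a ⊔ c ⊔ ℓ)
  em′ = lower-em (a ⊔ c ⊔ ℓ) (lsuc (a ⊔ c ⊔ ℓ)) em

  open Profiles 𝔽 isField closed em′ 𝒢 g L k
  open SheafExcess 𝔽 isField closed em′ 𝒢 g L k M public
  open FiniteGroup 𝒢 using (order; finite; isGroup; assoc; _∙_; _⁻¹; ε) renaming (Carrier to C)
  open FiniteGraph (CayleyBigraph 𝒢 g) using (Edge; tail; ∣E∣)
  open Fibers
  open Inverse finite using (to; from; strictlyInverseˡ; strictlyInverseʳ)

  HasDimΓ : SubspaceV → ℕ → Set (a ⊔ c ⊔ ℓ)
  HasDimΓ U = HasDimension 𝔽 (ℱ[E] 𝔽 ℱ) (Subspace.member (Γ U))

  HasDim : SubspaceV → ℕ → Set (a ⊔ c ⊔ ℓ)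
  HasDim U = HasDimension 𝔽 (ℱ[V] 𝔽 ℱ) (Subspace.member U)

  -- The zero subspace provides a starting value, and every excess is at most the bound on
  -- independent families over the edges.
  maximum-exists : ∃ (IsMaximumExcess 𝔽 ℱ)
  maximum-exists = largest-exists em (λ n → ∃ λ (U : SubspaceV) → HasExcess 𝔽 ℱ U n)
    {proj₁ dimΓ} {proj₁ dim} (U₀ , _ , _ , proj₂ dimΓ , proj₂ dim , refl) (∣E∣ ℕ.* order)
    λ { _ (U , dΓ , dU , dimΓ , _ , refl) → ℤₚ.≤-trans (ℤₚ.m⊖n≤m dΓ dU)
          (ℤ.+≤+ (E.bounded dΓ (HasDimension.basis dimΓ) (HasDimension.independent dimΓ))) }
    where
    U₀ : SubspaceV
    U₀ = V.span {0} (λ ())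
    dimΓ = E.dimension E.bounded (Subspace.member (Γ U₀))
    dim = V.dimension V.bounded (Subspace.member U₀)

  module _ {m : ℤ} (max : IsMaximumExcess 𝔽 ℱ m) where

    excess-≤ : ∀ U {dΓ d} → HasDimΓ U dΓ → HasDim U d → dΓ ⊖ d ℤ.≤ m
    excess-≤ U dimΓ dim = proj₂ max _ (U , _ , _ , dimΓ , dim , refl)

    profile-excess : ∀ {d e} {τ : Fin d → C} {σ : Fin e → Edge} → Profile τ σ M → e ⊖ d ℤ.≤ m
    profile-excess {d} profile = ℤₚ.≤-trans (ℤₚ.⊖-monoˡ-≤ d (E.dimension-bound (proj₂ dimΓ) s s∈Γ s-ind))
      (excess-≤ (V.span b) (proj₂ dimΓ) dim-span)
      where
      open HomogeneousPair (profile⇒pair profile)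
      dimΓ = E.dimension E.bounded (Subspace.member (Γ (V.span b)))

    -- Homogenizing a maximizer keeps the dimension of its sections over the edges without enlarging
    -- the subspace, so no excess is lost.
    maximal-profile : ∃ λ d → ∃ λ e → ∃ λ (τ : Fin d → C) → ∃ λ (σ : Fin e → Edge) → Profile τ σ M × m ℤ.≤ e ⊖ d
    maximal-profile with U , dΓ , dU , dimΓ , dim , refl ← proj₁ max = d , e , τ , σ , pair⇒profile pair ,
      +≤+⇒⊖≤⊖ {dΓ} {dU} {e} {d} (ℕₚ.+-mono-≤ (dim-Γ-≤ dimΓ) (V.dimension-bound dim b b∈U b-ind))
      where open Homogenization (homogenize U)

    Optimal : Pred ℕ (lsuc (a ⊔ c ⊔ ℓ))
    Optimal d = ∃ λ (U : SubspaceV) → ∃ λ dΓ → HasDimΓ U dΓ × HasDim U d × m ≡ dΓ ⊖ d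

    -- Here U′ is a maximizer as well, and so is U ∩ U′, whose dimension is therefore at least that of U′.
    module _ (U U′ : SubspaceV) {d e e′ : ℕ} (dimΓ : HasDimΓ U e) (dim : HasDim U d) (m≡ : m ≡ e ⊖ d)
             (dimΓ′ : HasDimΓ U′ e′) (dim′ : HasDim U′ d) (e≤e′ : e ≤ e′) (least : ∀ d′ → Optimal d′ → d ≤ d′) where

      private
        U∩ = V.intersection U U′
        U+ = V.addition U U′
        modular = V.modular V.bounded U U′ dim dim′
        modularΓ = E.modular E.bounded (Γ U) (Γ U′) dimΓ dimΓ′
        i = proj₁ modular
        t = proj₁ (proj₂ modular)
        dim∩ = proj₁ (proj₂ (proj₂ modular))
        dim+ = proj₁ (proj₂ (proj₂ (proj₂ modular)))
        i+t≡ = proj₂ (proj₂ (proj₂ (proj₂ modular)))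
        γi = proj₁ modularΓ
        γt = proj₁ (proj₂ modularΓ)
        γi+γt≡ = proj₂ (proj₂ (proj₂ (proj₂ modularΓ)))
        dimΓ∩ : HasDimΓ U∩ γi
        dimΓ∩ = E.dimension-resp {W = Γ U E.∩ˢ Γ U′} {W′ = Subspace.member (Γ U∩)}
          (λ (w∈ , w∈′) e → (proj₁ (w∈ e) , proj₁ (w∈′ e)) , (proj₂ (w∈ e) , proj₂ (w∈′ e)))
          (λ w∈ → (λ e → proj₁ (proj₁ (w∈ e)) , proj₁ (proj₂ (w∈ e))) , (λ e → proj₂ (proj₁ (w∈ e)) , proj₂ (proj₂ (w∈ e))))
          (proj₁ (proj₂ (proj₂ modularΓ)))
        dimΓ+ = E.dimension E.bounded (Subspace.member (Γ U+))
        -- Only an inequality, since `Γ` of a sum may be larger than the sum of the two `Γ`.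
        γt≤ : γt ≤ proj₁ dimΓ+
        γt≤ = E.dimension-mono {W = Γ U E.+ˢ Γ U′} {W′ = Subspace.member (Γ U+)}
          (λ {x} (y , z , y∈ , z∈ , y+z≈x) → Subspace.≈-closed (Γ U+) {y E.N.+ᴹ z} {x} y+z≈x (Subspace.+-closed (Γ U+) {y} {z}
            (Γ-mono {U} {U+} (λ {h} h∈ → h , V.N.0ᴹ , h∈ , Subspace.0-closed U′ , V.N.+ᴹ-identityʳ h) {y} y∈)
            (Γ-mono {U′} {U+} (λ {h} h∈ → V.N.0ᴹ , h , Subspace.0-closed U , h∈ , V.N.+ᴹ-identityˡ h) {z} z∈)))
          (proj₁ (proj₂ (proj₂ (proj₂ modularΓ)))) (proj₂ dimΓ+)
        ∩≤ : γi ℕ.+ d ≤ e ℕ.+ i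
        ∩≤ = ⊖≤⊖⇒+≤+ {γi} {i} {e} {d} (subst (γi ⊖ i ℤ.≤_) m≡ (excess-≤ U∩ dimΓ∩ dim∩))
        +≤ : γt ℕ.+ d ≤ e ℕ.+ t
        +≤ = ℕₚ.≤-trans (ℕₚ.+-monoˡ-≤ d γt≤) (⊖≤⊖⇒+≤+ {proj₁ dimΓ+} {t} {e} {d} (subst (proj₁ dimΓ+ ⊖ t ℤ.≤_) m≡ (excess-≤ U+ (proj₂ dimΓ+) dim+)))
        interchange : ∀ w x y z → (w ℕ.+ x) ℕ.+ (y ℕ.+ z) ≡ (w ℕ.+ y) ℕ.+ (x ℕ.+ z)
        interchange = solve-∀
        -- The modular law gives `γi + γt = e + e′`, which is at least twice `e`, and
        -- `i + t = d + d`. As the sum accounts for an excess of at most `e ⊖ d`, at least that much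
        -- remains for the intersection.
        ∩≥ : e ℕ.+ i ≤ γi ℕ.+ d
        ∩≥ = ℕₚ.+-cancelʳ-≤ (γt ℕ.+ d) (e ℕ.+ i) (γi ℕ.+ d) (begin
          (e ℕ.+ i) ℕ.+ (γt ℕ.+ d)  ≤⟨ ℕₚ.+-monoʳ-≤ (e ℕ.+ i) +≤ ⟩
          (e ℕ.+ i) ℕ.+ (e ℕ.+ t)   ≡⟨ interchange e i e t ⟩
          (e ℕ.+ e) ℕ.+ (i ℕ.+ t)   ≡⟨ cong ((e ℕ.+ e) ℕ.+_) i+t≡ ⟩
          (e ℕ.+ e) ℕ.+ (d ℕ.+ d)   ≤⟨ ℕₚ.+-monoˡ-≤ (d ℕ.+ d) (ℕₚ.+-monoʳ-≤ e e≤e′) ⟩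
          (e ℕ.+ e′) ℕ.+ (d ℕ.+ d)  ≡⟨ cong (ℕ._+ (d ℕ.+ d)) γi+γt≡ ⟨
          (γi ℕ.+ γt) ℕ.+ (d ℕ.+ d) ≡⟨ interchange γi γt d d ⟩
          (γi ℕ.+ d) ℕ.+ (γt ℕ.+ d) ∎)
          where open ℕₚ.≤-Reasoning

      least-maximizer-⊆ : Subspace.member U′ ⊆ Subspace.member U
      least-maximizer-⊆ {h} h∈ = proj₁ (V.⊆-full-dimension (U V.∩ˢ U′) (Subspace.member U′) proj₂
        (λ {b} b∈ {x} → V.Span-⊆ U∩ {b = b} b∈ {x}) dim∩ dim′
        (least i (U∩ , γi , dimΓ∩ , dim∩ , ≡.trans m≡ (ℤₚ.≤-antisym (+≤+⇒⊖≤⊖ {e} {d} {γi} {i} ∩≥) (+≤+⇒⊖≤⊖ {γi} {i} {e} {d} ∩≤)))) {h} h∈)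

    private
      group : Group a a
      group = record { isGroup = isGroup }
      open GroupProperties group using (∙-cancelʳ)
      open Group group using (inverseʳ; identityˡ)

      shift : C → Fin order → Fin order
      shift y l = to (from l ∙ y)

      shift-injective : ∀ y → Injective _≡_ _≡_ (shift y)
      shift-injective y eq = ≡.trans (≡.sym (strictlyInverseˡ _)) (≡.trans (cong to (∙-cancelʳ y _ _ (↔-injective finite eq))) (strictlyInverseˡ _))

      shift-transitive : ∀ l l′ → shift (from l ⁻¹ ∙ from l′) l ≡ l′
      shift-transitive l l′ = ≡.trans (cong to (≡.trans (≡.sym (assoc _ _ _))
        (≡.trans (cong (_∙ from l′) (inverseʳ (from l))) (identityˡ (from l′))))) (strictlyInverseˡ l′)

      -- The action is transitive, so the inequality can be applied from any group element to any
      -- other and back, and all fibres have the same size.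
      equal-fibers : ∀ {d} (T : Fin d → C) →
        (∀ y l → fiberSize (λ j → to (T j ∙ y)) l ≤ fiberSize (λ j → to (T j)) l) → ∃ λ t → d ≡ order ℕ.* t
      equal-fibers T le = _ , fibers-equal (to ∘ T) (fiberSize (to ∘ T) (to ε))
        (λ l → ℕₚ.≤-antisym (along l (to ε)) (along (to ε) l))
        where
        along : ∀ l l′ → fiberSize (to ∘ T) l ≤ fiberSize (to ∘ T) l′
        along l l′ = subst₂ _≤_
          (fiberSize-map (shift-injective y) (to ∘ T) (λ j → to (T j ∙ y)) (λ j → cong (λ v → to (v ∙ y)) (≡.sym (strictlyInverseʳ (T j)))) l)
          (cong (fiberSize (to ∘ T)) (shift-transitive l l′)) (le y (shift y l))
          where y = from l ⁻¹ ∙ from l′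

    -- Genericity of the matrix is condensed in the hypothesis: the profiles of this one matrix are
    -- stable under translation.
    divisible : (∀ y {d e} (τ : Fin d → C) (σ : Fin e → Edge) → Profile τ σ M → Profile (λ j → τ j ∙ y) (λ j → shiftᴱ y (σ j)) M) →
                (+ order) ∣ m
    divisible translate = subst ((+ order) ∣_)
      (≡.sym (≡.trans m≡ (cong₂ _⊖_ (proj₂ e-multiple) (proj₂ d-multiple))))
      (⊖-divisible order (proj₁ e-multiple) (proj₁ d-multiple))
      where
      optimal : ∃ λ d → Optimal d × (∀ d′ → Optimal d′ → d ≤ d′)
      optimal with U , dΓ , dU , dimΓ , dim , m≡ ← proj₁ max = least-exists em Optimal (U , dΓ , dimΓ , dim , m≡)
      U₀ = proj₁ (proj₁ (proj₂ optimal))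
      e₀ = proj₁ (proj₂ (proj₁ (proj₂ optimal)))
      dimΓ₀ = proj₁ (proj₂ (proj₂ (proj₁ (proj₂ optimal))))
      dim₀ = proj₁ (proj₂ (proj₂ (proj₂ (proj₁ (proj₂ optimal)))))
      m≡₀ = proj₂ (proj₂ (proj₂ (proj₂ (proj₁ (proj₂ optimal)))))
      open Homogenization (homogenize U₀)
      d≤d₀ : d ≤ proj₁ optimal
      d≤d₀ = V.dimension-bound dim₀ b b∈U b-ind
      -- Homogenizing the least maximizer does not raise the dimension or lower that of `Γ`, so the
      -- result is again a maximizer, now with explicit lists `τ` and `σ`.
      m≡ : m ≡ e ⊖ d
      m≡ = ℤₚ.≤-antisym
        (subst (ℤ._≤ e ⊖ d) (≡.sym m≡₀) (+≤+⇒⊖≤⊖ {e₀} {proj₁ optimal} {e} {d} (ℕₚ.+-mono-≤ (dim-Γ-≤ dimΓ₀) d≤d₀)))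
        (excess-≤ (V.span b) dim-Γ-span dim-span)
      module Translated (y : C) where
        pair′ = profile⇒pair (translate y τ σ (pair⇒profile pair))
        module P = HomogeneousPair pair′
        dimΓ′ = E.dimension E.bounded (Subspace.member (Γ (V.span P.b)))
        -- The translated span also has dimension `d`, and the independent family `P.s` shows that
        -- its `Γ` has dimension at least `e`; hence it lies in the maximizer of least dimension.
        contained : V.Span P.b ⊆ V.Span b
        contained {h} = least-maximizer-⊆ (V.span b) (V.span P.b) dim-Γ-span dim-span m≡ (proj₂ dimΓ′) P.dim-span
          (E.dimension-bound (proj₂ dimΓ′) P.s P.s∈Γ P.s-ind) (λ d′ opt → ℕₚ.≤-trans d≤d₀ (proj₂ (proj₂ optimal) d′ opt)) {h}
        fibersV : ∀ l → fiberSize (λ j → to (τ j ∙ y)) l ≤ fiberSize (to ∘ τ) l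
        fibersV = V.fiberSize-≤ to b (to ∘ τ) (λ j v v≢ → b-hom j v (v≢ ∘ cong to))
          P.b (λ j → to (τ j ∙ y)) (λ j v v≢ → P.b-hom j v (v≢ ∘ cong to)) P.b-ind (λ j → contained {P.b j} (V.∈-span P.b j))
        -- By `contained`, the family `P.s` lies in `Γ (V.span b)` and thus in the span of `s`; the
        -- degree of an edge is its tail.
        fibersE : ∀ l → fiberSize (λ j → to (tail (σ j) ∙ y)) l ≤ fiberSize (λ j → to (tail (σ j))) l
        fibersE = E.fiberSize-≤ (to ∘ tail) s (λ j → to (tail (σ j))) (λ j e e≢ → s-hom j e (e≢ ∘ cong (to ∘ tail)))
          P.s (λ j → to (tail (σ j) ∙ y)) (λ j e e≢ → P.s-hom j e (e≢ ∘ cong (to ∘ tail))) P.s-ind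
          (λ j → HasDimension.spanning dim-Γ-span (P.s j) (Γ-mono {V.span P.b} {V.span b} (λ {h} → contained {h}) {P.s j} (P.s∈Γ j)))
      d-multiple = equal-fibers τ Translated.fibersV
      e-multiple = equal-fibers (tail ∘ σ) Translated.fibersE

-- Matrices at which every profile has its generic truth value

module GenericPoint {a c ℓ} (𝔽 : CommutativeRing c ℓ) (isField : IsField 𝔽)
         (closed : IsAlgebraicallyClosed 𝔽) (em : ExcludedMiddle (lsuc (a ⊔ c ⊔ ℓ)))
         (𝒢 : FiniteGroup a) (g : Fin 2 → FiniteGroup.Carrier 𝒢)
         (L : Subgraph (CayleyBigraph 𝒢 g)) (k : ℕ) where

  private
    em′ : ExcludedMiddle (a ⊔ c ⊔ ℓ)
    em′ = lower-em (a ⊔ c ⊔ ℓ) (lsuc (a ⊔ c ⊔ ℓ)) em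

  open Genericity {a} 𝔽 isField closed em′
  open Profiles 𝔽 isField closed em′ 𝒢 g L k
  open FiniteGroup 𝒢 using (order; _∙_) renaming (Carrier to C)
  open FiniteGraph (CayleyBigraph 𝒢 g) using (Edge; V-finite; E-finite; ∣V∣; ∣E∣)
  private module Max = MaximumExcess 𝔽 isField closed em 𝒢 g L k

  Decides : ∀ {d e} (τ : Fin d → C) (σ : Fin e → Edge) → Pred Matrix′ (a ⊔ c ⊔ ℓ)
  Decides τ σ M = (Profile τ σ M → Generic (Profile τ σ)) × (Generic (Profile τ σ) → Profile τ σ M)

  Decides-resp : ∀ {d e} {τ τ′ : Fin d → C} {σ σ′ : Fin e → Edge} M → (∀ j → τ j ≡ τ′ j) → (∀ j → σ j ≡ σ′ j) →
                 Decides τ σ M → Decides τ′ σ′ M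
  Decides-resp M τ≗ σ≗ (out , into) =
    (λ h → generic-map (λ M → Profile-resp M τ≗ σ≗) (out (Profile-resp M (≡.sym ∘ τ≗) (≡.sym ∘ σ≗) h))) ,
    (λ h → Profile-resp M τ≗ σ≗ (into (generic-map (λ M → Profile-resp M (≡.sym ∘ τ≗) (≡.sym ∘ σ≗)) h)))

  generic-Decides : ∀ {d e} (τ : Fin d → C) (σ : Fin e → Edge) → Generic (Decides τ σ)
  generic-Decides τ σ = tame-generic (tame-Profile τ σ)

  Decided : Pred Matrix′ (a ⊔ c ⊔ ℓ)
  Decided M = ∀ d → d ≤ ∣V∣ ℕ.* order → ∀ e → e ≤ ∣E∣ ℕ.* order → ∀ (τ : Fin d → C) (σ : Fin e → Edge) → Decides τ σ M

  generic-Decided : Generic Decided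
  generic-Decided = generic-∀≤ (∣V∣ ℕ.* order) λ d → generic-∀≤ (∣E∣ ℕ.* order) λ e →
    generic-∀→ V-finite (λ M τ≗ h σ → Decides-resp M τ≗ (λ _ → refl) (h σ)) λ τ →
    generic-∀→ E-finite (λ M σ≗ → Decides-resp M (λ _ → refl) σ≗) (generic-Decides τ)

  private
    -- The profile may belong to another matrix `M′`; it serves to place `d` and `e` within the
    -- bounds of `Decided`.
    decides : ∀ M → Decided M → ∀ {d e} (τ : Fin d → C) (σ : Fin e → Edge) → ∀ M′ → Profile τ σ M′ → Decides τ σ M
    decides M decided {d} {e} τ σ M′ profile =
      decided d (proj₁ (Max.profile-bounded M′ profile)) e (proj₂ (Max.profile-bounded M′ profile)) τ σ

  profile-out : ∀ M → Decided M → ∀ {d e} (τ : Fin d → C) (σ : Fin e → Edge) → Profile τ σ M → Generic (Profile τ σ)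
  profile-out M decided τ σ profile = proj₁ (decides M decided τ σ M profile) profile

  profile-in : ∀ M → Decided M → ∀ {d e} (τ : Fin d → C) (σ : Fin e → Edge) → Generic (Profile τ σ) → Profile τ σ M
  profile-in M decided τ σ gen = proj₂ (decides M decided τ σ (proj₁ (generic-nonempty gen)) (proj₂ (generic-nonempty gen))) gen

  module _ (M* : Matrix′) (decided : Decided M*) (m : ℤ) (maximum : IsMaximumExcess 𝔽 (𝒦 𝔽 𝒢 g L k M*) m) where

    order-divides : (+ order) ∣ m
    order-divides = Max.divisible M* maximum λ y τ σ profile →
      profile-in M* decided (λ j → τ j ∙ y) (λ j → shiftᴱ y (σ j))
        (generic-Profile-translate y {τ = τ} {σ} (profile-out M* decided τ σ profile))

    Excess≥ : ℤ → Pred Matrix′ (lsuc (a ⊔ c ⊔ ℓ))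
    Excess≥ n M = IsSurjective 𝔽 𝒢 g L k M × ∃ λ e → IsMaximumExcess 𝔽 (𝒦 𝔽 𝒢 g L k M) e × n ℤ.≤ e

    -- A profile that attains `m` at `M*` holds generically, and wherever it holds the maximum
    -- excess is at least `m`.
    dense : Generic (IsSurjective 𝔽 𝒢 g L k) → ZariskiDense 𝔽 (Excess≥ m)
    dense surjective = go (Max.maximal-profile M* maximum)
      where
      go : (∃ λ d → ∃ λ e → ∃ λ (τ : Fin d → C) → ∃ λ (σ : Fin e → Edge) → Profile τ σ M* × m ℤ.≤ e ⊖ d) → ZariskiDense 𝔽 (Excess≥ m)
      go (d , e , τ , σ , profile , m≤) = generic-dense (generic-map enough (generic-× surjective (profile-out M* decided τ σ profile)))
        where
        enough : ∀ M → IsSurjective 𝔽 𝒢 g L k M × Profile τ σ M → Excess≥ m M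
        enough M (surj , h) = surj , proj₁ (Max.maximum-exists M) , proj₂ (Max.maximum-exists M) ,
          ℤₚ.≤-trans m≤ (Max.profile-excess M (proj₂ (Max.maximum-exists M)) h)

    -- A dense set meets the decided matrices, and all of these have the same profiles; so a maximal
    -- profile found there occurs at `M*` as well and has excess at most `m`.
    largest : ∀ n → ZariskiDense 𝔽 (Excess≥ n) → n ℤ.≤ m
    largest n n-dense = decidable-stable (n ℤₚ.≤? m) λ n≰m →
      dense-meets-generic {S = Excess≥ n} {P = Decided} n-dense generic-Decided λ (M , (_ , e , max , n≤e) , decidedᴹ) →
        n≰m (ℤₚ.≤-trans n≤e (compare M decidedᴹ (Max.maximal-profile M max)))
      where
      compare : ∀ M → Decided M → ∀ {e′} → (∃ λ d → ∃ λ e → ∃ λ (τ : Fin d → C) → ∃ λ (σ : Fin e → Edge) → Profile τ σ M × e′ ℤ.≤ e ⊖ d) → e′ ℤ.≤ m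
      compare M decidedᴹ (_ , _ , τ , σ , profile , e≤) =
        ℤₚ.≤-trans e≤ (Max.profile-excess M* maximum (profile-in M* decided τ σ (profile-out M decidedᴹ τ σ profile)))

theorem2 : ∀ {a c ℓ} → ExcludedMiddle (lsuc (a ⊔ c ⊔ ℓ)) →
    (𝔽 : CommutativeRing c ℓ) → IsField 𝔽 → IsAlgebraicallyClosed 𝔽 →
    (𝒢 : FiniteGroup a) (g : Fin 2 → FiniteGroup.Carrier 𝒢)
    (L : Subgraph (CayleyBigraph 𝒢 g)) (k : ℕ) → k ≤ρ L →
    ∃ λ m → IsGenericMaximumExcess 𝔽 𝒢 g L k m × (+ FiniteGroup.order 𝒢) ∣ m
theorem2 {a} {c} {ℓ} em 𝔽 isField closed 𝒢 g L k k≤ρ = conclude (generic-nonempty generic-Decided)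
  where
  em′ : ExcludedMiddle (a ⊔ c ⊔ ℓ)
  em′ = lower-em (a ⊔ c ⊔ ℓ) (lsuc (a ⊔ c ⊔ ℓ)) em
  open Genericity {a} 𝔽 isField closed em′ using (Generic; generic-nonempty)
  open GenericPoint 𝔽 isField closed em 𝒢 g L k
  surjective : Generic (IsSurjective 𝔽 𝒢 g L k)
  surjective = GenericSurjectivity.generic-surjective 𝔽 isField closed em′ 𝒢 g L k k≤ρ
  conclude : ∃ Decided → ∃ λ m → IsGenericMaximumExcess 𝔽 𝒢 g L k m × (+ FiniteGroup.order 𝒢) ∣ m
  conclude (M , decided) = at (MaximumExcess.maximum-exists 𝔽 isField closed em 𝒢 g L k M)
    where
    at : ∃ (IsMaximumExcess 𝔽 (𝒦 𝔽 𝒢 g L k M)) → ∃ λ m → IsGenericMaximumExcess 𝔽 𝒢 g L k m × (+ FiniteGroup.order 𝒢) ∣ m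
    -- The generic maximum excess is the maximum excess at a single decided matrix `M`, which gives
    -- its existence together with its value.
    at (m , maximum) = m , (dense M decided m maximum surjective , largest M decided m maximum) , order-divides M decided m maximum
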